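{- Let $G$ be a plane graph with outer face boundary $\partial G$. Let $S \subseteq V(\partial G)$ be a set of at most three consecutive vertices, and let $I \subseteq V(\partial G) \setminus S$ be a set that is independent in $G$. Define $f \colon V(G - S) \to \mathbb{Z}$ by $$f(v) = \begin{cases} 4 - \deg_S(v) & \text{if } v \in V(G)\setminus V(\partial G),\\ 3 - \deg_S(v) & \text{if } v \in V(\partial G) \setminus (S \cup I),\\ 2 - \deg_S(v) & \text{if } v \in I.\end{cases}$$ Then the graph $G - S$ is weakly $f$-degenerate unless there exists a vertex $v \in I$ with $3$ neighbors in $S$.
   Context: All graphs are finite and simple. For a set of vertices $S$ and a vertex $v$, $\deg_S(v)$ is the number of neighbors of $v$ in $S$. For a plane graph $G$, its outer face boundary $\partial G$ is the (not necessarily induced) subgraph whose vertices and edges are exactly those incident to the outer face of $G$. Vertices in a set $S \subseteq V(\partial G)$ are consecutive if $S = \varnothing$ or the induced subgraph $(\partial G)[S]$ is connected. Let $\mathsf{blank}$ be a special symbol distinct from every vertex. For a graph $H$, a function $g \colon V(H) \to \mathbb{Z}$, a vertex $u \in V(H)$ and $w \in N_H(u) \cup \{\mathsf{blank}\}$, define $\mathsf{DelSave}(H,g,u,w) := (H-u, g')$, where for $v \in V(H-u)$: $g'(v) = g(v)$ if $v \notin N_H(u)$ or ($v = w$ and $g(u) > g(w)$), and $g'(v) = g(v)-1$ otherwise. An application is legal if $g'$ is nonnegative. $H$ is weakly $g$-degenerate if, starting from $(H,g)$, all vertices can be removed by a sequence of legal applications of $\mathsf{DelSave}$. (Note that the condition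 that no vertex of $I$ has $3$ neighbors in $S$ is equivalent to $f$ being nonnegative.) -}

module Defs where

open import Data.Bool using (Bool; true; false; _∧_; _∨_; not; if_then_else_; T)
open import Data.Nat using (ℕ; zero; suc; _+_; _*_; _≤ᵇ_)
open import Data.Fin using (Fin; toℕ; _≟_)
open import Data.Integer using (ℤ; +_; _-_; _≤_; _<?_)
open import Data.Maybe using (Maybe; just; nothing)
open import Data.Product using (_×_; _,_; proj₁; proj₂; ∃; ∃-syntax)
open import Data.Unit using (⊤)
open import Relation.Nullary using (does)
open import Relation.Binary.PropositionalEquality using (_≡_)

∑ : {n : ℕ} → (Fin n → ℕ) → ℕ
∑ {zero}  f = 0
∑ {suc n} f = f Fin.zero + ∑ {n} (λ i → f (Fin.suc i))

#_ : {n : ℕ} → (Fin n → Bool) → ℕ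
# p = ∑ (λ i → if p i then 1 else 0)

#₂_ : {n : ℕ} → (Fin n → Fin n → Bool) → ℕ
#₂ p = ∑ (λ u → # (p u))

anyV : {n : ℕ} → (Fin n → Bool) → Bool
anyV {zero}  p = false
anyV {suc n} p = p Fin.zero ∨ anyV {n} (λ i → p (Fin.suc i))

allBelow : ℕ → (ℕ → Bool) → Bool
allBelow zero    p = true
allBelow (suc m) p = allBelow m p ∧ p m

iter : {A : Set} → (A → A) → ℕ → A → A
iter f zero    x = x
iter f (suc k) x = f (iter f k x)

record Graph (n : ℕ) : Set where
  field
    adj    : Fin n → Fin n → Bool
    sym    : ∀ u v → adj u v ≡ adj v u
    irrefl : ∀ u → adj u u ≡ false

reachB : {n : ℕ} → (Fin n → Fin n → Bool) → ℕ → Fin n → Fin n → Bool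
reachB E zero    u v = does (u ≟ v)
reachB E (suc k) u v = reachB E k u v ∨ anyV (λ w → reachB E k u w ∧ E w v)

-- u and v lie in the same connected component of the relation E
-- (a walk, if it exists, can be taken of length < n).
connB : {n : ℕ} → (Fin n → Fin n → Bool) → Fin n → Fin n → Bool
connB {n} E = reachB E n

-- Plane graphs, combinatorially (rotation systems of genus 0 on every
-- component, together with a choice of the outer face).

-- A rotation system: rot u is a cyclic permutation of N(u).
-- Darts are ordered pairs (u , v) with uv ∈ E(G); the face-tracing
-- permutation is φ (u , v) = (v , rot v u).
module _ {n : ℕ} (G : Graph n) (rot : Fin n → Fin n → Fin n) where
  open Graph G

  φ : Fin n × Fin n → Fin n × Fin n
  φ (u , v) = (v , rot v u)

  code : Fin n × Fin n → ℕ
  code (u , v) = toℕ u * n + toℕ v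

  -- the dart (u , v) is the least dart (w.r.t. code) of its φ-orbit
  -- (orbits have length ≤ n * n)
  orbitRep : Fin n → Fin n → Bool
  orbitRep u v = allBelow (n * n) (λ k → code (u , v) ≤ᵇ code (iter φ k (u , v)))

  -- vertices, darts (= 2 · edges) and faces (= φ-orbits) of the
  -- component containing r
  Vc : Fin n → ℕ
  Vc r = # connB adj r

  Dc : Fin n → ℕ
  Dc r = #₂ (λ u v → connB adj r u ∧ adj u v)

  Fc : Fin n → ℕ
  Fc r = #₂ (λ u v → connB adj r u ∧ adj u v ∧ orbitRep u v)

  SameFace : Fin n × Fin n → Fin n × Fin n → Set
  SameFace d d' = ∃[ k ] iter φ k d ≡ d'

record PlaneGraph (n : ℕ) : Set where
  field
    graph : Graph n
  open Graph graph public
  field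
    rot     : Fin n → Fin n → Fin n
    rot-adj : ∀ u v → T (adj u v) → T (adj u (rot u v))
    rot-cyc : ∀ u v w → T (adj u v) → T (adj u w) → ∃[ k ] iter (rot u) k v ≡ w
    -- genus 0 on every component with an edge (Euler's formula
    -- V - E + F = 2, written as 2V + 2F = 2E + 4 with 2E = #darts);
    -- components consisting of an isolated vertex are trivially spherical
    euler   : ∀ r v → T (adj r v) →
              2 * Vc graph rot r + 2 * Fc graph rot r ≡ Dc graph rot r + 4
    -- the outer face: its darts, and the isolated vertices lying in it
    outerDart     : Fin n → Fin n → Bool
    outerIso      : Fin n → Bool
    outerDart-adj : ∀ u v → T (outerDart u v) → T (adj u v)
    outerDart-φ   : ∀ u v → T (outerDart u v) →
                    T (outerDart (proj₁ (φ graph rot (u , v))) (proj₂ (φ graph rot (u , v))))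
    outerDart-one : ∀ u v u' v' → T (outerDart u v) → T (outerDart u' v') →
                    T (connB adj u u') → SameFace graph rot (u , v) (u' , v')
    outerIso-iso  : ∀ v w → T (outerIso v) → adj v w ≡ false

  onOuter : Fin n → Bool
  onOuter v = outerIso v ∨ anyV (outerDart v)

  outerComp : Fin n → Bool
  outerComp r = anyV (λ x → connB adj r x ∧ onOuter x)

  field
    -- realizability of the nesting: a component not meeting the outer
    -- face must lie in a non-outer face of some component meeting it
    -- (this also forces at least one component to meet the outer face)
    nesting : ∀ r → outerComp r ≡ false →
              ∃[ u ] ∃[ v ] (T (adj u v) × outerDart u v ≡ false × outerComp u ≡ true)

  ∂V : Fin n → Bool
  ∂V = onOuter

  ∂E : Fin n → Fin n → Bool
  ∂E u v = outerDart u v ∨ outerDart v u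

-- Weak degeneracy (DelSave), on induced subgraphs of a graph given by
-- the Boolean adjacency relation A; the current graph is A restricted to
-- the vertices marked alive.

removeV : {n : ℕ} → (Fin n → Bool) → Fin n → (Fin n → Bool)
removeV alive u v = alive v ∧ not (does (v ≟ u))

-- w = nothing plays the role of blank
ValidSave : {n : ℕ} → (Fin n → Fin n → Bool) → (Fin n → Bool) → Fin n → Maybe (Fin n) → Set
ValidSave A alive u nothing  = ⊤
ValidSave A alive u (just w) = T (alive w ∧ A u w)

delSaveFun : {n : ℕ} → (Fin n → Fin n → Bool) → (Fin n → Bool) → (Fin n → ℤ) →
             Fin n → Maybe (Fin n) → Fin n → ℤ
delSaveFun A alive g u w v =
  if (alive v ∧ A u v) ∧ not (saved w) then g v - + 1 else g v
  where
  saved : Maybe (Fin _) → Bool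
  saved nothing   = false
  saved (just w') = does (v ≟ w') ∧ does (g w' <? g u)

data WeaklyDeg {n : ℕ} (A : Fin n → Fin n → Bool) : (Fin n → Bool) → (Fin n → ℤ) → Set where
  finished : ∀ {alive g} → (∀ v → alive v ≡ false) → WeaklyDeg A alive g
  delSave  : ∀ {alive g} (u : Fin n) → T (alive u) →
             (w : Maybe (Fin n)) → ValidSave A alive u w →
             (∀ v → T (removeV alive u v) → + 0 ≤ delSaveFun A alive g u w v) →
             WeaklyDeg A (removeV alive u) (delSaveFun A alive g u w) →
             WeaklyDeg A alive g

degIn : {n : ℕ} → (Fin n → Fin n → Bool) → (Fin n → Bool) → Fin n → ℕ
degIn A S v = # (λ x → S x ∧ A v x)

Consecutive : {n : ℕ} → PlaneGraph n → (Fin n → Bool) → Set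
Consecutive G S =
  (∀ v → T (S v) → T (PlaneGraph.∂V G v)) ×
  (∀ a b → T (S a) → T (S b) →
     T (connB (λ u v → S u ∧ S v ∧ PlaneGraph.∂E G u v) a b))

-- the function f of the theorem (its values on S are irrelevant)
fBound : {n : ℕ} → PlaneGraph n → (S I : Fin n → Bool) → Fin n → ℤ
fBound G S I v =
  if PlaneGraph.∂V G v
  then (if I v then + 2 - + d else + 3 - + d)
  else + 4 - + d
  where d = degIn (PlaneGraph.adj G) S v

{-# OPTIONS --safe #-}
-- Delete the vertices of S first. What is left is drawn in a disc whose boundary
-- word, read cyclically, is N(s₁) N(s₂) N(s₃) P, where P is the rest of the outer
-- boundary, and f drops below 4 by one for each of these segments that contains
-- the vertex, and once more on I. Deleting a boundary vertex replaces it in the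
-- word by its neighbours, and two corners of one vertex cut the disc into
-- independent parts. Hence a chord, or a path of length two, between boundary
-- points reduces the problem to smaller ones (the separating vertices take the
-- role of S), unless it is blocked by a vertex of I adjacent to all of them.
-- Otherwise let v₁, v₂, … be the vertices of P next to s₃. One either forgets s₃,
-- moving v₁ into I if it is adjacent to s₃, or, if v₁ or v₂ is in I, removes one
-- to three of v₁, v₂, v₃, saving a neighbour in I, and moves the vertices that
-- lose two into I; the reductions keep I independent.
--
-- Genus 0 is used only to build the disc: merging all faces into the outer one
-- deletes F - 1 edges, so Euler's formula leaves V - 1 edges, and the boundary
-- walk of the merged face goes around a tree.
module Submission where

open import Defs
open import Data.Bool using (Bool; true; false; T; _∧_; not; if_then_else_; _∨_)
open import Data.Empty using (⊥; ⊥-elim)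
open import Data.Fin as Fin using (Fin; _≟_; toℕ; combine)
import Data.Fin.Properties as FinP
open import Data.Integer as ℤ using (ℤ; +_; +≤+)
import Data.Integer.Properties as ℤP
open import Data.List using (List; []; _∷_; _++_; [_]; filter; length; allFin; map; initLast; _∷ʳ′_; applyUpTo)
open import Data.List.Membership.Propositional using (_∈_; _∉_; find; lose)
open import Data.List.Membership.Propositional.Properties using (∈-++⁺ˡ; ∈-++⁺ʳ; ∈-++⁻; ∈-filter⁺; ∈-filter⁻; ∈-∃++; ∈-insert; ∈-allFin; ∈-map⁺; ∈-map⁻; ∈-applyUpTo⁺; ∈-applyUpTo⁻)
open import Data.List.Properties using (++-assoc; ++-identityʳ; filter-notAll; length-filter; filter-++; filter-accept; ∷-injectiveʳ; length-++; length-map; length-tabulate; ∷-injectiveˡ)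
open import Data.List.Relation.Binary.Permutation.Propositional using (_↭_; ↭-refl; ↭-sym; ↭-trans; ↭-reflexive; prep; ↭⇒↭ₛ)
open import Data.List.Relation.Binary.Permutation.Propositional.Properties using (∈-resp-↭; ++⁺ˡ; ++⁺ʳ; ++-comm; shift; All-resp-↭; shifts; ↭-length)
import Data.List.Relation.Binary.Permutation.Setoid.Properties as PermS
open import Data.List.Relation.Binary.Sublist.Propositional using (_⊆_; []; _∷ʳ_; _∷_; ⊆-refl; from∈)
open import Data.List.Relation.Binary.Sublist.Propositional.Properties using (filter⁺; filter-⊆; ++⁺) renaming (++⁺ˡ to ⊆-++⁺ˡ)
open import Data.List.Relation.Unary.All as All using (All; []; _∷_)
import Data.List.Relation.Unary.All.Properties as AllP
open import Data.List.Relation.Unary.AllPairs using ([]; _∷_)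
open import Data.List.Relation.Unary.Any as Any using (here; there; any?; Any)
open import Data.List.Relation.Unary.Unique.Propositional using (Unique)
import Data.List.Relation.Unary.Unique.Propositional.Properties as UniqueP
open import Data.Maybe using (Maybe; just; nothing)
open import Data.Nat as ℕ using (ℕ; zero; suc; _+_; _≤_; _<_; z≤n; s≤s; s≤s⁻¹; _*_; _∸_)
open import Data.Nat.Properties using (≤-refl; ≤-trans; <⇒≤; ≮⇒≥; +-monoʳ-≤; +-suc; +-comm; +-identityʳ; _<?_; m≤m+n; ≤-reflexive; +-mono-≤; module ≤-Reasoning; +-assoc; n≤1+n; m≤n+m; 1+n≰n; m≤n⇒m<n∨m≡n; ≤-antisym; +-monoˡ-<; *-comm; m∸n+n≡m; m∸n≤m; ≤-<-trans; <-≤-trans; n<1+n; ≰⇒>; _≤?_; ≤ᵇ⇒≤; +-cancelʳ-≤)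
open import Data.Nat.Tactic.RingSolver using (solve-∀)
open import Data.Product using (_×_; _,_; proj₁; proj₂; ∃-syntax; map₂)
open import Data.Product.Properties using (,-injectiveʳ; ≡-dec)
open import Data.Sum as Sum using (_⊎_; inj₁; inj₂; [_,_]′)
open import Data.Unit using (tt)
open import Function using (_∘_; id; case_of_)
open import Relation.Binary.PropositionalEquality using (_≡_; _≢_; refl; sym; trans; cong; subst; setoid; subst₂; cong₂)
open import Relation.Nullary using (¬_; yes; no; does; Dec; ¬?)
open import Relation.Nullary.Decidable using (_×-dec_)

-- Drawings in a disc

-- The bookkeeping uses the loss `c = 4 - f`. A larger loss is a stronger claim, so every reduction
-- may round losses up. An instance offers three segments for deleted vertices, the boundary `P`,
-- and `I`. Three is what a separating path of length two needs, since its three vertices become the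
-- deleted vertices of the part cut off. Each of the five memberships costs one and the budget is
-- four, so the only possible overflow is a vertex of `I` in all three segments; this is why a
-- separation can be blocked, and why independence of `I` unblocks it from the other side.
-- Forgetting a deleted vertex does not shrink the graph, so the induction is lexicographic: first
-- the number of vertices, then the number of deleted vertices. No topology enters after the
-- construction of the drawing: a drawing is a term built by gluing, and cutting along a vertex is a
-- recursion on that term.

Disjoint : {A : Set} → List A → List A → Set
Disjoint xs ys = ∀ {x} → x ∈ xs → x ∈ ys → ⊥

module Discs {n : ℕ} (G : Graph n) where
  open Graph G using (adj; irrefl) renaming (sym to adj-sym)

  V : Set
  V = Fin n

  Adj : V → V → Set
  Adj u v = T (adj u v)

  Adj-sym : ∀ {u v} → Adj u v → Adj v u
  Adj-sym {u} {v} = subst T (adj-sym u v)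

  Adj-irrefl : ∀ {u} → ¬ Adj u u
  Adj-irrefl {u} = subst T (irrefl u)

  -- Disc A E w: the graph (A , E) is drawn in a closed disc, and w lists, in
  -- cyclic order, some of its corners on the boundary circle; a vertex may own
  -- several corners.
  data Disc : List V → List (V × V) → List V → Set where
    nil  : Disc [] [] []
    new  : ∀ v → Disc (v ∷ []) [] (v ∷ [])
    uni  : ∀ {A E w A' E' w'} → Disc A E w → Disc A' E' w' → Disjoint A A' →
           Disc (A ++ A') (E ++ E') (w ++ w')
    rot  : ∀ {A E a w} → Disc A E (a ∷ w) → Disc A E (w ++ [ a ])
    dup  : ∀ {A E a w} → Disc A E (a ∷ w) → Disc A E (a ∷ a ∷ w)
    edge : ∀ {A E a b w} → Adj a b → Disc A E (a ∷ b ∷ w) → Disc A ((a , b) ∷ E) (a ∷ b ∷ w)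
    hide : ∀ {A E a w} → Disc A E (a ∷ w) → Disc A E w

  word⊆ : ∀ {A E w u} → Disc A E w → u ∈ w → u ∈ A
  word⊆ (new v) p = p
  word⊆ (uni {A} {w = w} D D' _) p with ∈-++⁻ w p
  ... | inj₁ q = ∈-++⁺ˡ (word⊆ D q)
  ... | inj₂ q = ∈-++⁺ʳ A (word⊆ D' q)
  word⊆ (rot {w = w} D) p with ∈-++⁻ w p
  ... | inj₁ q = word⊆ D (there q)
  ... | inj₂ (here refl) = word⊆ D (here refl)
  word⊆ (dup D) (here q) = word⊆ D (here q)
  word⊆ (dup D) (there q) = word⊆ D q
  word⊆ (edge _ D) p = word⊆ D p
  word⊆ (hide D) p = word⊆ D (there p)

  edge⊆ : ∀ {A E w a b} → Disc A E w → (a , b) ∈ E → (a ∈ A) × (b ∈ A)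
  edge⊆ (uni {A} {E} D D' _) p with ∈-++⁻ E p
  ... | inj₁ q = let x , y = edge⊆ D q in ∈-++⁺ˡ x , ∈-++⁺ˡ y
  ... | inj₂ q = let x , y = edge⊆ D' q in ∈-++⁺ʳ A x , ∈-++⁺ʳ A y
  edge⊆ (rot D) p = edge⊆ D p
  edge⊆ (dup D) p = edge⊆ D p
  edge⊆ (edge _ D) (here refl) = word⊆ D (here refl) , word⊆ D (there (here refl))
  edge⊆ (edge _ D) (there p) = edge⊆ D p
  edge⊆ (hide D) p = edge⊆ D p

  rotate : ∀ {A E} x {y} → Disc A E (x ++ y) → Disc A E (y ++ x)
  rotate [] {y} D = subst (Disc _ _) (sym (++-identityʳ y)) D
  rotate (a ∷ x) {y} D =
    subst (Disc _ _) (++-assoc y [ a ] x) (rotate x (subst (Disc _ _) (++-assoc x y [ a ]) (rot D)))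

  -- The constructors act at the head of the word; as the word is cyclic, rotation carries them to
  -- any other place.
  at : ∀ {A E A' E'} q {x x' y} → (∀ {r} → Disc A E (x ++ r) → Disc A' E' (x' ++ r)) →
       Disc A E (q ++ x ++ y) → Disc A' E' (q ++ x' ++ y)
  at {A} {E} {A'} {E'} q {x} {x'} {y} f D =
    rotate (x' ++ y) (subst (Disc A' E') (sym (++-assoc x' y q))
      (f (subst (Disc A E) (++-assoc x y q) (rotate q D))))

  insert : ∀ {A E A' E'} q {w y} → Disc A E (q ++ y) → Disc A' E' w → Disjoint A A' →
           Disc (A ++ A') (E ++ E') (q ++ w ++ y)
  insert q {w} {y} D D' dj =
    subst (Disc _ _) (++-assoc q w y)
      (rotate y (subst (Disc _ _) (++-assoc y q w) (uni (rotate q D) D' dj)))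

  module _ (v : V) where

    -- The sectors cut out by the corners of v, read along a boundary word whose
    -- first corner of v is preceded by p and whose current sector starts with q.
    -- Deleting v from a sector exposes its neighbours there, collected in N.
    data Sec (p : List V) : List V → List (V × V) → List V → List V → List V → Set where
      end : ∀ {A E Y q} → Disc A E (q ++ p ++ Y) → Sec p A E Y q []
      cut : ∀ {A E Y q A' E' N w} → Disc A E (q ++ Y) → Sec p A' E' N [] w → Disjoint A A' →
            Sec p (A ++ A') (E ++ E') (Y ++ N) q (v ∷ w)
      oth : ∀ {A E N q u w} → u ≢ v → Sec p A E N (q ++ [ u ]) w → Sec p A E N q (u ∷ w)

    data Fst : List V → List (V × V) → List V → List V → List V → Set where
      hit  : ∀ {A E N p w} → Sec p A E N [] w → Fst A E N p (v ∷ w)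
      skip : ∀ {A E N p u w} → u ≢ v → Fst A E N (p ++ [ u ]) w → Fst A E N p (u ∷ w)

    castF : ∀ {A E N p p' w} → p ≡ p' → Fst A E N p w → Fst A E N p' w
    castF refl f = f

    disj-++ : ∀ {A B C : List V} → Disjoint A B → Disjoint A C → Disjoint A (B ++ C)
    disj-++ {B = B} f g a b with ∈-++⁻ B b
    ... | inj₁ x = f a x
    ... | inj₂ x = g a x

    -- Only the last sector wraps around the end of the word. Whatever happens at the head of the
    -- word, before the first corner of `v`, concerns this sector and leaves the others alone.
    endMap : ∀ {p p' A⁺ E⁺ N⁺} →
      (∀ {A E} q Y → Disjoint A A⁺ → Disc A E (q ++ p ++ Y) →
        ∃[ A₁ ] ∃[ E₁ ] ∃[ Y₁ ] (Disc A₁ E₁ (q ++ p' ++ Y₁) × (A₁ ↭ A ++ A⁺) × (E₁ ↭ E ++ E⁺) × (Y₁ ↭ Y ++ N⁺))) →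
      ∀ {A E N q w} → Disjoint A A⁺ → Sec p A E N q w →
      ∃[ A₁ ] ∃[ E₁ ] ∃[ N₁ ] (Sec p' A₁ E₁ N₁ q w × (A₁ ↭ A ++ A⁺) × (E₁ ↭ E ++ E⁺) × (N₁ ↭ N ++ N⁺))
    endMap op dj (end {Y = Y} {q} D) = let _ , _ , _ , D₁ , a , e , y = op q Y dj D in _ , _ , _ , end D₁ , a , e , y
    endMap op dj (oth u≢v s) = let _ , _ , _ , s₁ , a , e , y = endMap op dj s in _ , _ , _ , oth u≢v s₁ , a , e , y
    endMap {A⁺ = A⁺} {E⁺} {N⁺} op dj (cut {A} {E} {Y} {A' = A'} {E'} {N} D s dj') =
      let _ , _ , _ , s₁ , a , e , y = endMap op (dj ∘ ∈-++⁺ʳ A) s in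
      _ , _ , _ , cut D s₁ (λ i j → disj-++ dj' (dj ∘ ∈-++⁺ˡ) i (∈-resp-↭ a j)) ,
      ↭-trans (++⁺ˡ A a) (↭-reflexive (sym (++-assoc A A' A⁺))) ,
      ↭-trans (++⁺ˡ E e) (↭-reflexive (sym (++-assoc E E' E⁺))) ,
      ↭-trans (++⁺ˡ Y y) (↭-reflexive (sym (++-assoc Y N N⁺)))

    fstMap : ∀ {x x' E⁺} →
      (∀ {A E r} → Disc A E (x ++ r) → Disc A (E⁺ ++ E) (x' ++ r)) →
      ∀ {A E N p w} → Fst A E N (x ++ p) w →
      ∃[ E₁ ] ∃[ A₁ ] ∃[ N₁ ] (Fst A₁ E₁ N₁ (x' ++ p) w × (A₁ ↭ A) × (E₁ ↭ E⁺ ++ E) × (N₁ ↭ N))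
    fstMap {x} {x'} {E⁺} op {p = p} (skip {A} {E} {N} {u = u} {w} u≢v f)
      with fstMap {x} {x'} op {p = p ++ [ u ]} (subst (λ z → Fst A E N z w) (++-assoc x p [ u ]) f)
    ... | _ , _ , _ , f₁ , a , e , y = _ , _ , _ , skip u≢v (subst (λ z → Fst _ _ _ z w) (sym (++-assoc x' p [ u ])) f₁) , a , e , y
    fstMap {x} {x'} {E⁺} op {p = p} (hit {A} {E} {N} s)
      with endMap {x ++ p} {x' ++ p} {[]} {E⁺} {[]}
             (λ {A} {E} q Y _ D → A , E⁺ ++ E , Y ,
               subst (λ z → Disc A (E⁺ ++ E) (q ++ z)) (sym (++-assoc x' p Y))
                 (at q op (subst (λ z → Disc A E (q ++ z)) (++-assoc x p Y) D)) ,
               ↭-reflexive (sym (++-identityʳ A)) , ++-comm E⁺ E , ↭-reflexive (sym (++-identityʳ Y)))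
             (λ _ ()) s
    ... | E₁ , A₁ , N₁ , s₁ , a , e , y = A₁ , E₁ , N₁ , hit s₁ ,
          ↭-trans a (↭-reflexive (++-identityʳ A)) , ↭-trans e (++-comm E E⁺) , ↭-trans y (↭-reflexive (++-identityʳ N))

    -- The edge from v to the first corner b of a sector exposes b.
    headMap : ∀ {b A E N q w} → Sec [] A E N (b ∷ q) w → ∃[ N₁ ] (Sec [] A E N₁ (b ∷ q) w × (N₁ ↭ b ∷ N))
    headMap (oth u≢v s) = let _ , s₁ , y = headMap s in _ , oth u≢v s₁ , y
    headMap {b} {q = q} (end {A} {E} {Y = Y} D) =
      Y ++ [ b ] , end (subst (Disc A E) (++-assoc (b ∷ q) Y [ b ]) (rot (dup D))) , ++-comm Y [ b ]
    headMap {b} {q = q} (cut {A} {E} {Y = Y} {N = N} D s dj) =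
      (Y ++ [ b ]) ++ N , cut (subst (Disc A E) (++-assoc (b ∷ q) Y [ b ]) (rot (dup D))) s dj ,
      ++⁺ʳ N (++-comm Y [ b ])

    appendW : ∀ {p A E N q w A' E' w'} → Disjoint A A' → Disc A' E' w' → v ∉ w' →
              Sec p A E N q w → ∃[ A₁ ] ∃[ E₁ ] (Sec p A₁ E₁ N q (w ++ w') × (A₁ ↭ A ++ A') × (E₁ ↭ E ++ E'))
    appendW {p} {q = q} {w' = w'} dj D' v∉ (end {Y = Y} D) =
      _ , _ , oths q w' v∉ (end (subst (Disc _ _) (sym (++-assoc q w' (p ++ Y))) (insert q D D' dj))) , ↭-refl , ↭-refl
      where
      oths : ∀ {A E N} q w → v ∉ w → Sec p A E N (q ++ w) [] → Sec p A E N q w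
      oths q [] _ s = subst (λ z → Sec p _ _ _ z []) (++-identityʳ q) s
      oths q (u ∷ w) v∉ s = oth (λ e → v∉ (here (sym e)))
        (oths (q ++ [ u ]) w (v∉ ∘ there) (subst (λ z → Sec p _ _ _ z []) (sym (++-assoc q [ u ] w)) s))
    appendW dj D' v∉ (oth u≢v s) = let _ , _ , s₁ , a , e = appendW dj D' v∉ s in _ , _ , oth u≢v s₁ , a , e
    appendW {A' = A₂} {E₂} dj D' v∉ (cut {A} {E} {A' = A'} {E'} D s dj') =
      let _ , _ , s₁ , a , e = appendW (dj ∘ ∈-++⁺ʳ A) D' v∉ s in
      _ , _ , cut D s₁ (λ i j → disj-++ dj' (dj ∘ ∈-++⁺ˡ) i (∈-resp-↭ a j)) ,
      ↭-trans (++⁺ˡ A a) (↭-reflexive (sym (++-assoc A A' A₂))) ,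
      ↭-trans (++⁺ˡ E e) (↭-reflexive (sym (++-assoc E E' E₂)))

    appendF : ∀ {p A E N w A' E' w'} → Disjoint A A' → Disc A' E' w' → v ∉ w' →
              Fst A E N p w → ∃[ A₁ ] ∃[ E₁ ] (Fst A₁ E₁ N p (w ++ w') × (A₁ ↭ A ++ A') × (E₁ ↭ E ++ E'))
    appendF dj D' v∉ (hit s) = let _ , _ , s₁ , a , e = appendW dj D' v∉ s in _ , _ , hit s₁ , a , e
    appendF dj D' v∉ (skip u≢v f) = let _ , _ , f₁ , a , e = appendF dj D' v∉ f in _ , _ , skip u≢v f₁ , a , e

    skips : ∀ {A E N} p w {w'} → v ∉ w → Fst A E N (p ++ w) w' → Fst A E N p (w ++ w')
    skips p [] _ f = subst (λ z → Fst _ _ _ z _) (++-identityʳ p) f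
    skips p (u ∷ w) v∉ f = skip (λ e → v∉ (here (sym e)))
      (skips (p ++ [ u ]) w (v∉ ∘ there) (subst (λ z → Fst _ _ _ z _) (sym (++-assoc p [ u ] w)) f))

    prependF : ∀ {p A E N w A' E' w'} → Disjoint A A' → Disc A' E' w' →
              Fst A E N p w → ∃[ A₁ ] ∃[ E₁ ] ∃[ N₁ ] (Fst A₁ E₁ N₁ (w' ++ p) w × (A₁ ↭ A ++ A') × (E₁ ↭ E ++ E') × (N₁ ↭ N))
    prependF {p} {N = N} {w' = w'} dj D' (hit s)
      with endMap {p} {w' ++ p} {N⁺ = []}
             (λ q Y dj D → _ , _ , Y , subst (λ z → Disc _ _ (q ++ z)) (sym (++-assoc w' p Y)) (insert q D D' dj) ,
                ↭-refl , ↭-refl , ↭-reflexive (sym (++-identityʳ Y))) dj s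
    ... | _ , _ , _ , s₁ , a , e , y = _ , _ , _ , hit s₁ , a , e , ↭-trans y (↭-reflexive (++-identityʳ N))
    prependF {p} {w' = w'} dj D' (skip {u = u} u≢v f)
      with prependF dj D' f
    ... | _ , _ , _ , f₁ , a , e , y =
          _ , _ , _ , skip u≢v (subst (λ z → Fst _ _ _ z _) (sym (++-assoc w' p [ u ])) f₁) , a , e , y

    -- When a corner of `v` moves from the head of the word to its end, the sector that followed it
    -- becomes the one that wraps around.
    rotSec : ∀ {q A E N r w A₁ E₁ Y} → Disc A₁ E₁ (q ++ Y) → Disjoint A A₁ → Sec [] A E N r w →
             ∃[ A₂ ] ∃[ E₂ ] ∃[ N₂ ] (Sec q A₂ E₂ N₂ r (w ++ [ v ]) × (A₂ ↭ A ++ A₁) × (E₂ ↭ E ++ E₁) × (N₂ ↭ N ++ Y))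
    rotSec D₁ dj (end D) = _ , _ , _ , cut D (end D₁) dj , ↭-refl , ↭-refl , ↭-refl
    rotSec D₁ dj (oth u≢v s) = let _ , _ , _ , s₁ , x = rotSec D₁ dj s in _ , _ , _ , oth u≢v s₁ , x
    rotSec {A₁ = A₁} {E₁} {Y₁} D₁ dj (cut {A} {E} {Y} {A' = A'} {E'} {N} D s dj') =
      let _ , _ , _ , s₁ , a , e , y = rotSec D₁ (dj ∘ ∈-++⁺ʳ A) s in
      _ , _ , _ , cut D s₁ (λ i j → disj-++ dj' (dj ∘ ∈-++⁺ˡ) i (∈-resp-↭ a j)) ,
      ↭-trans (++⁺ˡ A a) (↭-reflexive (sym (++-assoc A A' A₁))) ,
      ↭-trans (++⁺ˡ E e) (↭-reflexive (sym (++-assoc E E' E₁))) ,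
      ↭-trans (++⁺ˡ Y y) (↭-reflexive (sym (++-assoc Y N Y₁)))

    rotHit : ∀ {A E N q w} → Sec [] A E N q w →
             ∃[ A₂ ] ∃[ E₂ ] ∃[ N₂ ] (Fst A₂ E₂ N₂ q (w ++ [ v ]) × (A₂ ↭ A) × (E₂ ↭ E) × (N₂ ↭ N))
    rotHit (end D) = _ , _ , _ , hit (end D) , ↭-refl , ↭-refl , ↭-refl
    rotHit (oth u≢v s) = let _ , _ , _ , f , x = rotHit s in _ , _ , _ , skip u≢v f , x
    rotHit (cut {A} {E} {Y} {A' = A'} {E'} {N} D s dj) =
      let _ , _ , _ , s₁ , a , e , y = rotSec D (λ i j → dj j i) s in
      _ , _ , _ , hit s₁ , ↭-trans a (++-comm A' A) , ↭-trans e (++-comm E' E) , ↭-trans y (++-comm N Y)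

    rotSkip : ∀ {A E N a p q w} → a ≢ v → Sec (a ∷ p) A E N q w → Sec p A E N q (w ++ [ a ])
    rotSkip {a = a} {p} {q} a≢v (end {Y = Y} D) = oth a≢v (end (subst (Disc _ _) (sym (++-assoc q [ a ] (p ++ Y))) D))
    rotSkip a≢v (oth u≢v s) = oth u≢v (rotSkip a≢v s)
    rotSkip a≢v (cut D s dj) = cut D (rotSkip a≢v s) dj

    rotFst : ∀ {A E N a p w} → a ≢ v → Fst A E N (a ∷ p) w → Fst A E N p (w ++ [ a ])
    rotFst a≢v (hit s) = hit (rotSkip a≢v s)
    rotFst a≢v (skip u≢v f) = skip u≢v (rotFst a≢v f)

    -- Forgetting a corner of `v` makes one sector of the two on its sides; their discs are disjoint
    -- and are glued into a single disc.
    hideHit : ∀ {A E N q w} → Sec [] A E N q w → v ∈ w →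
              ∃[ A₂ ] ∃[ E₂ ] ∃[ N₂ ] (Fst A₂ E₂ N₂ q w × (A₂ ↭ A) × (E₂ ↭ E) × (N₂ ↭ N))
    hideHit (oth u≢v s) (here e) = ⊥-elim (u≢v (sym e))
    hideHit (oth u≢v s) (there i) = let _ , _ , _ , f , x = hideHit s i in _ , _ , _ , skip u≢v f , x
    hideHit {q = q} (cut {A} {E} {Y} {A' = A'} {E'} {N} D s dj) _
      with endMap {[]} {q} {A} {E} {Y}
             (λ r Y₂ dj D₂ → _ , _ , Y ++ Y₂ ,
                subst (λ z → Disc _ _ (r ++ z)) (++-assoc q Y Y₂) (insert r D₂ D dj) , ↭-refl , ↭-refl , ++-comm Y Y₂)
             (λ i j → dj j i) s
    ... | _ , _ , _ , s₁ , a , e , y = _ , _ , _ , hit s₁ , ↭-trans a (++-comm A' A) , ↭-trans e (++-comm E' E) , ↭-trans y (++-comm N Y)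

    record Deleted (A : List V) (E : List (V × V)) (w : List V) : Set where
      field
        {A⁻ N} : List V
        {E⁻} : List (V × V)
        sectors : Fst A⁻ E⁻ N [] w
        verts : A ↭ v ∷ A⁻
        edges : ∀ {a b} → (a , b) ∈ E → (a , b) ∈ E⁻ ⊎ (a ≡ v × b ∈ N) ⊎ (b ≡ v × a ∈ N)
        nbrs : All (Adj v) N

    private
      variable
        A A₁ : List V
        E E₁ : List (V × V)
        w w₁ : List V

    open Deleted

    adapt : (d : Deleted A E w) → ∀ {A₂ E₂ N₂} → Fst A₂ E₂ N₂ [] w₁ → A₂ ↭ A⁻ d → E₂ ↭ E⁻ d → N₂ ↭ N d → Deleted A E w₁
    adapt d f a e y = record
      { sectors = f ; verts = ↭-trans (verts d) (prep v (↭-sym a))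
      ; edges = Sum.map (∈-resp-↭ (↭-sym e)) (Sum.map (map₂ (∈-resp-↭ (↭-sym y))) (map₂ (∈-resp-↭ (↭-sym y)))) ∘ edges d
      ; nbrs = All-resp-↭ (↭-sym y) (nbrs d) }

    -- Recursion on the construction of the drawing, keeping track of all sectors at once. An edge
    -- at `v` is dropped, and its other end gets one more corner in the sector. An edge away from
    -- `v` joins two letters before the first corner of `v`, so it lies in the sector that wraps
    -- around.
    delete : Disc A E w → v ∈ w → Deleted A E w
    delete (new u) (here refl) = record { sectors = hit (end nil) ; verts = ↭-refl ; edges = λ () ; nbrs = [] }
    delete (uni {A} {E} {w} {A'} {E'} {w'} D D' dj) i with ∈-++⁻ w i
    ... | inj₁ j = record
          { sectors = proj₁ (proj₂ (proj₂ ap)) ; verts = ↭-trans (++⁺ʳ A' (verts d)) (prep v (↭-sym (proj₁ (proj₂ (proj₂ (proj₂ ap))))))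
          ; edges = λ x → edg x ; nbrs = nbrs d }
      where
      d = delete D j
      v∉A' : v ∉ A'
      v∉A' = dj (word⊆ D j)
      ap = appendF (λ x y → dj (∈-resp-↭ (↭-sym (verts d)) (there x)) y) D' (v∉A' ∘ word⊆ D') (sectors d)
      eq = proj₂ (proj₂ (proj₂ (proj₂ ap)))
      edg : ∀ {a b} → (a , b) ∈ E ++ E' → _
      edg x with ∈-++⁻ E x
      ... | inj₁ y = Sum.map (∈-resp-↭ (↭-sym eq) ∘ ∈-++⁺ˡ) id (edges d y)
      ... | inj₂ y = inj₁ (∈-resp-↭ (↭-sym eq) (∈-++⁺ʳ (E⁻ d) y))
    ... | inj₂ j = record
          { sectors = skips [] w v∉w fs
          ; verts = ↭-trans (++-comm A A') (↭-trans (++⁺ʳ A (verts d)) (prep v (↭-sym (proj₁ (proj₂ (proj₂ (proj₂ (proj₂ ap))))))))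
          ; edges = λ x → edg x ; nbrs = All-resp-↭ (↭-sym ny) (nbrs d) }
      where
      d = delete D' j
      v∉w : v ∉ w
      v∉w k = dj (word⊆ D k) (word⊆ D' j)
      ap = prependF (λ x y → dj y (∈-resp-↭ (↭-sym (verts d)) (there x))) D (sectors d)
      fs : Fst (proj₁ ap) (proj₁ (proj₂ ap)) (proj₁ (proj₂ (proj₂ ap))) w w'
      fs = castF (++-identityʳ w) (proj₁ (proj₂ (proj₂ (proj₂ ap))))
      eq = proj₁ (proj₂ (proj₂ (proj₂ (proj₂ (proj₂ ap)))))
      ny = proj₂ (proj₂ (proj₂ (proj₂ (proj₂ (proj₂ ap)))))
      mv : ∀ {x} → x ∈ N d → x ∈ proj₁ (proj₂ (proj₂ ap))
      mv = ∈-resp-↭ (↭-sym ny)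
      edg : ∀ {a b} → (a , b) ∈ E ++ E' → _
      edg x with ∈-++⁻ E x
      ... | inj₂ y = Sum.map (∈-resp-↭ (↭-sym eq) ∘ ∈-++⁺ˡ) (Sum.map (map₂ mv) (map₂ mv)) (edges d y)
      ... | inj₁ y = inj₁ (∈-resp-↭ (↭-sym eq) (∈-++⁺ʳ (E⁻ d) y))
    delete (rot {a = a} {w} D) i with delete D (∈-resp-↭ (++-comm w [ a ]) i)
    ... | d with sectors d
    ...   | hit s = let _ , _ , _ , f , x , y , z = rotHit s in adapt d f x y z
    ...   | skip u≢v f = adapt d (rotFst u≢v f) ↭-refl ↭-refl ↭-refl
    delete (dup {a = a} {w} D) i with delete D (undup i)
      where
      undup : v ∈ a ∷ a ∷ w → v ∈ a ∷ w
      undup (here e) = here e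
      undup (there j) = j
    ... | d with sectors d
    -- The two copies of the corner enclose an empty sector.
    ...   | hit s = adapt d (hit (cut nil s (λ ()))) ↭-refl ↭-refl ↭-refl
    ...   | skip u≢v f = let _ , _ , _ , f₁ , x , y , z = fstMap {[ a ]} {a ∷ a ∷ []} {[]} dup f in
                         adapt d (skip u≢v (skip u≢v f₁)) x y z
    delete (edge {a = a} {b} {w} ab D) i with delete D i
    ... | d with sectors d
    ...   | hit (cut _ _ _) = ⊥-elim (Adj-irrefl ab)
    ...   | hit (oth b≢v s) = let _ , s₁ , y = headMap s in record
            { sectors = hit (oth b≢v s₁) ; verts = verts d
            ; edges = λ { (here refl) → inj₂ (inj₁ (refl , ∈-resp-↭ (↭-sym y) (here refl)))
                        ; (there x) → Sum.map id (Sum.map (map₂ (∈-resp-↭ (↭-sym y) ∘ there)) (map₂ (∈-resp-↭ (↭-sym y) ∘ there))) (edges d x) }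
            ; nbrs = All-resp-↭ (↭-sym y) (ab ∷ nbrs d) }
    -- Here `b` is `v`, and `a` comes just before its first corner, hence in the sector that wraps
    -- around, where it gets a second corner.
    ...   | skip a≢v (hit s) =
            let _ , _ , _ , s₁ , x , y , z = endMap {[ a ]} {[ a ]} {[]} {[]} {[ a ]}
                  (λ {A} {E} q Y _ D → A , E , a ∷ Y , at q {[ a ]} {a ∷ a ∷ []} dup D , ↭-reflexive (sym (++-identityʳ A)) , ↭-reflexive (sym (++-identityʳ E)) , ++-comm [ a ] Y)
                  (λ _ ()) s
                mv = λ {u} (m : u ∈ N d) → ∈-resp-↭ (↭-sym z) (∈-++⁺ˡ m) in
            record
            { sectors = skip a≢v (hit s₁) ; verts = ↭-trans (verts d) (prep v (↭-trans (↭-reflexive (sym (++-identityʳ _))) (↭-sym x)))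
            ; edges = λ { (here refl) → inj₂ (inj₂ (refl , ∈-resp-↭ (↭-sym z) (∈-++⁺ʳ (N d) (here refl))))
                        ; (there m) → Sum.map (∈-resp-↭ (↭-sym y) ∘ ∈-++⁺ˡ) (Sum.map (map₂ mv) (map₂ mv)) (edges d m) }
            ; nbrs = All-resp-↭ (↭-trans (++-comm [ a ] (N d)) (↭-sym z)) (Adj-sym ab ∷ nbrs d) }
    ...   | skip a≢v (skip b≢v f) =
            let _ , _ , _ , f₁ , x , y , z = fstMap {a ∷ b ∷ []} {a ∷ b ∷ []} {[ (a , b) ]} (edge ab) f
                mv = λ {u} (m : u ∈ N d) → ∈-resp-↭ (↭-sym z) m in
            record
            { sectors = skip a≢v (skip b≢v f₁) ; verts = ↭-trans (verts d) (prep v (↭-sym x))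
            ; edges = λ { (here refl) → inj₁ (∈-resp-↭ (↭-sym y) (here refl))
                        ; (there m) → Sum.map (∈-resp-↭ (↭-sym y) ∘ there) (Sum.map (map₂ mv) (map₂ mv)) (edges d m) }
            ; nbrs = All-resp-↭ (↭-sym z) (nbrs d) }
    delete (hide {a = a} D) i with delete D (there i)
    ... | d with sectors d
    ...   | hit s = let _ , _ , _ , f , x , y , z = hideHit s i in adapt d f x y z
    ...   | skip u≢v f = let _ , _ , _ , f₁ , x , y , z = fstMap {[ a ]} {[]} {[]} hide f in adapt d f₁ x y z

    single : ∀ {p A E N q} w → v ∉ w → Sec p A E N q w → Disc A E (q ++ w ++ p ++ N)
    single [] _ (end D) = D
    single (u ∷ w) v∉ (cut _ _ _) = ⊥-elim (v∉ (here refl))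
    single {q = q} (u ∷ w) v∉ (oth _ s) = subst (Disc _ _) (++-assoc q [ u ] _) (single w (v∉ ∘ there) s)

    record Two (p q : List V) (A : List V) (E : List (V × V)) (N : List V) : Set where
      field
        {A₁′ A₂′ Y₁ Y₂} : List V
        {E₁′ E₂′} : List (V × V)
        disc₁ : Disc A₁′ E₁′ (p ++ Y₁)
        disc₂ : Disc A₂′ E₂′ (q ++ Y₂)
        disj : Disjoint A₁′ A₂′
        A≡ : A ≡ A₁′ ++ A₂′
        E≡ : E ≡ E₁′ ++ E₂′
        N≡ : N ≡ Y₁ ++ Y₂

    double : ∀ {A E N q} w {w'} → v ∉ w → v ∉ w' → Sec [] A E N q (w ++ v ∷ w') → Two (q ++ w) w' A E N
    double {q = q} [] {w'} _ v∉ (cut {Y = Y} {N = N} D s dj) = record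
      { disc₁ = subst (λ z → Disc _ _ (z ++ Y)) (sym (++-identityʳ q)) D ; disc₂ = single w' v∉ s ; disj = dj
      ; A≡ = refl ; E≡ = refl ; N≡ = refl }
    double [] _ v∉ (oth u≢v _) = ⊥-elim (u≢v refl)
    double (u ∷ w) v∉ _ (cut _ _ _) = ⊥-elim (v∉ (here refl))
    double {q = q} (u ∷ w) v∉ v∉' (oth _ s) = subst (λ z → Two z _ _ _ _) (++-assoc q [ u ] w) (double w (v∉ ∘ there) v∉' s)

-- Weak degeneracy

4≤-mono : ∀ h {c c'} → + 4 ℤ.≤ h ℤ.+ + c → c ≤ c' → + 4 ℤ.≤ h ℤ.+ + c'
4≤-mono h p q = ℤP.≤-trans p (ℤP.+-monoʳ-≤ h (+≤+ q))

pred+suc : ∀ h c → (h ℤ.- + 1) ℤ.+ + suc c ≡ h ℤ.+ + c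
pred+suc h c = trans (ℤP.+-assoc h (ℤ.- + 1) (+ suc c)) refl

4≤-pred : ∀ h {c c'} → + 4 ℤ.≤ h ℤ.+ + c → c < c' → + 4 ℤ.≤ (h ℤ.- + 1) ℤ.+ + c'
4≤-pred h {c} {suc c'} p (s≤s q) = subst (+ 4 ℤ.≤_) (sym (pred+suc h c')) (4≤-mono h p q)

4≤-nonneg : ∀ {h c} → + 4 ℤ.≤ h ℤ.+ + c → c ≤ 4 → + 0 ℤ.≤ h
4≤-nonneg {h} p q = subst (+ 0 ℤ.≤_) (trans (ℤP.+-assoc h (+ 4) (ℤ.- + 4)) (ℤP.+-identityʳ h))
  (ℤP.+-monoˡ-≤ (ℤ.- + 4) (4≤-mono h p q))

decT : ∀ b → Dec (T b)
decT true = yes tt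
decT false = no id

module Weak {n : ℕ} (G : Graph n) where
  open Graph G using (adj)
  open Discs G
  open import Data.List.Membership.DecPropositional (_≟_ {n}) using (_∈?_) public

  infixl 6 _∖_
  abstract
    _∖_ : List V → V → List V
    A ∖ u = filter (λ v → ¬? (v ≟ u)) A

    ∖⁺ : ∀ {A u v} → v ∈ A → v ≢ u → v ∈ A ∖ u
    ∖⁺ {u = u} = ∈-filter⁺ (λ v → ¬? (v ≟ u))

    ∖⁻ : ∀ {A u v} → v ∈ A ∖ u → v ∈ A × v ≢ u
    ∖⁻ {u = u} = ∈-filter⁻ (λ v → ¬? (v ≟ u))

    ∖-≤ : ∀ {A} u → length (A ∖ u) ≤ length A
    ∖-≤ {A} u = length-filter (λ v → ¬? (v ≟ u)) A

    ∖-shorter : ∀ {A u} → u ∈ A → length (A ∖ u) < length A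
    ∖-shorter {A} {u} i = filter-notAll (λ v → ¬? (v ≟ u)) A (Any.map (λ e ne → ne (sym e)) i)

  adj? : ∀ u v → Dec (Adj u v)
  adj? u v = decT (adj u v)

  -- For `c = 4 - g` the condition `g(u) > g(w)` reads `c u < c w`.
  data Save (A : List V) (c : V → ℕ) (u : V) : Set where
    blank : Save A c u
    save  : ∀ w → w ∈ A → Adj u w → c u < c w → Save A c u

  Saved : ∀ {A c u} → Save A c u → V → Set
  Saved blank v = ⊥
  Saved (save w _ _ _) v = v ≡ w

  -- Weak degeneracy of the graph induced on A, for the function 4 - c.
  data W : List V → (V → ℕ) → Set where
    done : ∀ {A c} → (∀ {v} → v ∉ A) → W A c
    step : ∀ {A c} u {A' c'} → u ∈ A →
           (∀ {v} → v ∈ A → v ≢ u → v ∈ A') → (∀ {v} → v ∈ A' → v ∈ A × v ≢ u) →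
           (s : Save A c u) →
           (∀ {v} → v ∈ A' → c' v ≤ 4 × c v ≤ c' v × (Adj u v → c v < c' v ⊎ Saved s v)) →
           W A' c' → W A c

  -- The same order of deletion works. A smaller loss can only make a saving illegal, namely if
  -- `d w ≤ d u`. But then `d w + 1 ≤ d u + 1 ≤ c u + 1 ≤ c w`, so `w` can pay in full and a blank
  -- deletion replaces the saving.
  mono : ∀ {A B c d} → (∀ {v} → v ∈ A → v ∈ B) → (∀ {v} → v ∈ B → v ∈ A) →
         (∀ {v} → v ∈ A → d v ≤ c v) → W A c → W B d
  mono f g le (done e) = done (e ∘ g)
  mono {A} {B} {c} {d} f g le (step u {c' = c'} i a⁺ a⁻ s leg W') = go s leg
    where
    W″ : (s' : Save B d u) → (∀ {v} → v ∈ _ → c' v ≤ 4 × d v ≤ c' v × (Adj u v → d v < c' v ⊎ Saved s' v)) → W B d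
    W″ s' leg' = step u (f i) (λ j → a⁺ (g j)) (λ j → let k , ne = a⁻ j in f k , ne) s' leg' W'
    go : (s : Save A c u) → (∀ {v} → v ∈ _ → c' v ≤ 4 × c v ≤ c' v × (Adj u v → c v < c' v ⊎ Saved s v)) → W B d
    go blank leg = W″ blank λ j → let l , m , k = leg j ; ld = le (proj₁ (a⁻ j)) in
      l , ≤-trans ld m , λ uv → case k uv of λ { (inj₁ x) → inj₁ (≤-trans (s≤s ld) x) }
    go (save w wi uw lt) leg with d u <? d w
    ... | yes lt' = W″ (save w (f wi) uw lt') λ j → let l , m , k = leg j ; ld = le (proj₁ (a⁻ j)) in
      l , ≤-trans ld m , λ uv → case k uv of λ { (inj₁ x) → inj₁ (≤-trans (s≤s ld) x) ; (inj₂ e) → inj₂ e }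
    ... | no ≮ = W″ blank λ j → let l , m , k = leg j ; ld = le (proj₁ (a⁻ j)) in
      l , ≤-trans ld m , λ uv → case k uv of λ { (inj₁ x) → inj₁ (≤-trans (s≤s ld) x)
        ; (inj₂ refl) → inj₁ (≤-trans (s≤s (≮⇒≥ ≮)) (≤-trans (s≤s (le i)) (≤-trans lt m))) }

  ⟦_⟧ : ∀ {p} {P : Set p} → Dec P → ℕ
  ⟦ yes _ ⟧ = 1
  ⟦ no _ ⟧ = 0

  -- First remove B, then R; τ v lists the neighbours in B of a vertex v of R.
  compose : ∀ {A B R c c₁ c₂} (τ : V → List V) →
    (∀ {v} → v ∈ A → v ∈ B ⊎ v ∈ R) → (∀ {v} → v ∈ B → v ∈ A) → (∀ {v} → v ∈ R → v ∈ A) → Disjoint B R →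
    (∀ {v} → v ∈ B → c v ≤ c₁ v) →
    (∀ {v t} → v ∈ R → t ∈ B → Adj t v → t ∈ τ v) →
    (∀ {v} → v ∈ R → c v + length (τ v) ≤ c₂ v × c₂ v ≤ 4) →
    W B c₁ → W R c₂ → W A c
  compose τ spl b⁺ r⁺ dj leB nb leR (done e) WR =
    mono r⁺ (λ i → case spl i of λ { (inj₁ j) → ⊥-elim (e j) ; (inj₂ j) → j })
      (λ i → ≤-trans (m≤m+n _ _) (proj₁ (leR i))) WR
  compose {A} {B} {R} {c} {c₁} {c₂} τ spl b⁺ r⁺ dj leB nb leR (step u {B'} {c₁'} i a⁺ a⁻ s leg WB) WR = go s leg
    where
    -- On `B` the loss follows the given sequence. On `R` each deletion is paid in full, because all
    -- saved vertices lie in `B`.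
    c' : V → ℕ
    c' v with v ∈? B
    ... | yes _ = c₁' v
    ... | no _ = c v + ⟦ adj? u v ⟧
    -- A deleted neighbour leaves the list when it enters the loss, so `c v + length (τ v)` does not
    -- grow.
    τ' : V → List V
    τ' v with adj? u v
    ... | yes _ = τ v ∖ u
    ... | no _ = τ v
    rest : W (A ∖ u) c'
    rest = compose τ'
      (λ j → let k , ne = ∖⁻ j in Sum.map (λ x → a⁺ x ne) id (spl k))
      (λ j → let k , ne = a⁻ j in ∖⁺ (b⁺ k) ne)
      (λ j → ∖⁺ (r⁺ j) λ { refl → dj i j })
      (λ j k → dj (proj₁ (a⁻ j)) k)
      leB' nb' leR' WB WR
      where
      leB' : ∀ {v} → v ∈ B' → c' v ≤ c₁' v
      leB' {v} j with v ∈? B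
      ... | yes _ = ≤-refl
      ... | no v∉ = ⊥-elim (v∉ (proj₁ (a⁻ j)))
      nb' : ∀ {v t} → v ∈ R → t ∈ B' → Adj t v → t ∈ τ' v
      nb' {v} {t} j k tv with adj? u v
      ... | yes _ = ∖⁺ (nb j (proj₁ (a⁻ k)) tv) (proj₂ (a⁻ k))
      ... | no _ = nb j (proj₁ (a⁻ k)) tv
      leR' : ∀ {v} → v ∈ R → c' v + length (τ' v) ≤ c₂ v × c₂ v ≤ 4
      leR' {v} j with v ∈? B
      ... | yes v∈ = ⊥-elim (dj v∈ j)
      ... | no _ with adj? u v
      ...   | no _ = subst (λ z → z + length (τ v) ≤ c₂ v) (sym (+-identityʳ (c v))) (proj₁ (leR j)) , proj₂ (leR j)
      ...   | yes uv = ≤-trans (≤-trans (≤-reflexive (trans (cong (_+ length (τ v ∖ u)) (+-comm (c v) 1)) (sym (+-suc (c v) _))))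
                             (+-monoʳ-≤ (c v) (∖-shorter (nb j i uv)))) (proj₁ (leR j)) , proj₂ (leR j)
    nonempty : ∀ {t : V} {xs} → t ∈ xs → 1 ≤ length xs
    nonempty (here _) = s≤s z≤n
    nonempty (there _) = s≤s z≤n
    legR : ∀ {v} → v ∈ R → c' v ≤ 4 × c v ≤ c' v × (Adj u v → c v < c' v)
    legR {v} j with v ∈? B
    ... | yes v∈ = ⊥-elim (dj v∈ j)
    ... | no _ with adj? u v
    ...   | no ¬uv = ≤-trans (≤-reflexive (+-identityʳ (c v))) (≤-trans (m≤m+n _ _) (≤-trans (proj₁ (leR j)) (proj₂ (leR j)))) ,
                     m≤m+n _ _ , λ uv → ⊥-elim (¬uv uv)
    ...   | yes uv = ≤-trans (+-monoʳ-≤ (c v) (nonempty (nb j i uv))) (≤-trans (proj₁ (leR j)) (proj₂ (leR j))) ,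
                     m≤m+n _ _ , λ _ → ≤-reflexive (sym (+-comm (c v) 1))
    legB : ∀ {v} → v ∈ B → c' v ≡ c₁' v
    legB {v} j with v ∈? B
    ... | yes _ = refl
    ... | no v∉ = ⊥-elim (v∉ j)
    by : (s' : Save A c u) → (∀ {v} → v ∈ B' → c₁' v ≤ 4 × c v ≤ c₁' v × (Adj u v → c v < c₁' v ⊎ Saved s' v)) → W A c
    by s' leg' = step u (b⁺ i) (λ j ne → ∖⁺ j ne) ∖⁻ s' lg rest
      where
      lg : ∀ {v} → v ∈ A ∖ u → c' v ≤ 4 × c v ≤ c' v × (Adj u v → c v < c' v ⊎ Saved s' v)
      lg {v} j with spl (proj₁ (∖⁻ j))
      ... | inj₁ k = subst (λ z → z ≤ 4 × c v ≤ z × (Adj u v → c v < z ⊎ Saved s' v)) (sym (legB k)) (leg' (a⁺ k (proj₂ (∖⁻ j))))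
      ... | inj₂ k = let x , y , z = legR k in x , y , inj₁ ∘ z
    go : (s : Save B c₁ u) → (∀ {v} → v ∈ B' → c₁' v ≤ 4 × c₁ v ≤ c₁' v × (Adj u v → c₁ v < c₁' v ⊎ Saved s v)) → W A c
    go blank leg = by blank λ j → let l , m , k = leg j ; ld = leB (proj₁ (a⁻ j)) in
      l , ≤-trans ld m , λ uv → case k uv of λ { (inj₁ x) → inj₁ (≤-trans (s≤s ld) x) }
    go (save w wi uw lt) leg with c u <? c w
    ... | yes lt' = by (save w (b⁺ wi) uw lt') λ j → let l , m , k = leg j ; ld = leB (proj₁ (a⁻ j)) in
      l , ≤-trans ld m , λ uv → case k uv of λ { (inj₁ x) → inj₁ (≤-trans (s≤s ld) x) ; (inj₂ e) → inj₂ e }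
    -- The saving was legal for `c₁` but is not for `c`; as in `mono`, the saved vertex can then pay
    -- in full.
    ... | no ≮ = by blank λ j → let l , m , k = leg j ; ld = leB (proj₁ (a⁻ j)) in
      l , ≤-trans ld m , λ uv → case k uv of λ { (inj₁ x) → inj₁ (≤-trans (s≤s ld) x)
        ; (inj₂ refl) → inj₁ (≤-trans (s≤s (≮⇒≥ ≮)) (≤-trans (s≤s (leB i)) (≤-trans lt m))) }

  remove : ∀ {A c c'} u → u ∈ A →
    (∀ {v} → v ∈ A → v ≢ u → c v + ⟦ adj? u v ⟧ ≤ c' v × c' v ≤ 4) → W (A ∖ u) c' → W A c
  remove {A} {c} {c'} u i leg = step u i ∖⁺ ∖⁻ blank lg
    where
    lg : ∀ {v} → v ∈ A ∖ u → c' v ≤ 4 × c v ≤ c' v × (Adj u v → c v < c' v ⊎ ⊥)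
    lg {v} j with adj? u v | leg (proj₁ (∖⁻ j)) (proj₂ (∖⁻ j))
    ... | yes _ | a , b = b , ≤-trans (m≤m+n _ _) a , λ _ → inj₁ (≤-trans (≤-reflexive (sym (+-comm (c v) 1))) a)
    ... | no ¬p | a , b = b , ≤-trans (m≤m+n _ _) a , λ p → ⊥-elim (¬p p)

  removeSaving : ∀ {A c c'} u w → u ∈ A → w ∈ A → Adj u w → c u < c w →
    (∀ {v} → v ∈ A → v ≢ u → v ≢ w → c v + ⟦ adj? u v ⟧ ≤ c' v) → c w ≤ c' w →
    (∀ {v} → v ∈ A → v ≢ u → c' v ≤ 4) → W (A ∖ u) c' → W A c
  removeSaving {A} {c} {c'} u w i wi uw lt leg lew l4 = step u i ∖⁺ ∖⁻ (save w wi uw lt) lg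
    where
    lg : ∀ {v} → v ∈ A ∖ u → c' v ≤ 4 × c v ≤ c' v × (Adj u v → c v < c' v ⊎ v ≡ w)
    lg {v} j with v ≟ w
    ... | yes refl = l4 (proj₁ (∖⁻ j)) (proj₂ (∖⁻ j)) , lew , λ _ → inj₂ refl
    ... | no ne with adj? u v | leg (proj₁ (∖⁻ j)) (proj₂ (∖⁻ j)) ne
    ...   | yes _ | a = l4 (proj₁ (∖⁻ j)) (proj₂ (∖⁻ j)) , ≤-trans (m≤m+n _ _) a , λ _ → inj₁ (≤-trans (≤-reflexive (sym (+-comm (c v) 1))) a)
    ...   | no ¬p | a = l4 (proj₁ (∖⁻ j)) (proj₂ (∖⁻ j)) , ≤-trans (m≤m+n _ _) a , λ p → ⊥-elim (¬p p)

  module _ (alive : V → Bool) (h : V → ℤ) (u : V) where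

    dsf-blank : ∀ {v} → ¬ Adj u v → ∀ mw → delSaveFun adj alive h u mw v ≡ h v
    dsf-blank {v} ¬uv mw with alive v | adj u v
    ... | false | _ = refl
    ... | true | false = refl
    ... | true | true = ⊥-elim (¬uv tt)

    dsf-≥ : ∀ {v c c'} mw → + 4 ℤ.≤ h v ℤ.+ + c → c < c' → + 4 ℤ.≤ delSaveFun adj alive h u mw v ℤ.+ + c'
    dsf-≥ {v} nothing p q with alive v ∧ adj u v
    ... | false = 4≤-mono (h v) p (<⇒≤ q)
    ... | true = 4≤-pred (h v) p q
    dsf-≥ {v} (just w) p q with alive v ∧ adj u v
    ... | false = 4≤-mono (h v) p (<⇒≤ q)
    ... | true with does (v ≟ w) ∧ does (h w ℤ.<? h u)
    ...   | false = 4≤-pred (h v) p q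
    ...   | true = 4≤-mono (h v) p (<⇒≤ q)

    dsf-saved : ∀ {w} → h w ℤ.< h u → delSaveFun adj alive h u (just w) w ≡ h w
    dsf-saved {w} lt with alive w ∧ adj u w
    ... | false = refl
    ... | true with w ≟ w | h w ℤ.<? h u
    ...   | yes _ | yes _ = refl
    ...   | no ne | _ = ⊥-elim (ne refl)
    ...   | yes _ | no nl = ⊥-elim (nl lt)

    dsf-unsaved : ∀ {w} → T (alive w) → Adj u w → ¬ (h w ℤ.< h u) → delSaveFun adj alive h u (just w) w ≡ h w ℤ.- + 1
    dsf-unsaved {w} al uw nl with alive w | adj u w
    ... | true | true with w ≟ w | h w ℤ.<? h u
    ...   | yes _ | yes lt = ⊥-elim (nl lt)
    ...   | yes _ | no _ = refl
    ...   | no ne | _ = ⊥-elim (ne refl)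

  -- The actual values `h` are only bounded below by `4 - c`, so a saving planned in `W` may have no
  -- effect. This happens when `h u ≤ h w`, and then `c u < c w` leaves `w` enough room to lose one.
  weaklyDeg : ∀ {A c} → W A c → (alive : V → Bool) (h : V → ℤ) →
    (∀ {v} → T (alive v) → v ∈ A) → (∀ {v} → v ∈ A → T (alive v)) →
    (∀ {v} → v ∈ A → + 4 ℤ.≤ h v ℤ.+ + c v) → WeaklyDeg adj alive h
  weaklyDeg (done e) alive h f g b = finished λ v → dead (λ t → e (f {v} t))
    where
    dead : ∀ {b} → ¬ T b → b ≡ false
    dead {false} _ = refl
    dead {true} k = ⊥-elim (k tt)
  weaklyDeg {A} {c} (step u {A'} {c'} i a⁺ a⁻ s leg W') alive h f g b =
    delSave u (g i) (target s) (valid s) (λ v t → 4≤-nonneg (bound (f' t)) (proj₁ (leg (f' t))))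
      (weaklyDeg W' _ _ f' g' bound)
    where
    target : Save A c u → Maybe V
    target blank = nothing
    target (save w _ _ _) = just w
    T∧ : ∀ {a b} → T a → T b → T (a ∧ b)
    T∧ {true} {true} _ _ = tt
    valid : ∀ s → ValidSave adj alive u (target s)
    valid blank = tt
    valid (save w wi uw _) = T∧ (g wi) uw
    f' : ∀ {v} → T (removeV alive u v) → v ∈ A'
    f' {v} t with v ≟ u | alive v in eq
    ... | no ne | true = a⁺ (f (subst T (sym eq) tt)) ne
    g' : ∀ {v} → v ∈ A' → T (removeV alive u v)
    g' {v} j with v ≟ u | alive v in eq
    ... | no ne | true = tt
    ... | no ne | false = ⊥-elim (subst T eq (g (proj₁ (a⁻ j))))
    ... | yes e | _ = ⊥-elim (proj₂ (a⁻ j) e)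
    savedBound : ∀ {v} → v ∈ A' → (s : Save A c u) → c v ≤ c' v → Saved s v → + 4 ℤ.≤ delSaveFun adj alive h u (target s) v ℤ.+ + c' v
    savedBound {v} j (save w wi uw lt) le refl = by (h w ℤ.<? h u)
      where
      by : Dec (h w ℤ.< h u) → + 4 ℤ.≤ delSaveFun adj alive h u (just w) w ℤ.+ + c' w
      by (yes hl) = subst (λ z → + 4 ℤ.≤ z ℤ.+ + c' v) (sym (dsf-saved alive h u hl)) (4≤-mono (h w) (b wi) le)
      by (no nl) = subst (λ z → + 4 ℤ.≤ z ℤ.+ + c' v) (sym (dsf-unsaved alive h u (g wi) uw nl))
        (4≤-pred (h w) (ℤP.≤-trans (b i) (ℤP.+-monoˡ-≤ (+ c u) (ℤP.≮⇒≥ nl))) (≤-trans lt le))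
    bound : ∀ {v} → v ∈ A' → + 4 ℤ.≤ delSaveFun adj alive h u (target s) v ℤ.+ + c' v
    bound {v} j with adj? u v
    ... | no ¬uv = subst (λ z → + 4 ℤ.≤ z ℤ.+ + c' v) (sym (dsf-blank alive h u ¬uv (target s))) (4≤-mono (h v) (b (proj₁ (a⁻ j))) (proj₁ (proj₂ (leg j))))
    ... | yes uv with proj₂ (proj₂ (leg j)) uv
    ...   | inj₁ lt = dsf-≥ alive h u (target s) (b (proj₁ (a⁻ j))) lt
    ...   | inj₂ sv = savedBound j s (proj₁ (proj₂ (leg j))) sv

-- Drawings of induced subgraphs, and deletion of a boundary vertex

module Planar {n : ℕ} (G : Graph n) where
  open Discs G
  open Weak G

  Disc-unique : ∀ {A E w} → Disc A E w → Unique A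
  Disc-unique nil = []
  Disc-unique (new v) = [] ∷ []
  Disc-unique (uni D D' dj) = UniqueP.++⁺ (Disc-unique D) (Disc-unique D') (λ (p , q) → dj p q)
  Disc-unique (rot D) = Disc-unique D
  Disc-unique (dup D) = Disc-unique D
  Disc-unique (edge _ D) = Disc-unique D
  Disc-unique (hide D) = Disc-unique D

  hideSub : ∀ {A E} q {w w'} → w' ⊆ w → Disc A E (q ++ w) → Disc A E (q ++ w')
  hideSub q [] D = D
  hideSub q (_∷ʳ_ {ys = ys} y s) D = hideSub q s (at q {[ y ]} {[]} hide D)
  hideSub q (_∷_ {x} {xs} {y} {ys} refl s) D =
    subst (Disc _ _) (++-assoc q [ x ] xs) (hideSub (q ++ [ x ]) s (subst (Disc _ _) (sym (++-assoc q [ x ] ys)) D))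

  infixl 7 _∣_
  _∣_ : List V → List V → List V
  w ∣ A = filter (_∈? A) w

  ∣-sub : ∀ {A B w w'} → (∀ {v} → v ∈ B → v ∈ A) → w' ⊆ w → w' ∣ B ⊆ w ∣ A
  ∣-sub {A} {B} f = filter⁺ (_∈? B) (_∈? A) (λ { refl → f })

  ∣-++ : ∀ {A} w w' → (w ++ w') ∣ A ≡ w ∣ A ++ w' ∣ A
  ∣-++ {A} = filter-++ (_∈? A)

  -- The graph induced on A is drawn in a disc with boundary word w; vertices of
  -- w outside A are to be ignored.
  record Pl (A w : List V) : Set where
    field
      {A′} : List V
      {E′} : List (V × V)
      disc : Disc A′ E′ (w ∣ A)
      alive : ∀ {v} → v ∈ A → v ∈ A′
      full : ∀ {u v} → u ∈ A → v ∈ A → Adj u v → (u , v) ∈ E′ ⊎ (v , u) ∈ E′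

  open Pl

  Pl-sub : ∀ {A B w w'} → (∀ {v} → v ∈ B → v ∈ A) → w' ⊆ w → Pl A w → Pl B w'
  Pl-sub f s P = record { disc = hideSub [] (∣-sub f s) (disc P) ; alive = alive P ∘ f ; full = λ i j → full P (f i) (f j) }

  Pl-rot : ∀ {A} x {y} → Pl A (x ++ y) → Pl A (y ++ x)
  Pl-rot {A} x {y} P = record
    { disc = subst (Disc _ _) (sym (∣-++ y x)) (rotate (x ∣ A) (subst (Disc _ _) (∣-++ x y) (disc P)))
    ; alive = alive P ; full = full P }

  ∉-∣∖ : ∀ {A v} w → v ∉ w ∣ (A ∖ v)
  ∉-∣∖ {A} {v} w i = proj₂ (∖⁻ (proj₂ (∈-filter⁻ (_∈? (A ∖ v)) {xs = w} i))) refl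

  ∖⊆ : ∀ {A u v} → v ∈ A ∖ u → v ∈ A
  ∖⊆ = proj₁ ∘ ∖⁻

  ∉-deleted : ∀ {v A E w} (d : Deleted v A E w) → Disc A E w → v ∉ Deleted.A⁻ d
  ∉-deleted {v} d D i with PermS.Unique-resp-↭ (setoid V) (↭⇒↭ₛ (Deleted.verts d)) (Disc-unique D)
  ... | al ∷ _ = All.lookup al i refl

  record Single (A : List V) (v : V) (w : List V) : Set where
    field
      Y : List V
      pl : Pl (A ∖ v) (Y ++ w)
      exposed : ∀ {u} → u ∈ A → Adj v u → u ∈ Y
      nbr : ∀ {u} → u ∈ Y → Adj v u

  deleteV : ∀ {A v w} → v ∈ A → Pl A (v ∷ w) → Single A v w
  deleteV {A} {v} {w} v∈ P with filter-accept (_∈? A) {xs = w} v∈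
  -- Reading the tail relative to the remaining vertices hides every further corner of `v`, so
  -- exactly one sector is left.
  ... | eq with hideSub [ v ] (∣-sub {A} {A ∖ v} ∖⊆ (⊆-refl {x = w})) (subst (Disc _ _) eq (disc P))
  ...   | D with delete v D (here refl)
  ...     | d with Deleted.sectors d
  ...       | skip ne _ = ⊥-elim (ne refl)
  ...       | hit s = record
    { Y = N
    ; pl = record
      { disc = subst (Disc _ _) (sym (∣-++ N w)) (hideSub [] (++⁺ (filter-⊆ (_∈? (A ∖ v)) N) ⊆-refl) (rotate (w ∣ (A ∖ v)) D⁻))
      ; alive = λ i → let a , ne = ∖⁻ i in keep (alive P a) ne
      ; full = λ i j uv → let a , ne = ∖⁻ i ; b , ne' = ∖⁻ j in Sum.map (inner ne ne') (inner ne' ne) (full P a b uv) }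
    ; exposed = λ i vu → [ expo , expo' ]′ (full P v∈ i vu)
    ; nbr = All.lookup nbrs }
    where
    open Deleted d using (A⁻; E⁻; N; verts; edges; nbrs)
    D⁻ : Disc A⁻ E⁻ (w ∣ (A ∖ v) ++ N)
    D⁻ = single v (w ∣ (A ∖ v)) (∉-∣∖ w) s
    v∉ : v ∉ A⁻
    v∉ = ∉-deleted d D
    keep : ∀ {u} → u ∈ A′ P → u ≢ v → u ∈ A⁻
    keep i ne with ∈-resp-↭ verts i
    ... | here e = ⊥-elim (ne e)
    ... | there j = j
    inner : ∀ {a b} → a ≢ v → b ≢ v → (a , b) ∈ E′ P → (a , b) ∈ E⁻
    inner ne ne' i with edges i
    ... | inj₁ j = j
    ... | inj₂ (inj₁ (e , _)) = ⊥-elim (ne e)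
    ... | inj₂ (inj₂ (e , _)) = ⊥-elim (ne' e)
    expo : ∀ {u} → (v , u) ∈ E′ P → u ∈ N
    expo i with edges i
    ... | inj₁ j = ⊥-elim (v∉ (proj₁ (edge⊆ D⁻ j)))
    ... | inj₂ (inj₁ (_ , k)) = k
    ... | inj₂ (inj₂ (refl , k)) = k
    expo' : ∀ {u} → (u , v) ∈ E′ P → u ∈ N
    expo' i with edges i
    ... | inj₁ j = ⊥-elim (v∉ (proj₂ (edge⊆ D⁻ j)))
    ... | inj₂ (inj₁ (refl , k)) = k
    ... | inj₂ (inj₂ (_ , k)) = k

  record Split (A : List V) (v : V) (p q : List V) : Set where
    field
      A₁ A₂ Y₁ Y₂ : List V
      pl₁ : Pl A₁ (p ++ Y₁)
      pl₂ : Pl A₂ (q ++ Y₂)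
      cover : ∀ {u} → u ∈ A → u ≢ v → u ∈ A₁ ⊎ u ∈ A₂
      sub₁ : ∀ {u} → u ∈ A₁ → u ∈ A × u ≢ v
      sub₂ : ∀ {u} → u ∈ A₂ → u ∈ A × u ≢ v
      disj : Disjoint A₁ A₂
      sep : ∀ {a b} → a ∈ A₁ → b ∈ A₂ → ¬ Adj a b
      exposed₁ : ∀ {u} → u ∈ A₁ → Adj v u → u ∈ Y₁
      exposed₂ : ∀ {u} → u ∈ A₂ → Adj v u → u ∈ Y₂
      nbr₁ : ∀ {u} → u ∈ Y₁ → Adj v u
      nbr₂ : ∀ {u} → u ∈ Y₂ → Adj v u
      in₁ : ∀ {u} → u ∈ p → u ∈ A → u ≢ v → u ∈ A₁
      in₂ : ∀ {u} → u ∈ q → u ∈ A → u ≢ v → u ∈ A₂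

  -- All corners of `v` inside `p` and `q` are hidden. The two that remain bound exactly two
  -- sectors, one read along `p` and one along `q`, whose discs share neither vertices nor edges.
  splitV : ∀ {A v} p {q} → v ∈ A → Pl A (v ∷ p ++ v ∷ q) → Split A v p q
  splitV {A} {v} p {q} v∈ P with filter-accept (_∈? A) {xs = p ++ v ∷ q} v∈ | filter-accept (_∈? A) {xs = q} v∈
  ... | eq | eq' with hideSub [ v ] (++⁺ (∣-sub {A} {A ∖ v} ∖⊆ (⊆-refl {x = p})) (refl ∷ ∣-sub {A} {A ∖ v} ∖⊆ (⊆-refl {x = q})))
                        (subst (λ z → Disc _ _ (v ∷ z)) (trans (∣-++ p (v ∷ q)) (cong ((p ∣ A) ++_) eq')) (subst (Disc _ _) eq (disc P)))
  ...   | D with delete v D (here refl)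
  ...     | d with Deleted.sectors d
  ...       | skip ne _ = ⊥-elim (ne refl)
  ...       | hit s with double v (p ∣ (A ∖ v)) (∉-∣∖ p) (∉-∣∖ q) s
  ...         | t = record
    { A₁ = B₁ ; A₂ = B₂ ; Y₁ = Y₁ ; Y₂ = Y₂
    ; pl₁ = record { disc = restrict p disc₁ (λ i → proj₁ (s₁ i)) ; alive = proj₂ ∘ m₁
                   ; full = λ i j uv → Sum.map (inE₁ i j) (inE₁ j i) (full P (proj₁ (m₁ i)) (proj₁ (m₁ j)) uv) }
    ; pl₂ = record { disc = restrict q disc₂ (λ i → proj₁ (s₂ i)) ; alive = proj₂ ∘ m₂
                   ; full = λ i j uv → Sum.map (inE₂ i j) (inE₂ j i) (full P (proj₁ (m₂ i)) (proj₁ (m₂ j)) uv) }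
    ; cover = cov
    ; sub₁ = λ i → ∖⁻ (proj₁ (s₁ i)) ; sub₂ = λ i → ∖⁻ (proj₁ (s₂ i))
    ; disj = λ i j → disj (proj₂ (m₁ i)) (proj₂ (m₂ j))
    ; sep = λ i j uv → [ noE i j , noE' i j ]′ (full P (proj₁ (m₁ i)) (proj₁ (m₂ j)) uv)
    ; exposed₁ = λ i vu → inY₁ i ([ expo , expo' ]′ (full P v∈ (proj₁ (m₁ i)) vu))
    ; exposed₂ = λ i vu → inY₂ i ([ expo , expo' ]′ (full P v∈ (proj₁ (m₂ i)) vu))
    ; nbr₁ = λ i → All.lookup nbrs (N⊇₁ i) ; nbr₂ = λ i → All.lookup nbrs (N⊇₂ i)
    ; in₁ = λ i a ne → ∈-filter⁺ (_∈? A) (word⊆ disc₁ (∈-++⁺ˡ (∈-filter⁺ (_∈? (A ∖ v)) i (∖⁺ a ne)))) a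
    ; in₂ = λ i a ne → ∈-filter⁺ (_∈? A) (word⊆ disc₂ (∈-++⁺ˡ (∈-filter⁺ (_∈? (A ∖ v)) i (∖⁺ a ne)))) a }
    where
    open Deleted d using (A⁻; E⁻; N; verts; edges; nbrs)
    open Two t
    -- A drawing keeps vertices that have left `A`, so both sides are cut down to `A` again.
    B₁ = A₁′ ∣ A
    B₂ = A₂′ ∣ A
    v∉ : v ∉ A⁻
    v∉ = ∉-deleted d D
    m₁ : ∀ {u} → u ∈ B₁ → u ∈ A × u ∈ A₁′
    m₁ i = let a , b = ∈-filter⁻ (_∈? A) {xs = A₁′} i in b , a
    m₂ : ∀ {u} → u ∈ B₂ → u ∈ A × u ∈ A₂′
    m₂ i = let a , b = ∈-filter⁻ (_∈? A) {xs = A₂′} i in b , a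
    a₁ : ∀ {u} → u ∈ A₁′ → u ∈ A⁻
    a₁ i = subst (_ ∈_) (sym A≡) (∈-++⁺ˡ i)
    a₂ : ∀ {u} → u ∈ A₂′ → u ∈ A⁻
    a₂ i = subst (_ ∈_) (sym A≡) (∈-++⁺ʳ A₁′ i)
    s₁ : ∀ {u} → u ∈ B₁ → u ∈ A ∖ v × u ∈ A₁′
    s₁ i = let a , b = m₁ i in ∖⁺ a (λ { refl → v∉ (a₁ b) }) , b
    s₂ : ∀ {u} → u ∈ B₂ → u ∈ A ∖ v × u ∈ A₂′
    s₂ i = let a , b = m₂ i in ∖⁺ a (λ { refl → v∉ (a₂ b) }) , b
    restrict : ∀ r {X E Y B} → Disc X E (r ∣ (A ∖ v) ++ Y) → (∀ {u} → u ∈ B → u ∈ A ∖ v) → Disc X E ((r ++ Y) ∣ B)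
    restrict r {Y = Y} {B} D f = subst (Disc _ _) (sym (∣-++ r Y)) (hideSub [] (++⁺ (∣-sub f (⊆-refl {x = r})) (filter-⊆ (_∈? B) Y)) D)
    cov : ∀ {u} → u ∈ A → u ≢ v → u ∈ B₁ ⊎ u ∈ B₂
    cov i ne with ∈-resp-↭ verts (alive P i)
    ... | here e = ⊥-elim (ne e)
    ... | there j = Sum.map (λ k → ∈-filter⁺ (_∈? A) k i) (λ k → ∈-filter⁺ (_∈? A) k i) (∈-++⁻ A₁′ (subst (_ ∈_) A≡ j))
    inner : ∀ {a b} → a ≢ v → b ≢ v → (a , b) ∈ E′ P → (a , b) ∈ E₁′ ⊎ (a , b) ∈ E₂′
    inner ne ne' i with edges i
    ... | inj₁ j = ∈-++⁻ E₁′ (subst (_ ∈_) E≡ j)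
    ... | inj₂ (inj₁ (e , _)) = ⊥-elim (ne e)
    ... | inj₂ (inj₂ (e , _)) = ⊥-elim (ne' e)
    ne₁ : ∀ {u} → u ∈ B₁ → u ≢ v
    ne₁ i = proj₂ (∖⁻ (proj₁ (s₁ i)))
    ne₂ : ∀ {u} → u ∈ B₂ → u ≢ v
    ne₂ i = proj₂ (∖⁻ (proj₁ (s₂ i)))
    inE₁ : ∀ {a b} → a ∈ B₁ → b ∈ B₁ → (a , b) ∈ E′ P → (a , b) ∈ E₁′
    inE₁ i j e = [ id , (λ k → ⊥-elim (disj (proj₂ (m₁ i)) (proj₁ (edge⊆ disc₂ k)))) ]′ (inner (ne₁ i) (ne₁ j) e)
    inE₂ : ∀ {a b} → a ∈ B₂ → b ∈ B₂ → (a , b) ∈ E′ P → (a , b) ∈ E₂′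
    inE₂ i j e = [ (λ k → ⊥-elim (disj (proj₁ (edge⊆ disc₁ k)) (proj₂ (m₂ i)))) , id ]′ (inner (ne₂ i) (ne₂ j) e)
    noE : ∀ {a b} → a ∈ B₁ → b ∈ B₂ → (a , b) ∈ E′ P → ⊥
    noE i j e = [ (λ k → disj (proj₂ (edge⊆ disc₁ k)) (proj₂ (m₂ j))) , (λ k → disj (proj₂ (m₁ i)) (proj₁ (edge⊆ disc₂ k))) ]′ (inner (ne₁ i) (ne₂ j) e)
    noE' : ∀ {a b} → a ∈ B₁ → b ∈ B₂ → (b , a) ∈ E′ P → ⊥
    noE' i j e = [ (λ k → disj (proj₁ (edge⊆ disc₁ k)) (proj₂ (m₂ j))) , (λ k → disj (proj₂ (m₁ i)) (proj₂ (edge⊆ disc₂ k))) ]′ (inner (ne₂ j) (ne₁ i) e)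
    e⁻ : ∀ {a b} → (a , b) ∈ E⁻ → a ∈ A⁻ × b ∈ A⁻
    e⁻ i with ∈-++⁻ E₁′ (subst (_ ∈_) E≡ i)
    ... | inj₁ k = a₁ (proj₁ (edge⊆ disc₁ k)) , a₁ (proj₂ (edge⊆ disc₁ k))
    ... | inj₂ k = a₂ (proj₁ (edge⊆ disc₂ k)) , a₂ (proj₂ (edge⊆ disc₂ k))
    expo : ∀ {u} → (v , u) ∈ E′ P → u ∈ N
    expo i with edges i
    ... | inj₁ j = ⊥-elim (v∉ (proj₁ (e⁻ j)))
    ... | inj₂ (inj₁ (_ , k)) = k
    ... | inj₂ (inj₂ (refl , k)) = k
    expo' : ∀ {u} → (u , v) ∈ E′ P → u ∈ N
    expo' i with edges i
    ... | inj₁ j = ⊥-elim (v∉ (proj₂ (e⁻ j)))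
    ... | inj₂ (inj₁ (refl , k)) = k
    ... | inj₂ (inj₂ (_ , k)) = k
    inY₁ : ∀ {u} → u ∈ B₁ → u ∈ N → u ∈ Y₁
    inY₁ i j with ∈-++⁻ Y₁ (subst (_ ∈_) N≡ j)
    ... | inj₁ k = k
    ... | inj₂ k = ⊥-elim (disj (proj₂ (m₁ i)) (word⊆ disc₂ (∈-++⁺ʳ (q ∣ (A ∖ v)) k)))
    inY₂ : ∀ {u} → u ∈ B₂ → u ∈ N → u ∈ Y₂
    inY₂ i j with ∈-++⁻ Y₁ (subst (_ ∈_) N≡ j)
    ... | inj₂ k = k
    ... | inj₁ k = ⊥-elim (disj (word⊆ disc₁ (∈-++⁺ʳ (p ∣ (A ∖ v)) k)) (proj₂ (m₂ i)))
    N⊇₁ : ∀ {u} → u ∈ Y₁ → u ∈ N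
    N⊇₁ i = subst (_ ∈_) (sym N≡) (∈-++⁺ˡ i)
    N⊇₂ : ∀ {u} → u ∈ Y₂ → u ∈ N
    N⊇₂ i = subst (_ ∈_) (sym N≡) (∈-++⁺ʳ Y₁ i)

-- Reducible configurations

-- A reflective solver for associativity; the side condition of reassoc is refl.
infixr 5 _⊕_
data Word (X : Set) : Set where
  ⟨_⟩ : List X → Word X
  _⊕_ : Word X → Word X → Word X

word : ∀ {X} → Word X → List X
word ⟨ l ⟩ = l
word (a ⊕ b) = word a ++ word b

flat : ∀ {X} → Word X → List X → List X
flat ⟨ l ⟩ r = l ++ r
flat (a ⊕ b) r = flat a (flat b r)

flat-word : ∀ {X} (a : Word X) r → word a ++ r ≡ flat a r
flat-word ⟨ l ⟩ r = refl
flat-word (a ⊕ b) r = trans (++-assoc (word a) (word b) r) (trans (cong (word a ++_) (flat-word b r)) (flat-word a (flat b r)))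

reassoc : ∀ {X} (a b : Word X) → flat a [] ≡ flat b [] → word a ≡ word b
reassoc a b e = trans (sym (++-identityʳ (word a))) (trans (flat-word a []) (trans e (trans (sym (flat-word b [])) (++-identityʳ (word b)))))

∈-one : ∀ {X : Set} {x y : X} → x ∈ [ y ] → x ≡ y
∈-one (here e) = e

∈-order : ∀ {X : Set} {x y : X} {L} → x ∈ L → y ∈ L → x ≢ y →
  (∃[ a ] ∃[ b ] (L ≡ a ++ x ∷ b × y ∈ b)) ⊎ (∃[ a ] ∃[ b ] (L ≡ a ++ y ∷ b × x ∈ b))
∈-order {x = x} {y} x∈ y∈ ne with ∈-∃++ x∈
... | a , b , refl with ∈-++⁻ a y∈
...   | inj₂ (here e) = ⊥-elim (ne (sym e))
...   | inj₂ (there k) = inj₁ (a , b , refl , k)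
...   | inj₁ k with ∈-∃++ k
...     | c , d , refl = inj₂ (c , d ++ x ∷ b , ++-assoc c (y ∷ d) (x ∷ b) , ∈-insert d)

uniqueˡ : ∀ {X : Set} {u v : X} a {b} → Unique (a ++ v ∷ b) → u ∈ a → u ≢ v
uniqueˡ (x ∷ a) (px ∷ _) (here refl) = All.lookup px (∈-insert a)
uniqueˡ (x ∷ a) (_ ∷ us) (there i) = uniqueˡ a us i

uniqueʳ : ∀ {X : Set} {u v : X} a {b} → Unique (a ++ v ∷ b) → u ∈ b → u ≢ v
uniqueʳ [] (px ∷ _) i refl = All.lookup px i refl
uniqueʳ (x ∷ a) (_ ∷ us) i = uniqueʳ a us i

module Instances {n : ℕ} (G : Graph n) where
  open Discs G
  open Weak G
  open Planar G

  ⟦⟧-mono : ∀ {p q} {P : Set p} {Q : Set q} (x : Dec P) (y : Dec Q) → (P → Q) → ⟦ x ⟧ ≤ ⟦ y ⟧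
  ⟦⟧-mono (no _) _ f = z≤n
  ⟦⟧-mono (yes p) (yes _) f = ≤-refl
  ⟦⟧-mono (yes p) (no ¬q) f = ⊥-elim (¬q (f p))

  ⟦⟧-no : ∀ {p} {P : Set p} (x : Dec P) → ¬ P → ⟦ x ⟧ ≡ 0
  ⟦⟧-no (no _) _ = refl
  ⟦⟧-no (yes p) ¬p = ⊥-elim (¬p p)

  ⟦⟧-yes : ∀ {p} {P : Set p} (x : Dec P) → P → ⟦ x ⟧ ≡ 1
  ⟦⟧-yes (yes _) _ = refl
  ⟦⟧-yes (no ¬p) p = ⊥-elim (¬p p)

  ⟦⟧≤1 : ∀ {p} {P : Set p} (x : Dec P) → ⟦ x ⟧ ≤ 1
  ⟦⟧≤1 (yes _) = ≤-refl
  ⟦⟧≤1 (no _) = z≤n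

  ι : V → List V → ℕ
  ι u L = ⟦ u ∈? L ⟧

  ι-mono : ∀ {u} L L' → (u ∈ L → u ∈ L') → ι u L ≤ ι u L'
  ι-mono {u} L L' = ⟦⟧-mono (u ∈? L) (u ∈? L')

  ι-no : ∀ {u L} → u ∉ L → ι u L ≡ 0
  ι-no {u} {L} = ⟦⟧-no (u ∈? L)

  ι-yes : ∀ {u L} → u ∈ L → ι u L ≡ 1
  ι-yes {u} {L} = ⟦⟧-yes (u ∈? L)

  -- The loss of u: one for each of the three vertices of S adjacent to u (with
  -- neighbourhoods X₁, X₂, X₃), one if u lies on the outer face, one if u ∈ I.
  cost : (X₁ X₂ X₃ P I : List V) → V → ℕ
  cost X₁ X₂ X₃ P I u = ι u X₁ + ι u X₂ + ι u X₃ + ι u P + ι u I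

  -- The outer face after the deletion of S is read as the neighbours of the
  -- three vertices of S in turn, followed by the rest P of the outer boundary.
  record Ok (A X₁ X₂ X₃ P I : List V) : Set where
    field
      pl : Pl A (X₁ ++ X₂ ++ X₃ ++ P)
      I⊆P : ∀ {u} → u ∈ I → u ∈ P
      indep : ∀ {u v} → u ∈ I → v ∈ I → ¬ Adj u v
      no3 : ∀ {u} → u ∈ A → u ∈ I → u ∈ X₁ → u ∈ X₂ → u ∈ X₃ → ⊥

  open Ok

  -- Five memberships at once would be a vertex of `I` in all three segments, which `no3` excludes.
  -- This is the nonnegativity of the function of the instance.
  cost≤4 : ∀ {A X₁ X₂ X₃ P I} → Ok A X₁ X₂ X₃ P I → ∀ {u} → u ∈ A → cost X₁ X₂ X₃ P I u ≤ 4
  cost≤4 {A} {X₁} {X₂} {X₃} {P} {I} ok {u} a with u ∈? X₁ | u ∈? X₂ | u ∈? X₃ | u ∈? I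
  ... | yes x | yes y | yes z | yes i = ⊥-elim (no3 ok a i x y z)
  ... | yes x | yes y | yes z | no _ = +-mono-≤ (s≤s (s≤s (s≤s (⟦⟧≤1 (u ∈? P))))) z≤n
  ... | no _ | y | z | i = +-mono-≤ (+-mono-≤ (+-mono-≤ (⟦⟧≤1 y) (⟦⟧≤1 z)) (⟦⟧≤1 (u ∈? P))) (⟦⟧≤1 i)
  ... | yes _ | no _ | z | i = +-mono-≤ (+-mono-≤ (s≤s (⟦⟧≤1 z)) (⟦⟧≤1 (u ∈? P))) (⟦⟧≤1 i)
  ... | yes _ | yes _ | no _ | i = +-mono-≤ (s≤s (s≤s (⟦⟧≤1 (u ∈? P)))) (⟦⟧≤1 i)

  ok-restrict : ∀ {A B X₁ X₂ X₃ P I} → (∀ {v} → v ∈ B → v ∈ A) → Ok A X₁ X₂ X₃ P I → Ok B X₁ X₂ X₃ P I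
  ok-restrict f ok = record { pl = Pl-sub f ⊆-refl (pl ok) ; I⊆P = I⊆P ok ; indep = indep ok ; no3 = no3 ok ∘ f }

  -- The part B of A ∖ {x} ∪ D separated from the rest by x and D; the sector
  -- at x lies between two corners of x, in the segments L₁ and L₂.
  record Sector (A A° D : List V) (x : V) (lb M ra L₁ L₂ Q : List V) : Set where
    field
      B Nₓ : List V
      plB : Pl B ((lb ++ M ++ ra) ++ Nₓ)
      B⊆ : ∀ {u} → u ∈ B → u ∈ A°
      x∉ : x ∉ B
      nbrs : ∀ {u t} → u ∈ B → t ∈ A → t ∉ B → Adj t u → t ∈ x ∷ D
      exposed : ∀ {u} → u ∈ B → Adj x u → u ∈ Nₓ
      nbrₓ : ∀ {u} → u ∈ Nₓ → Adj x u
      inL₁ : ∀ {u} → u ∈ B → u ∈ L₁ → u ∈ lb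
      inL₂ : ∀ {u} → u ∈ B → u ∈ L₂ → u ∈ ra
      notQ : ∀ {u} → u ∈ B → u ∉ Q
      inB : ∀ {u} → u ∈ lb ++ M ++ ra → u ∈ A° → u ≢ x → u ∈ B

  sectorOf : ∀ {A A° D x} la lb M ra rb Q → Split A° x (lb ++ M ++ ra) (rb ++ Q ++ la) →
    (∀ {u} → u ∈ A → u ∉ D → u ∈ A°) → (∀ {u} → u ∈ D ⊎ u ∉ D) →
    Sector A A° D x lb M ra (la ++ x ∷ lb) (ra ++ x ∷ rb) Q
  sectorOf {A} {A°} {D} {x} la lb M ra rb Q S A→ D? = record
    { B = A₁ ; Nₓ = Y₁ ; plB = pl₁ ; B⊆ = proj₁ ∘ sub₁ ; x∉ = λ i → proj₂ (sub₁ i) refl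
    ; nbrs = nb ; exposed = exposed₁ ; nbrₓ = nbr₁
    ; inL₁ = λ i → [ (λ k → ⊥-elim (out i (∈-++⁺ʳ rb (∈-++⁺ʳ Q k)))) ,
                     (λ { (here refl) → ⊥-elim (proj₂ (sub₁ i) refl) ; (there k) → k }) ]′ ∘ ∈-++⁻ la
    ; inL₂ = λ i → [ id , (λ { (here refl) → ⊥-elim (proj₂ (sub₁ i) refl) ; (there k) → ⊥-elim (out i (∈-++⁺ˡ k)) }) ]′ ∘ ∈-++⁻ ra
    ; notQ = λ i k → out i (∈-++⁺ʳ rb (∈-++⁺ˡ k))
    ; inB = in₁ }
    where
    open Split S
    out : ∀ {u} → u ∈ A₁ → u ∈ rb ++ Q ++ la → ⊥
    out i k = disj i (in₂ k (proj₁ (sub₁ i)) (proj₂ (sub₁ i)))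
    nb : ∀ {u t} → u ∈ A₁ → t ∈ A → t ∉ A₁ → Adj t u → t ∈ x ∷ D
    nb {t = t} i ta t∉ tu with t ≟ x | D? {t}
    ... | yes refl | _ = here refl
    ... | no _ | inj₁ d = there d
    ... | no ne | inj₂ nd with cover (A→ ta nd) ne
    ...   | inj₁ k = ⊥-elim (t∉ k)
    ...   | inj₂ k = ⊥-elim (sep i k (Adj-sym tu))

  -- Rotated to start at the corner of `x` in the first segment, the word meets the second corner
  -- after `lb ++ M ++ ra`; cutting at these two corners gives the sector.
  sector : ∀ {A A° D x} la lb M ra rb Q → Pl A° ((la ++ x ∷ lb) ++ M ++ (ra ++ x ∷ rb) ++ Q) → x ∈ A° →
    (∀ {u} → u ∈ A → u ∉ D → u ∈ A°) → (∀ {u} → u ∈ D ⊎ u ∉ D) →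
    Sector A A° D x lb M ra (la ++ x ∷ lb) (ra ++ x ∷ rb) Q
  sector {A} {A°} {D} {x} la lb M ra rb Q P x∈ =
    sectorOf la lb M ra rb Q (splitV (lb ++ M ++ ra) x∈ (subst (Pl A°) eq' (Pl-rot la (subst (Pl A°) eq P))))
    where
    eq : (la ++ x ∷ lb) ++ M ++ (ra ++ x ∷ rb) ++ Q ≡ la ++ (x ∷ (lb ++ M ++ ra) ++ x ∷ rb ++ Q)
    eq = trans (++-assoc la (x ∷ lb) _) (cong (λ z → la ++ x ∷ z)
           (trans (cong (λ z → lb ++ M ++ z) (++-assoc ra (x ∷ rb) Q))
             (trans (cong (lb ++_) (sym (++-assoc M ra _))) (sym (++-assoc lb (M ++ ra) _)))))
    eq' : (x ∷ (lb ++ M ++ ra) ++ x ∷ rb ++ Q) ++ la ≡ x ∷ (lb ++ M ++ ra) ++ x ∷ (rb ++ Q ++ la)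
    eq' = cong (x ∷_) (trans (++-assoc (lb ++ M ++ ra) (x ∷ rb ++ Q) la) (cong (λ z → (lb ++ M ++ ra) ++ x ∷ z) (++-assoc rb Q la)))

  cast : ∀ {A} (a b : Word V) → flat a [] ≡ flat b [] → Pl A (word a) → Pl A (word b)
  cast a b e = subst (Pl _) (reassoc a b e)

  module _ {u : V} {P I P' I' : List V} where

    -- A vertex that loses one more pays by entering `P'` if it was inside, and by entering `I'` if
    -- it was on the boundary.
    exchange : ∀ {Q : Set} (q : Dec Q) → (u ∈ P → u ∈ P') → (u ∈ I → u ∈ I') → (u ∈ I → u ∈ P) →
      (Q → u ∈ P → u ∈ I' × u ∉ I) → (Q → u ∉ P → u ∈ P') → ι u P + ι u I + ⟦ q ⟧ ≤ ι u P' + ι u I'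
    exchange (no _) f g h k l = ≤-trans (≤-reflexive (+-identityʳ _)) (+-mono-≤ (ι-mono P P' f) (ι-mono I I' g))
    exchange (yes q) f g h k l with u ∈? P
    ... | yes p rewrite ι-yes (f p) | ι-yes (proj₁ (k q p)) | ι-no (proj₂ (k q p)) = ≤-refl
    ... | no np rewrite ι-no (np ∘ h) | ι-yes (l q np) = s≤s z≤n

    -- Only a vertex outside `P` may lose two at once; it enters both `P'` and `I'`.
    exchange₂ : ∀ {Q R : Set} (q : Dec Q) (r : Dec R) → (u ∈ P → u ∈ P') → (u ∈ I → u ∈ I') → (u ∈ I → u ∈ P) →
      (Q → u ∉ P) → (R → u ∈ P → u ∈ I' × u ∉ I) → (Q → u ∈ P') → (R → u ∉ P → u ∈ P') → (Q → R → u ∈ I') →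
      ι u P + ι u I + ⟦ q ⟧ + ⟦ r ⟧ ≤ ι u P' + ι u I'
    exchange₂ (no _) r f g h k l m o j = ≤-trans (≤-reflexive (cong (_+ ⟦ r ⟧) (+-identityʳ (ι u P + ι u I)))) (exchange r f g h l o)
    exchange₂ (yes q) (no _) f g h k l m o j = ≤-trans (≤-reflexive (+-identityʳ _)) (exchange (yes q) f g h (λ q p → ⊥-elim (k q p)) (λ q _ → m q))
    exchange₂ (yes q) (yes r) f g h k l m o j rewrite ι-no (k q) | ι-no (k q ∘ h) | ι-yes (m q) | ι-yes (j q r) = ≤-refl

  cost-≤ : ∀ {u X₁ X₂ X₃ P I P' I' a} → ι u P + ι u I + a ≤ ι u P' + ι u I' →
    cost X₁ X₂ X₃ P I u + a ≤ cost X₁ X₂ X₃ P' I' u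
  cost-≤ {u} {X₁} {X₂} {X₃} {P} {I} {P'} {I'} {a} le =
    ≤-trans (≤-reflexive (s k (ι u P) (ι u I) a)) (≤-trans (+-monoʳ-≤ k le) (≤-reflexive (sym (+-assoc k (ι u P') (ι u I')))))
    where
    k : ℕ
    k = ι u X₁ + ι u X₂ + ι u X₃
    s : ∀ k p i a → k + p + i + a ≡ k + (p + i + a)
    s = solve-∀

  Independent : List V → Set
  Independent I = ∀ {u v} → u ∈ I → v ∈ I → ¬ Adj u v

  indep-++ : ∀ {I J} → Independent I → Independent J → (∀ {u v} → u ∈ I → v ∈ J → ¬ Adj u v) → Independent (I ++ J)
  indep-++ {I} f g h i j with ∈-++⁻ I i | ∈-++⁻ I j
  ... | inj₁ x | inj₁ y = f x y
  ... | inj₂ x | inj₂ y = g x y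
  ... | inj₁ x | inj₂ y = h x y
  ... | inj₂ x | inj₁ y = h y x ∘ Adj-sym

  indep-[_] : ∀ v → Independent [ v ]
  indep-[ v ] (here refl) (here refl) = Adj-irrefl

  indep-[] : Independent []
  indep-[] ()

  2≤cost : ∀ {X₁ X₂ X₃ P I u} → u ∈ P → u ∈ I → 2 ≤ cost X₁ X₂ X₃ P I u
  2≤cost {X₁} {X₂} {X₃} {P} {I} {u} p i rewrite ι-yes p | ι-yes i = +-mono-≤ {1} (m≤n+m 1 _) ≤-refl

  module Induction {A X₁ X₂ X₃ P I : List V} (ok : Ok A X₁ X₂ X₃ P I)
    (IH : ∀ {A' X₁' X₂' X₃' P' I'} → length A' < length A → Ok A' X₁' X₂' X₃' P' I' → W A' (cost X₁' X₂' X₃' P' I'))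
    where


    Goal : Set
    Goal = W A (cost X₁ X₂ X₃ P I)

    -- Remove A ∖ B first and then B, both by induction; in the instance B the
    -- separating vertices τ take the role of S.
    reduce : ∀ {B X₁' X₂' X₃' P' I'} (τ : V → List V) {s b} → b ∈ B → s ∈ A → s ∉ B → (∀ {u} → u ∈ B → u ∈ A) →
      (∀ {u t} → u ∈ B → t ∈ A → t ∉ B → Adj t u → t ∈ τ u) →
      (∀ {u} → u ∈ B → cost X₁ X₂ X₃ P I u + length (τ u) ≤ cost X₁' X₂' X₃' P' I' u) →
      Ok B X₁' X₂' X₃' P' I' → Goal
    reduce {B} τ {s} {b} b∈ s∈ s∉ B⊆A nb le okB = compose τ cov (λ i → proj₁ (F⁻ i)) (λ i → proj₁ (R⁻ i)) (λ i j → proj₂ (F⁻ i) (proj₂ (R⁻ j)))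
        (λ _ → ≤-refl)
        (λ j k tv → nb (proj₂ (R⁻ j)) (proj₁ (F⁻ k)) (proj₂ (F⁻ k)) tv)
        (λ j → le (proj₂ (R⁻ j)) , cost≤4 okB (proj₂ (R⁻ j)))
        (IH (filter-notAll (λ v → ¬? (v ∈? B)) A (lose (B⊆A b∈) (λ nb → nb b∈))) (ok-restrict (proj₁ ∘ F⁻) ok))
        (IH (filter-notAll (_∈? B) A (lose s∈ s∉)) (ok-restrict (proj₂ ∘ R⁻) okB))
      where
      F R : List V
      F = filter (λ v → ¬? (v ∈? B)) A
      R = filter (_∈? B) A
      F⁻ : ∀ {v} → v ∈ F → v ∈ A × v ∉ B
      F⁻ = ∈-filter⁻ (λ v → ¬? (v ∈? B))
      R⁻ : ∀ {v} → v ∈ R → v ∈ A × v ∈ B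
      R⁻ = ∈-filter⁻ (_∈? B)
      cov : ∀ {v} → v ∈ A → v ∈ F ⊎ v ∈ R
      cov {v} i with v ∈? B
      ... | yes j = inj₂ (∈-filter⁺ (_∈? B) i j)
      ... | no j = inj₁ (∈-filter⁺ (λ v → ¬? (v ∈? B)) i j)

    nbrsIn : List V → V → List V
    nbrsIn D u = filter (λ t → adj? t u) D

    nbrsIn-∷ : ∀ x D u → length (nbrsIn (x ∷ D) u) ≡ ⟦ adj? x u ⟧ + length (nbrsIn D u)
    nbrsIn-∷ x D u with adj? x u
    ... | yes _ = refl
    ... | no _ = refl

    D-dec : ∀ D {u : V} → u ∈ D ⊎ u ∉ D
    D-dec D {u} with u ∈? D
    ... | yes i = inj₁ i
    ... | no i = inj₂ i

    I∩ : List V → List V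
    I∩ M = filter (_∈? M) I

    module _ {A° D x lb M ra L₁ L₂ Q} (sc : Sector A A° D x lb M ra L₁ L₂ Q) (→A : ∀ {u} → u ∈ A° → u ∈ A) (x∈ : x ∈ A°) where
      open Sector sc

      -- `L₁` and `L₂` stand for the neighbourhoods of two vertices joined through `x`. These two
      -- and `x` are the deleted vertices of the instance on `B`, with boundary `M`, and `block`
      -- keeps `I` away from all three. For a single chord one of the two segments is just `[ x ]`,
      -- and only two deleted vertices remain.
      sectorReduce : ∀ {b} → b ∈ B →
        (∀ {u} → u ∈ A° → u ≢ x → u ∉ Q → cost X₁ X₂ X₃ P I u + length (nbrsIn D u) ≤ ι u L₁ + ι u L₂ + ι u M + ι u (I∩ M)) →
        (∀ {u} → u ∈ A° → u ∈ I → u ∈ M → u ∈ L₁ → u ∈ L₂ → Adj x u → ⊥) →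
        (∀ {v} → v ∈ lb → v ∈ L₁) → (∀ {v} → v ∈ ra → v ∈ L₂) → Goal
      sectorReduce b∈ le block lb⊆ ra⊆ = reduce {B} {ra} {Nₓ} {lb} {M} {I∩ M} (nbrsIn (x ∷ D)) b∈ (→A x∈) x∉ (→A ∘ B⊆)
        (λ i t t∉ tu → ∈-filter⁺ (λ t → adj? t _) (nbrs i t t∉ tu) tu)
        le'
        record { pl = Pl-sub id ⊆-refl (subst (Pl B) e2 (Pl-rot (lb ++ M) (subst (Pl B) e1 plB)))
               ; I⊆P = λ i → proj₂ (I⁻ i) ; indep = λ i j → indep ok (proj₁ (I⁻ i)) (proj₁ (I⁻ j))
               ; no3 = λ a i p q r → block (B⊆ a) (proj₁ (I⁻ i)) (proj₂ (I⁻ i)) (lb⊆ r) (ra⊆ p) (nbrₓ q) }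
        where
        I⁻ : ∀ {u} → u ∈ I∩ M → u ∈ I × u ∈ M
        I⁻ = ∈-filter⁻ (_∈? M)
        e1 : (lb ++ M ++ ra) ++ Nₓ ≡ (lb ++ M) ++ ra ++ Nₓ
        e1 = trans (cong (_++ Nₓ) (sym (++-assoc lb M ra))) (++-assoc (lb ++ M) ra Nₓ)
        e2 : (ra ++ Nₓ) ++ lb ++ M ≡ ra ++ Nₓ ++ lb ++ M
        e2 = ++-assoc ra Nₓ (lb ++ M)
        le' : ∀ {u} → u ∈ B → cost X₁ X₂ X₃ P I u + length (nbrsIn (x ∷ D) u) ≤ cost ra Nₓ lb M (I∩ M) u
        le' {u} i = begin
          c + length (nbrsIn (x ∷ D) u) ≡⟨ cong (λ z → c + z) (nbrsIn-∷ x D u) ⟩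
          c + (⟦ adj? x u ⟧ + d) ≡⟨ s1 c ⟦ adj? x u ⟧ d ⟩
          ⟦ adj? x u ⟧ + (c + d) ≤⟨ +-mono-≤ (⟦⟧-mono (adj? x u) (u ∈? Nₓ) (exposed i)) (le (B⊆ i) (λ { refl → x∉ i }) (notQ i)) ⟩
          ι u Nₓ + (ι u L₁ + ι u L₂ + m + k) ≤⟨ +-mono-≤ {ι u Nₓ} ≤-refl (+-mono-≤ {_} {_} {k} (+-mono-≤ {_} {_} {m} (+-mono-≤ (ι-mono L₁ lb (inL₁ i)) (ι-mono L₂ ra (inL₂ i))) ≤-refl) ≤-refl) ⟩
          ι u Nₓ + (ι u lb + ι u ra + m + k) ≡⟨ s2 (ι u Nₓ) (ι u lb) (ι u ra) m k ⟩
          cost ra Nₓ lb M (I∩ M) u ∎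
          where
          open ≤-Reasoning
          c d m k : ℕ
          c = cost X₁ X₂ X₃ P I u
          d = length (nbrsIn D u)
          m = ι u M
          k = ι u (I∩ M)
          s1 : ∀ c a d → c + (a + d) ≡ a + (c + d)
          s1 = solve-∀
          s2 : ∀ t l r m k → t + (l + r + m + k) ≡ r + t + l + m + k
          s2 = solve-∀

    mid : ∀ {u v : V} Pa {Pb} → P ≡ Pa ++ v ∷ Pb → u ∈ P → u ≢ v → u ∈ Pa ⊎ u ∈ Pb
    mid Pa refl i ne with ∈-++⁻ Pa i
    ... | inj₁ j = inj₁ j
    ... | inj₂ (here e) = ⊥-elim (ne e)
    ... | inj₂ (there j) = inj₂ j

    I∩-in : ∀ {M u} → (u ∈ P → u ∈ M) → u ∈ I → u ∈ I∩ M
    I∩-in {M} f i = ∈-filter⁺ (_∈? M) i (f (I⊆P ok i))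

    from : ∀ Pa v Pb → P ≡ Pa ++ v ∷ Pb → Pl A (v ∷ Pb ++ X₁ ++ X₂ ++ X₃ ++ Pa)
    from Pa v Pb eq =
      cast ((⟨ [ v ] ⟩ ⊕ ⟨ Pb ⟩) ⊕ ⟨ X₁ ⟩ ⊕ ⟨ X₂ ⟩ ⊕ ⟨ X₃ ⟩ ⊕ ⟨ Pa ⟩) (⟨ [ v ] ⟩ ⊕ ⟨ Pb ⟩ ⊕ ⟨ X₁ ⟩ ⊕ ⟨ X₂ ⟩ ⊕ ⟨ X₃ ⟩ ⊕ ⟨ Pa ⟩) refl
        (Pl-rot (X₁ ++ X₂ ++ X₃ ++ Pa)
          (cast (⟨ X₁ ⟩ ⊕ ⟨ X₂ ⟩ ⊕ ⟨ X₃ ⟩ ⊕ ⟨ Pa ⟩ ⊕ ⟨ [ v ] ⟩ ⊕ ⟨ Pb ⟩) ((⟨ X₁ ⟩ ⊕ ⟨ X₂ ⟩ ⊕ ⟨ X₃ ⟩ ⊕ ⟨ Pa ⟩) ⊕ ⟨ [ v ] ⟩ ⊕ ⟨ Pb ⟩) refl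
            (subst (λ z → Pl A (X₁ ++ X₂ ++ X₃ ++ z)) eq (pl ok))))

    -- The chord joins `v` to the deleted vertex with neighbourhood `X₃` and cuts off the part with
    -- boundary `Pa`. Its two ends are the only deleted vertices of that part, so nothing can block
    -- it.
    chordLast : ∀ Pa v Pb {w} → P ≡ Pa ++ v ∷ Pb → v ∈ X₃ → v ∈ A → w ∈ Pa → w ∈ A → w ≢ v → Goal
    chordLast Pa v Pb {w} eq v∈X v∈ w∈ wA w≢v with ∈-∃++ v∈X
    ... | la , lb , xe = sectorReduce sc id v∈ (inB (∈-++⁺ʳ lb (∈-++⁺ˡ w∈)) wA w≢v) le
          (λ _ _ _ _ q xu → Adj-irrefl (subst (Adj v) (∈-one q) xu)) (λ i → ∈-++⁺ʳ la (there i)) (λ ())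
      where
      Q = Pb ++ X₁ ++ X₂
      sc : Sector A A [] v lb Pa [] (la ++ v ∷ lb) [ v ] Q
      sc = sector la lb Pa [] [] Q
             (cast (⟨ la ++ v ∷ lb ⟩ ⊕ (⟨ Pa ⟩ ⊕ ⟨ [ v ] ⟩ ⊕ ⟨ Pb ⟩) ⊕ ⟨ X₁ ⟩ ⊕ ⟨ X₂ ⟩) (⟨ la ++ v ∷ lb ⟩ ⊕ ⟨ Pa ⟩ ⊕ ⟨ [ v ] ⟩ ⊕ (⟨ Pb ⟩ ⊕ ⟨ X₁ ⟩ ⊕ ⟨ X₂ ⟩)) refl
               (subst (λ z → Pl A (z ++ (Pa ++ v ∷ Pb) ++ X₁ ++ X₂)) xe (subst (λ z → Pl A (X₃ ++ z ++ X₁ ++ X₂)) eq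
                 (cast ((⟨ X₃ ⟩ ⊕ ⟨ P ⟩) ⊕ ⟨ X₁ ⟩ ⊕ ⟨ X₂ ⟩) (⟨ X₃ ⟩ ⊕ ⟨ P ⟩ ⊕ ⟨ X₁ ⟩ ⊕ ⟨ X₂ ⟩) refl
                   (Pl-rot (X₁ ++ X₂) (cast (⟨ X₁ ⟩ ⊕ ⟨ X₂ ⟩ ⊕ ⟨ X₃ ⟩ ⊕ ⟨ P ⟩) ((⟨ X₁ ⟩ ⊕ ⟨ X₂ ⟩) ⊕ ⟨ X₃ ⟩ ⊕ ⟨ P ⟩) refl (pl ok)))))))
             v∈ (λ a _ → a) (inj₂ λ ())
      open Sector sc using (inB)
      le : ∀ {u} → u ∈ A → u ≢ v → u ∉ Q → cost X₁ X₂ X₃ P I u + 0 ≤ ι u (la ++ v ∷ lb) + ι u [ v ] + ι u Pa + ι u (I∩ Pa)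
      le {u} a ne nq rewrite ι-no {u} {X₁} (nq ∘ ∈-++⁺ʳ Pb ∘ ∈-++⁺ˡ) | ι-no {u} {X₂} (nq ∘ ∈-++⁺ʳ Pb ∘ ∈-++⁺ʳ X₁) | ι-no {u} {[ v ]} (ne ∘ ∈-one) =
        ≤-trans (≤-reflexive (+-identityʳ _)) (+-mono-≤ (+-mono-≤ (≤-trans (≤-reflexive (cong (ι u) xe)) (≤-reflexive (sym (+-identityʳ _)))) (ι-mono P Pa inPa)) (ι-mono I (I∩ Pa) (I∩-in inPa)))
        where
        inPa : u ∈ P → u ∈ Pa
        inPa i = [ id , (λ k → ⊥-elim (nq (∈-++⁺ˡ k))) ]′ (mid Pa eq i ne)

    chordFirst : ∀ Pa v Pb {w} → P ≡ Pa ++ v ∷ Pb → v ∈ X₁ → v ∈ A → w ∈ Pb → w ∈ A → w ≢ v → Goal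
    chordFirst Pa v Pb {w} eq v∈X v∈ w∈ wA w≢v with ∈-∃++ v∈X
    ... | ra , rb , xe = sectorReduce sc id v∈ (inB (∈-++⁺ˡ w∈) wA w≢v) le
          (λ _ _ _ q _ xu → Adj-irrefl (subst (Adj v) (∈-one q) xu)) (λ ()) ∈-++⁺ˡ
      where
      Q = X₂ ++ X₃ ++ Pa
      sc : Sector A A [] v [] Pb ra [ v ] (ra ++ v ∷ rb) Q
      sc = sector [] [] Pb ra rb Q
             (subst (λ z → Pl A (v ∷ Pb ++ z ++ Q)) xe
               (from Pa v Pb eq))
             v∈ (λ a _ → a) (inj₂ λ ())
      open Sector sc using (inB)
      le : ∀ {u} → u ∈ A → u ≢ v → u ∉ Q → cost X₁ X₂ X₃ P I u + 0 ≤ ι u [ v ] + ι u (ra ++ v ∷ rb) + ι u Pb + ι u (I∩ Pb)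
      le {u} a ne nq rewrite ι-no {u} {X₂} (nq ∘ ∈-++⁺ˡ) | ι-no {u} {X₃} (nq ∘ ∈-++⁺ʳ X₂ ∘ ∈-++⁺ˡ) | ι-no {u} {[ v ]} (ne ∘ ∈-one) =
        ≤-trans (≤-reflexive (+-identityʳ _)) (+-mono-≤ (+-mono-≤ (≤-reflexive (trans (+-identityʳ _) (trans (+-identityʳ _) (cong (ι u) xe)))) (ι-mono P Pb inPb)) (ι-mono I (I∩ Pb) (I∩-in inPb)))
        where
        inPb : u ∈ P → u ∈ Pb
        inPb i = [ (λ k → ⊥-elim (nq (∈-++⁺ʳ X₂ (∈-++⁺ʳ X₃ k)))) , id ]′ (mid Pa eq i ne)

    nbrs₁ : ∀ {A° x lb M ra L₁ L₂ Q} (sc : Sector A A° [] x lb M ra L₁ L₂ Q) → let open Sector sc in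
      ∀ {u t} → u ∈ B → t ∈ A → t ∉ B → Adj t u → t ∈ nbrsIn [ x ] u
    nbrs₁ sc i t t∉ tu = ∈-filter⁺ (λ t → adj? t _) (Sector.nbrs sc i t t∉ tu) tu

    I∩⁻ : ∀ {M u} → u ∈ I∩ M → u ∈ I × u ∈ M
    I∩⁻ {M} = ∈-filter⁻ (_∈? M)

    -- The chord joins `v` to the middle deleted vertex. The part that carries `X₃` and `Pa` keeps
    -- two old deleted vertices and gets `v` as the third, so a vertex of `I` adjacent to all of
    -- them has to be excluded by `block`.
    rightOf′ : ∀ {Pa v Pb w la lb} → Sector A A [] v lb (X₃ ++ Pa) [] (la ++ v ∷ lb) [ v ] (Pb ++ X₁) →
      P ≡ Pa ++ v ∷ Pb → X₂ ≡ la ++ v ∷ lb → v ∈ A → w ∈ Pa → w ∈ A → w ≢ v →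
      (∀ {u} → u ∈ I → u ∈ Pa → u ∈ X₂ → u ∈ X₃ → Adj v u → ⊥) → Goal
    rightOf′ {Pa} {v} {Pb} {w} {la} {lb} sc eq xe v∈ w∈ wA w≢v block =
      reduce (nbrsIn [ v ]) (inB (∈-++⁺ʳ lb (∈-++⁺ˡ (∈-++⁺ʳ X₃ w∈))) wA w≢v) v∈ x∉ B⊆ (nbrs₁ sc)
           (λ i → le (λ { refl → x∉ i }) (notQ i) (inL₁ i) (exposed i))
           record { pl = cast (⟨ Nₓ ⟩ ⊕ (⟨ lb ⟩ ⊕ (⟨ X₃ ⟩ ⊕ ⟨ Pa ⟩) ⊕ ⟨ [] ⟩)) (⟨ Nₓ ⟩ ⊕ ⟨ lb ⟩ ⊕ ⟨ X₃ ⟩ ⊕ ⟨ Pa ⟩) refl (Pl-rot (lb ++ (X₃ ++ Pa) ++ []) plB)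
                  ; I⊆P = λ i → proj₂ (I∩⁻ i) ; indep = λ i j → indep ok (proj₁ (I∩⁻ i)) (proj₁ (I∩⁻ j))
                  ; no3 = λ a i p q r → block (proj₁ (I∩⁻ i)) (proj₂ (I∩⁻ i)) (subst (_ ∈_) (sym xe) (∈-++⁺ʳ la (there q))) r (nbrₓ p) }
      where
      open Sector sc
      le : ∀ {u} → u ≢ v → u ∉ Pb ++ X₁ → (u ∈ la ++ v ∷ lb → u ∈ lb) → (Adj v u → u ∈ Nₓ) →
           cost X₁ X₂ X₃ P I u + length (nbrsIn [ v ] u) ≤ cost Nₓ lb X₃ Pa (I∩ Pa) u
      le {u} ne nq il ex rewrite ι-no {u} {X₁} (nq ∘ ∈-++⁺ʳ Pb) | nbrsIn-∷ v [] u | +-identityʳ ⟦ adj? v u ⟧ =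
        ≤-trans (≤-reflexive (s (ι u X₂) (ι u X₃) (ι u P) (ι u I) ⟦ adj? v u ⟧))
          (+-mono-≤ (+-mono-≤ (+-mono-≤ (+-mono-≤ (⟦⟧-mono (adj? v u) (u ∈? Nₓ) ex) (≤-trans (≤-reflexive (cong (ι u) xe)) (ι-mono (la ++ v ∷ lb) lb il))) ≤-refl) (ι-mono P Pa inPa)) (ι-mono I (I∩ Pa) (I∩-in inPa)))
        where
        inPa : u ∈ P → u ∈ Pa
        inPa k = [ id , (λ k → ⊥-elim (nq (∈-++⁺ˡ k))) ]′ (mid Pa eq k ne)
        s : ∀ x y p i a → x + y + p + i + a ≡ a + x + y + p + i
        s = solve-∀

    rightOf : ∀ Pa v Pb {w} → P ≡ Pa ++ v ∷ Pb → v ∈ X₂ → v ∈ A → w ∈ Pa → w ∈ A → w ≢ v →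
      (∀ {u} → u ∈ I → u ∈ Pa → u ∈ X₂ → u ∈ X₃ → Adj v u → ⊥) → Goal
    rightOf Pa v Pb eq v∈X v∈ w∈ wA w≢v block with ∈-∃++ v∈X
    ... | la , lb , xe = rightOf′ (sector la lb (X₃ ++ Pa) [] [] (Pb ++ X₁)
             (subst (λ z → Pl A (z ++ (X₃ ++ Pa) ++ v ∷ Pb ++ X₁)) xe
               (cast ((⟨ X₂ ⟩ ⊕ ⟨ X₃ ⟩ ⊕ ⟨ Pa ⟩ ⊕ ⟨ [ v ] ⟩ ⊕ ⟨ Pb ⟩) ⊕ ⟨ X₁ ⟩) (⟨ X₂ ⟩ ⊕ (⟨ X₃ ⟩ ⊕ ⟨ Pa ⟩) ⊕ ⟨ [ v ] ⟩ ⊕ ⟨ Pb ⟩ ⊕ ⟨ X₁ ⟩) refl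
                 (Pl-rot X₁ (subst (λ z → Pl A (X₁ ++ X₂ ++ X₃ ++ z)) eq (pl ok)))))
             v∈ (λ a _ → a) (inj₂ λ ())) eq xe v∈ w∈ wA w≢v block

    leftOf′ : ∀ {Pa v Pb w ra rb} → Sector A A [] v [] (Pb ++ X₁) ra [ v ] (ra ++ v ∷ rb) (X₃ ++ Pa) →
      P ≡ Pa ++ v ∷ Pb → X₂ ≡ ra ++ v ∷ rb → v ∈ A → w ∈ Pb → w ∈ A → w ≢ v →
      (∀ {u} → u ∈ I → u ∈ Pb → u ∈ X₁ → u ∈ X₂ → Adj v u → ⊥) → Goal
    leftOf′ {Pa} {v} {Pb} {w} {ra} {rb} sc eq xe v∈ w∈ wA w≢v block =
      reduce (nbrsIn [ v ]) (inB (∈-++⁺ˡ (∈-++⁺ˡ w∈)) wA w≢v) v∈ x∉ B⊆ (nbrs₁ sc)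
           (λ i → le (λ { refl → x∉ i }) (notQ i) (inL₂ i) (exposed i))
           record { pl = cast ((⟨ X₁ ⟩ ⊕ ⟨ ra ⟩ ⊕ ⟨ Nₓ ⟩) ⊕ ⟨ Pb ⟩) (⟨ X₁ ⟩ ⊕ ⟨ ra ⟩ ⊕ ⟨ Nₓ ⟩ ⊕ ⟨ Pb ⟩) refl
                           (Pl-rot Pb (cast (((⟨ Pb ⟩ ⊕ ⟨ X₁ ⟩) ⊕ ⟨ ra ⟩) ⊕ ⟨ Nₓ ⟩) (⟨ Pb ⟩ ⊕ ⟨ X₁ ⟩ ⊕ ⟨ ra ⟩ ⊕ ⟨ Nₓ ⟩) refl plB))
                  ; I⊆P = λ i → proj₂ (I∩⁻ i) ; indep = λ i j → indep ok (proj₁ (I∩⁻ i)) (proj₁ (I∩⁻ j))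
                  ; no3 = λ a i p q r → block (proj₁ (I∩⁻ i)) (proj₂ (I∩⁻ i)) p (subst (_ ∈_) (sym xe) (∈-++⁺ˡ q)) (nbrₓ r) }
      where
      open Sector sc
      le : ∀ {u} → u ≢ v → u ∉ X₃ ++ Pa → (u ∈ ra ++ v ∷ rb → u ∈ ra) → (Adj v u → u ∈ Nₓ) →
           cost X₁ X₂ X₃ P I u + length (nbrsIn [ v ] u) ≤ cost X₁ ra Nₓ Pb (I∩ Pb) u
      le {u} ne nq il ex rewrite ι-no {u} {X₃} (nq ∘ ∈-++⁺ˡ) | nbrsIn-∷ v [] u | +-identityʳ ⟦ adj? v u ⟧ =
        ≤-trans (≤-reflexive (s (ι u X₁) (ι u X₂) (ι u P) (ι u I) ⟦ adj? v u ⟧))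
          (+-mono-≤ (+-mono-≤ (+-mono-≤ (+-monoʳ-≤ (ι u X₁) (≤-trans (≤-reflexive (cong (ι u) xe)) (ι-mono (ra ++ v ∷ rb) ra il))) (⟦⟧-mono (adj? v u) (u ∈? Nₓ) ex)) (ι-mono P Pb inPb)) (ι-mono I (I∩ Pb) (I∩-in inPb)))
        where
        inPb : u ∈ P → u ∈ Pb
        inPb k = [ (λ k → ⊥-elim (nq (∈-++⁺ʳ X₃ k))) , id ]′ (mid Pa eq k ne)
        s : ∀ x y p i a → x + y + 0 + p + i + a ≡ x + y + a + p + i
        s = solve-∀

    leftOf : ∀ Pa v Pb {w} → P ≡ Pa ++ v ∷ Pb → v ∈ X₂ → v ∈ A → w ∈ Pb → w ∈ A → w ≢ v →
      (∀ {u} → u ∈ I → u ∈ Pb → u ∈ X₁ → u ∈ X₂ → Adj v u → ⊥) → Goal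
    leftOf Pa v Pb eq v∈X v∈ w∈ wA w≢v block with ∈-∃++ v∈X
    ... | ra , rb , xe = leftOf′ (sector [] [] (Pb ++ X₁) ra rb (X₃ ++ Pa)
             (subst (λ z → Pl A (v ∷ (Pb ++ X₁) ++ z ++ X₃ ++ Pa)) xe
               (cast (⟨ [ v ] ⟩ ⊕ ⟨ Pb ⟩ ⊕ ⟨ X₁ ⟩ ⊕ ⟨ X₂ ⟩ ⊕ ⟨ X₃ ⟩ ⊕ ⟨ Pa ⟩) (⟨ [ v ] ⟩ ⊕ (⟨ Pb ⟩ ⊕ ⟨ X₁ ⟩) ⊕ ⟨ X₂ ⟩ ⊕ ⟨ X₃ ⟩ ⊕ ⟨ Pa ⟩) refl
                 (from Pa v Pb eq)))
             v∈ (λ a _ → a) (inj₂ λ ())) eq xe v∈ w∈ wA w≢v block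

    module Reduced (P⊆A : ∀ {u} → u ∈ P → u ∈ A) (unique : Unique P) where


      atP : ∀ {v} Pa {Pb} → P ≡ Pa ++ v ∷ Pb → v ∈ A
      atP Pa refl = P⊆A (∈-insert Pa)

      beforeP : ∀ {u v} Pa {Pb} → P ≡ Pa ++ v ∷ Pb → u ∈ Pa → u ∈ A × u ≢ v
      beforeP Pa refl i = P⊆A (∈-++⁺ˡ i) , uniqueˡ Pa unique i

      afterP : ∀ {u v} Pa {Pb} → P ≡ Pa ++ v ∷ Pb → u ∈ Pb → u ∈ A × u ≢ v
      afterP Pa refl i = P⊆A (∈-++⁺ʳ Pa (there i)) , uniqueʳ Pa unique i

      -- If the side containing `w` is blocked by a vertex `u` of `I`, then `u` also lies in `X₂`,
      -- and the chord at `u` cuts off the opposite side, which contains `v`. A vertex of `I`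
      -- blocking that side would be adjacent to `u`, against independence.
      chordMiddle : ∀ {v w} → v ∈ P → w ∈ P → w ≢ v → v ∈ X₂ → Goal
      chordMiddle {v} {w} v∈P w∈P w≢v v∈X with ∈-∃++ v∈P
      ... | Pa , Pb , eq = [ right , left ]′ (mid Pa eq w∈P w≢v)
        where
        right : w ∈ Pa → Goal
        right w∈ with any? (λ u → (u ∈? I) ×-dec (u ∈? X₂) ×-dec (u ∈? X₃) ×-dec adj? v u) Pa
        ... | no none = rightOf Pa v Pb eq v∈X (atP Pa eq) w∈ (P⊆A w∈P) w≢v (λ i a x y vu → none (lose a (i , x , y , vu)))
        ... | yes some with find some
        ...   | u , u∈ , ui , ux , _ , vu with ∈-∃++ u∈
        ...     | Pa₁ , Pa₂ , refl = leftOf Pa₁ u (Pa₂ ++ v ∷ Pb) eq' ux (atP Pa₁ eq') (∈-insert Pa₂) (atP Pa eq) (λ { refl → Adj-irrefl vu })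
                  (λ i _ _ _ uu → indep ok ui i uu)
          where
          eq' = trans eq (++-assoc Pa₁ (u ∷ Pa₂) (v ∷ Pb))
        left : w ∈ Pb → Goal
        left w∈ with any? (λ u → (u ∈? I) ×-dec (u ∈? X₁) ×-dec (u ∈? X₂) ×-dec adj? v u) Pb
        ... | no none = leftOf Pa v Pb eq v∈X (atP Pa eq) w∈ (P⊆A w∈P) w≢v (λ i a x y vu → none (lose a (i , x , y , vu)))
        ... | yes some with find some
        ...   | u , u∈ , ui , _ , ux , vu with ∈-∃++ u∈
        ...     | Pb₁ , Pb₂ , refl = rightOf (Pa ++ v ∷ Pb₁) u Pb₂ eq' ux (atP (Pa ++ v ∷ Pb₁) eq') (∈-insert Pa) (atP Pa eq) (λ { refl → Adj-irrefl vu })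
                  (λ i _ _ _ uu → indep ok ui i uu)
          where
          eq' = trans eq (sym (++-assoc Pa (v ∷ Pb₁) (u ∷ Pb₂)))

      expose : ∀ Pa v Pb → P ≡ Pa ++ v ∷ Pb → Single A v (Pb ++ X₁ ++ X₂ ++ X₃ ++ Pa)
      expose Pa v Pb eq = deleteV (atP Pa eq) (from Pa v Pb eq)

      D₁ : ∀ {u v} → u ∈ A → u ∉ [ v ] → u ∈ A ∖ v
      D₁ a ne = ∖⁺ a (λ { refl → ne (here refl) })

      D₂ : ∀ {u v w} → u ∈ A → u ∉ v ∷ w ∷ [] → u ∈ A ∖ v ∖ w
      D₂ a ne = ∖⁺ (∖⁺ a (λ { refl → ne (here refl) })) (λ { refl → ne (there (here refl)) })

      module _ {u} Pa Pb (nq : u ∉ Pb ++ X₁ ++ X₂ ++ X₃ ++ Pa) where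
        X₁∉ : u ∉ X₁
        X₁∉ i = nq (∈-++⁺ʳ Pb (∈-++⁺ˡ i))
        X₂∉ : u ∉ X₂
        X₂∉ i = nq (∈-++⁺ʳ Pb (∈-++⁺ʳ X₁ (∈-++⁺ˡ i)))
        X₃∉ : u ∉ X₃
        X₃∉ i = nq (∈-++⁺ʳ Pb (∈-++⁺ʳ X₁ (∈-++⁺ʳ X₂ (∈-++⁺ˡ i))))
        Pa∉ : u ∉ Pa
        Pa∉ i = nq (∈-++⁺ʳ Pb (∈-++⁺ʳ X₁ (∈-++⁺ʳ X₂ (∈-++⁺ʳ X₃ i))))
        Pb∉ : u ∉ Pb
        Pb∉ i = nq (∈-++⁺ˡ i)

      -- Deleting `vi` gives `vj` a second corner, among the neighbours of `vi`; the two corners of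
      -- `vj` enclose the part behind the chord.
      chordP : ∀ Pa vi M vj Pb {b} → P ≡ Pa ++ vi ∷ M ++ vj ∷ Pb → Adj vi vj → b ∈ M → Goal
      chordP Pa vi M vj Pb {b} eq ij b∈ = go (expose Pa vi (M ++ vj ∷ Pb) eq)
        where
        Q = Pb ++ X₁ ++ X₂ ++ X₃ ++ Pa
        eq' : P ≡ (Pa ++ vi ∷ M) ++ vj ∷ Pb
        eq' = trans eq (sym (++-assoc Pa (vi ∷ M) (vj ∷ Pb)))
        vj∈ : vj ∈ A ∖ vi
        vj∈ = ∖⁺ (atP (Pa ++ vi ∷ M) eq') (λ { refl → Adj-irrefl ij })
        b∈° : b ∈ A ∖ vi
        b∈° = let a , ne = afterP Pa eq (∈-++⁺ˡ b∈) in ∖⁺ a ne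
        b≢ : b ≢ vj
        b≢ = proj₂ (beforeP (Pa ++ vi ∷ M) eq' (∈-++⁺ʳ Pa (there b∈)))
        go : Single A vi ((M ++ vj ∷ Pb) ++ X₁ ++ X₂ ++ X₃ ++ Pa) → Goal
        go record { Y = Y ; pl = plY ; exposed = ex ; nbr = nb } with ∈-∃++ (ex (∖⊆ vj∈) ij)
        ... | la , lb , refl = finish (sector la lb M [] [] Q
                (cast (⟨ la ++ vj ∷ lb ⟩ ⊕ (⟨ M ⟩ ⊕ ⟨ [ vj ] ⟩ ⊕ ⟨ Pb ⟩) ⊕ ⟨ X₁ ++ X₂ ++ X₃ ++ Pa ⟩) (⟨ la ++ vj ∷ lb ⟩ ⊕ ⟨ M ⟩ ⊕ ⟨ [ vj ] ⟩ ⊕ ⟨ Pb ⟩ ⊕ ⟨ X₁ ++ X₂ ++ X₃ ++ Pa ⟩) refl plY)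
                vj∈ D₁ (D-dec [ vi ]))
          where
          le : ∀ {u} → u ∈ A ∖ vi → u ≢ vj → u ∉ Q → cost X₁ X₂ X₃ P I u + length (nbrsIn [ vi ] u) ≤ ι u (la ++ vj ∷ lb) + ι u [ vj ] + ι u M + ι u (I∩ M)
          le {u} a ne nq rewrite ι-no (X₁∉ Pa Pb nq) | ι-no (X₂∉ Pa Pb nq) | ι-no (X₃∉ Pa Pb nq) | ι-no {u} {[ vj ]} (ne ∘ ∈-one) | nbrsIn-∷ vi [] u =
            ≤-trans (≤-reflexive (s (ι u P) (ι u I) ⟦ adj? vi u ⟧))
              (+-mono-≤ (+-mono-≤ (+-mono-≤ (⟦⟧-mono (adj? vi u) (u ∈? (la ++ vj ∷ lb)) (ex (∖⊆ a))) (z≤n {0})) (ι-mono P M inM)) (ι-mono I (I∩ M) (I∩-in inM)))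
            where
            inM : u ∈ P → u ∈ M
            inM i with mid Pa eq i (proj₂ (∖⁻ a))
            ... | inj₁ k = ⊥-elim (Pa∉ Pa Pb nq k)
            ... | inj₂ k with ∈-++⁻ M k
            ...   | inj₁ m = m
            ...   | inj₂ (here e) = ⊥-elim (ne e)
            ...   | inj₂ (there m) = ⊥-elim (Pb∉ Pa Pb nq m)
            s : ∀ p i a → p + i + (a + 0) ≡ a + 0 + p + i
            s = solve-∀
          finish : Sector A (A ∖ vi) [ vi ] vj lb M [] (la ++ vj ∷ lb) [ vj ] Q → Goal
          finish sc = sectorReduce sc ∖⊆ vj∈ (Sector.inB sc (∈-++⁺ʳ lb (∈-++⁺ˡ b∈)) b∈° b≢) le
            (λ _ _ _ _ q xu → Adj-irrefl (subst (Adj vj) (∈-one q) xu)) (λ i → ∈-++⁺ʳ la (there i)) (λ ())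

      -- Once `vi` is deleted, `x` has a corner among the neighbours of `vi` and another in `X₁`,
      -- and `Pb` is the boundary between them.
      twoPathFirst : ∀ Pa vi Pb {x b} → P ≡ Pa ++ vi ∷ Pb → x ∈ X₁ → x ∈ A → x ∉ P → Adj vi x → b ∈ Pb →
        (∀ {u} → u ∈ I → u ∈ Pb → u ∈ X₁ → Adj vi u → ⊥) → Goal
      twoPathFirst Pa vi Pb {x} {b} eq xX xA xP ix b∈ block = go (expose Pa vi Pb eq)
        where
        Q = X₂ ++ X₃ ++ Pa
        x≢vi : x ≢ vi
        x≢vi refl = Adj-irrefl ix
        x∈ : x ∈ A ∖ vi
        x∈ = ∖⁺ xA x≢vi
        b∈° : b ∈ A ∖ vi
        b∈° = let a , ne = afterP Pa eq b∈ in ∖⁺ a ne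
        b≢ : b ≢ x
        b≢ refl = xP (subst (_ ∈_) (sym eq) (∈-++⁺ʳ Pa (there b∈)))
        go : Single A vi (Pb ++ X₁ ++ X₂ ++ X₃ ++ Pa) → Goal
        go record { Y = Y ; pl = plY ; exposed = ex ; nbr = nb } with ∈-∃++ (ex xA ix) | ∈-∃++ xX
        ... | la , lb , refl | ra , rb , xe = finish (sector la lb Pb ra rb Q
                (subst (λ z → Pl (A ∖ vi) ((la ++ x ∷ lb) ++ Pb ++ z ++ Q)) xe plY) x∈ D₁ (D-dec [ vi ]))
          where
          le : ∀ {u} → u ∈ A ∖ vi → u ≢ x → u ∉ Q → cost X₁ X₂ X₃ P I u + length (nbrsIn [ vi ] u) ≤ ι u (la ++ x ∷ lb) + ι u (ra ++ x ∷ rb) + ι u Pb + ι u (I∩ Pb)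
          le {u} a ne nq rewrite ι-no {u} {X₂} (nq ∘ ∈-++⁺ˡ) | ι-no {u} {X₃} (nq ∘ ∈-++⁺ʳ X₂ ∘ ∈-++⁺ˡ) | nbrsIn-∷ vi [] u =
            ≤-trans (≤-reflexive (s (ι u X₁) (ι u P) (ι u I) ⟦ adj? vi u ⟧))
              (+-mono-≤ (+-mono-≤ (+-mono-≤ (⟦⟧-mono (adj? vi u) (u ∈? (la ++ x ∷ lb)) (ex (∖⊆ a))) (≤-reflexive (cong (ι u) xe))) (ι-mono P Pb inM)) (ι-mono I (I∩ Pb) (I∩-in inM)))
            where
            inM : u ∈ P → u ∈ Pb
            inM i = [ (λ k → ⊥-elim (nq (∈-++⁺ʳ X₂ (∈-++⁺ʳ X₃ k)))) , id ]′ (mid Pa eq i (proj₂ (∖⁻ a)))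
            s : ∀ x p i a → x + 0 + 0 + p + i + (a + 0) ≡ a + x + p + i
            s = solve-∀
          finish : Sector A (A ∖ vi) [ vi ] x lb Pb ra (la ++ x ∷ lb) (ra ++ x ∷ rb) Q → Goal
          finish sc = sectorReduce sc ∖⊆ x∈ (Sector.inB sc (∈-++⁺ʳ lb (∈-++⁺ˡ b∈)) b∈° b≢) le
            (λ a i m l r xu → block i m (subst (_ ∈_) (sym xe) r) (nb l)) (λ i → ∈-++⁺ʳ la (there i)) ∈-++⁺ˡ

      -- With both `vi` and `vj` deleted, a common neighbour has a corner in each of `L₁` and `L₂`,
      -- and these enclose `M`.
      record Chord₂ (Pa : List V) (vi : V) (M : List V) (vj : V) (Pb : List V) : Set where
        field
          eqP : P ≡ Pa ++ vi ∷ M ++ vj ∷ Pb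
          L₁ L₂ : List V
          plC : Pl (A ∖ vi ∖ vj) (L₁ ++ M ++ L₂ ++ Pb ++ X₁ ++ X₂ ++ X₃ ++ Pa)
          ex₁ : ∀ {u} → u ∈ A → Adj vi u → u ∈ L₁
          ex₂ : ∀ {u} → u ∈ A ∖ vi → Adj vj u → u ∈ L₂
          nb₁ : ∀ {u} → u ∈ L₁ → Adj vi u
          nb₂ : ∀ {u} → u ∈ L₂ → Adj vj u

      chord₂ : ∀ Pa vi M vj Pb → P ≡ Pa ++ vi ∷ M ++ vj ∷ Pb → Chord₂ Pa vi M vj Pb
      chord₂ Pa vi M vj Pb eq = go (expose Pa vi (M ++ vj ∷ Pb) eq)
        where
        vj≢vi : vj ≢ vi
        vj≢vi = proj₂ (afterP Pa eq (∈-insert M))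
        Q = Pb ++ X₁ ++ X₂ ++ X₃ ++ Pa
        go : Single A vi ((M ++ vj ∷ Pb) ++ X₁ ++ X₂ ++ X₃ ++ Pa) → Chord₂ Pa vi M vj Pb
        go record { Y = Y ; pl = plY ; exposed = ex ; nbr = nb } = go' (deleteV (∖⁺ (P⊆A (subst (vj ∈_) (sym eq) (∈-++⁺ʳ Pa (there (∈-insert M))))) vj≢vi)
             (cast ((⟨ [ vj ] ⟩ ⊕ ⟨ Q ⟩) ⊕ (⟨ Y ⟩ ⊕ ⟨ M ⟩)) (⟨ [ vj ] ⟩ ⊕ ⟨ Q ⟩ ⊕ ⟨ Y ⟩ ⊕ ⟨ M ⟩) refl (Pl-rot (Y ++ M)
               (cast (⟨ Y ⟩ ⊕ (⟨ M ⟩ ⊕ ⟨ [ vj ] ⟩ ⊕ ⟨ Pb ⟩) ⊕ ⟨ X₁ ++ X₂ ++ X₃ ++ Pa ⟩) ((⟨ Y ⟩ ⊕ ⟨ M ⟩) ⊕ ⟨ [ vj ] ⟩ ⊕ (⟨ Pb ⟩ ⊕ ⟨ X₁ ++ X₂ ++ X₃ ++ Pa ⟩)) refl plY))))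
          where
          go' : Single (A ∖ vi) vj (Q ++ Y ++ M) → Chord₂ Pa vi M vj Pb
          go' record { Y = Z ; pl = plZ ; exposed = ex' ; nbr = nb' } = record
            { eqP = eq ; L₁ = Y ; L₂ = Z
            ; plC = cast ((⟨ Y ⟩ ⊕ ⟨ M ⟩) ⊕ (⟨ Z ⟩ ⊕ ⟨ Q ⟩)) (⟨ Y ⟩ ⊕ ⟨ M ⟩ ⊕ ⟨ Z ⟩ ⊕ ⟨ Q ⟩) refl (Pl-rot (Z ++ Q) (cast (⟨ Z ⟩ ⊕ ⟨ Q ⟩ ⊕ ⟨ Y ⟩ ⊕ ⟨ M ⟩) ((⟨ Z ⟩ ⊕ ⟨ Q ⟩) ⊕ ⟨ Y ⟩ ⊕ ⟨ M ⟩) refl plZ))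
            ; ex₁ = ex ; ex₂ = ex' ; nb₁ = nb ; nb₂ = nb' }

      module _ {Pa vi M vj Pb} (c : Chord₂ Pa vi M vj Pb) where
        open Chord₂ c

        A° Q° : List V
        A° = A ∖ vi ∖ vj
        Q° = Pb ++ X₁ ++ X₂ ++ X₃ ++ Pa

        inner : ∀ {u} → u ∈ A → u ≢ vi → u ≢ vj → u ∈ A°
        inner a n₁ n₂ = ∖⁺ (∖⁺ a n₁) n₂

        SectorAt : V → List V → List V → List V → List V → Set
        SectorAt x la lb ra rb = Sector A A° (vi ∷ vj ∷ []) x lb M ra (la ++ x ∷ lb) (ra ++ x ∷ rb) Q°

        sectorAt : ∀ {x} la lb ra rb → L₁ ≡ la ++ x ∷ lb → L₂ ≡ ra ++ x ∷ rb → x ∈ A° → SectorAt x la lb ra rb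
        sectorAt {x} la lb ra rb e₁ e₂ x∈ = sector la lb M ra rb Q°
          (subst (λ z → Pl A° ((la ++ x ∷ lb) ++ M ++ z ++ Q°)) e₂ (subst (λ z → Pl A° (z ++ M ++ L₂ ++ Q°)) e₁ plC)) x∈ D₂ (D-dec (vi ∷ vj ∷ []))

        inM : ∀ {u} → u ∈ A° → u ∉ Q° → u ∈ P → u ∈ M
        inM a nq i with mid Pa eqP i (proj₂ (∖⁻ (∖⊆ a)))
        ... | inj₁ k = ⊥-elim (Pa∉ Pa Pb nq k)
        ... | inj₂ k with ∈-++⁻ M k
        ...   | inj₁ m = m
        ...   | inj₂ (here e) = ⊥-elim (proj₂ (∖⁻ a) e)
        ...   | inj₂ (there m) = ⊥-elim (Pb∉ Pa Pb nq m)

        nbrs₂ : ∀ u → length (nbrsIn (vi ∷ vj ∷ []) u) ≡ ⟦ adj? vi u ⟧ + (⟦ adj? vj u ⟧ + 0)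
        nbrs₂ u = trans (nbrsIn-∷ vi [ vj ] u) (cong (λ z → ⟦ adj? vi u ⟧ + z) (nbrsIn-∷ vj [] u))

        le₂ : ∀ {u} → u ∈ A° → u ∉ Q° → cost X₁ X₂ X₃ P I u + length (nbrsIn (vi ∷ vj ∷ []) u) ≤ ι u L₁ + ι u L₂ + ι u M + ι u (I∩ M)
        le₂ {u} a nq rewrite ι-no (X₁∉ Pa Pb nq) | ι-no (X₂∉ Pa Pb nq) | ι-no (X₃∉ Pa Pb nq) | nbrs₂ u =
          ≤-trans (≤-reflexive (s (ι u P) (ι u I) ⟦ adj? vi u ⟧ ⟦ adj? vj u ⟧))
            (+-mono-≤ (+-mono-≤ (+-mono-≤ (⟦⟧-mono (adj? vi u) (u ∈? L₁) (ex₁ (∖⊆ (∖⊆ a)))) (⟦⟧-mono (adj? vj u) (u ∈? L₂) (ex₂ (∖⊆ a))))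
                       (ι-mono P M (inM a nq))) (ι-mono I (I∩ M) (I∩-in (inM a nq))))
          where
          s : ∀ p i a b → p + i + (a + (b + 0)) ≡ a + b + p + i
          s = solve-∀

        chordReduce : ∀ {x la lb ra rb b} → SectorAt x la lb ra rb → L₁ ≡ la ++ x ∷ lb → L₂ ≡ ra ++ x ∷ rb → x ∈ A° →
          b ∈ lb ++ M ++ ra → b ∈ A° → b ≢ x →
          (∀ {u} → u ∈ I → u ∈ M → Adj vi u → Adj vj u → Adj x u → ⊥) → Goal
        chordReduce {x} {la} {lb} {ra} {rb} sc e₁ e₂ x∈ b∈ b∈° b≢ block = sectorReduce sc (∖⊆ ∘ ∖⊆) x∈ (Sector.inB sc b∈ b∈° b≢)
          (λ {u} a _ nq → subst₂ (λ y z → cost X₁ X₂ X₃ P I u + length (nbrsIn (vi ∷ vj ∷ []) u) ≤ ι u y + ι u z + ι u M + ι u (I∩ M)) e₁ e₂ (le₂ a nq))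
          (λ a i m l r xu → block i m (nb₁ (subst (_ ∈_) (sym e₁) l)) (nb₂ (subst (_ ∈_) (sym e₂) r)) xu)
          (λ i → ∈-++⁺ʳ la (there i)) ∈-++⁺ˡ

      twoPathP : ∀ Pa vi M vj Pb {x b} → P ≡ Pa ++ vi ∷ M ++ vj ∷ Pb → x ∈ A → x ∉ P → Adj vi x → Adj vj x → b ∈ M →
        (∀ {u} → u ∈ I → u ∈ M → Adj vi u → Adj vj u → Adj x u → ⊥) → Goal
      twoPathP Pa vi M vj Pb {x} {b} eq xA xP ix jx b∈ block = go (chord₂ Pa vi M vj Pb eq)
        where
        eq' : P ≡ (Pa ++ vi ∷ M) ++ vj ∷ Pb
        eq' = trans eq (sym (++-assoc Pa (vi ∷ M) (vj ∷ Pb)))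
        go : Chord₂ Pa vi M vj Pb → Goal
        go c with ∈-∃++ (Chord₂.ex₁ c xA ix) | ∈-∃++ (Chord₂.ex₂ c (∖⁺ xA (λ { refl → Adj-irrefl ix })) jx)
        ... | la , lb , e₁ | ra , rb , e₂ = chordReduce c (sectorAt c la lb ra rb e₁ e₂ x∈) e₁ e₂ x∈ (∈-++⁺ʳ lb (∈-++⁺ˡ b∈))
              (inner c (proj₁ ba) (proj₂ ba) (proj₂ bb)) (λ { refl → xP (subst (_ ∈_) (sym eq) (∈-++⁺ʳ Pa (there (∈-++⁺ˡ b∈)))) }) block
          where
          x∈ : x ∈ A ∖ vi ∖ vj
          x∈ = inner c xA (λ { refl → Adj-irrefl ix }) (λ { refl → Adj-irrefl jx })
          ba = afterP Pa eq (∈-++⁺ˡ {ys = vj ∷ Pb} b∈)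
          bb = beforeP (Pa ++ vi ∷ M) eq' (∈-++⁺ʳ Pa (there b∈))

      -- Two common neighbours of consecutive vertices: one lies inside the
      -- triangle formed by the other one.
      oneCommonNbr : ∀ Pa vi vj Pb {x y} → P ≡ Pa ++ vi ∷ vj ∷ Pb → x ∈ A → y ∈ A → x ≢ y →
        Adj vi x → Adj vj x → Adj vi y → Adj vj y → Goal
      oneCommonNbr Pa vi vj Pb {x} {y} eq xA yA x≢y ix jx iy jy = go (chord₂ Pa vi [] vj Pb eq)
        where
        go : Chord₂ Pa vi [] vj Pb → Goal
        -- The order of `x` and `y` around `vi` decides which of them lies inside the other's
        -- triangle.
        go c with ∈-order (ex₁ xA ix) (ex₁ yA iy) x≢y | ∈-∃++ (ex₂ (∖⁺ xA (λ { refl → Adj-irrefl ix })) jx) | ∈-∃++ (ex₂ (∖⁺ yA (λ { refl → Adj-irrefl iy })) jy)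
          where open Chord₂ c
        ... | inj₁ (la , lb , e , y∈) | ra , rb , e' | _ = chordReduce c (sectorAt c la lb ra rb e e' x∈) e e' x∈ (∈-++⁺ˡ y∈) y∈° (x≢y ∘ sym) (λ _ ())
          where
          x∈ = inner c xA (λ { refl → Adj-irrefl ix }) (λ { refl → Adj-irrefl jx })
          y∈° = inner c yA (λ { refl → Adj-irrefl iy }) (λ { refl → Adj-irrefl jy })
        ... | inj₂ (la , lb , e , x∈) | _ | ra , rb , e' = chordReduce c (sectorAt c la lb ra rb e e' y∈) e e' y∈ (∈-++⁺ˡ x∈) x∈° x≢y (λ _ ())
          where
          y∈ = inner c yA (λ { refl → Adj-irrefl iy }) (λ { refl → Adj-irrefl jy })
          x∈° = inner c xA (λ { refl → Adj-irrefl ix }) (λ { refl → Adj-irrefl jx })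

      AllX : V → Set
      AllX u = u ∈ X₁ × u ∈ X₂ × u ∈ X₃

      no3-++ : ∀ {B I' J} → (∀ {u} → u ∈ B → u ∈ A) → (∀ {u} → u ∈ I' → u ∈ I) → (∀ {u} → u ∈ J → ¬ AllX u) →
        ∀ {u} → u ∈ B → u ∈ I' ++ J → u ∈ X₁ → u ∈ X₂ → u ∈ X₃ → ⊥
      no3-++ {I' = I'} b f g a i x y z = [ (λ k → no3 ok (b a) (f k) x y z) , (λ k → g k (x , y , z)) ]′ (∈-++⁻ I' i)

      -- Remove v ∈ P; its neighbours J on P join I.
      removeP : ∀ Pa v Pb (J : List V) → P ≡ Pa ++ v ∷ Pb → (∀ {u} → u ∈ P → Adj v u → u ∈ J) →
        (∀ {u} → u ∈ J → u ∈ P × u ≢ v × u ∉ I) → Independent ((I ∖ v) ++ J) → (∀ {u} → u ∈ J → ¬ AllX u) → Goal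
      removeP Pa v Pb J eq nbJ J⊆ ind noJ = go (expose Pa v Pb eq)
        where
        go : Single A v (Pb ++ X₁ ++ X₂ ++ X₃ ++ Pa) → Goal
        go record { Y = Y ; pl = plY ; exposed = ex } =
          remove v (atP Pa eq) (λ {u} a ne → cost-≤ {u} {X₁} {X₂} {X₃} {P} {I} (exchange {P = P} {I} {P'} {I'} (adj? v u) (P→ ne) (λ i → ∈-++⁺ˡ (∖⁺ i ne)) (I⊆P ok)
                    (λ vu p → let j = nbJ p vu in ∈-++⁺ʳ (I ∖ v) j , proj₂ (proj₂ (J⊆ j))) (λ vu _ → Y→ (ex a vu))) , cost≤4 ok' (∖⁺ a ne))
            (IH (∖-shorter (atP Pa eq)) ok')
          where
          P' I' : List V
          P' = Pa ++ Y ++ Pb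
          I' = (I ∖ v) ++ J
          P→ : ∀ {u} → u ≢ v → u ∈ P → u ∈ P'
          P→ ne p = [ ∈-++⁺ˡ , (λ k → ∈-++⁺ʳ Pa (∈-++⁺ʳ Y k)) ]′ (mid Pa eq p ne)
          Y→ : ∀ {u} → u ∈ Y → u ∈ P'
          Y→ y = ∈-++⁺ʳ Pa (∈-++⁺ˡ y)
          ok' : Ok (A ∖ v) X₁ X₂ X₃ P' I'
          ok' = record
            { pl = cast ((⟨ X₁ ⟩ ⊕ ⟨ X₂ ⟩ ⊕ ⟨ X₃ ⟩ ⊕ ⟨ Pa ⟩) ⊕ ⟨ Y ⟩ ⊕ ⟨ Pb ⟩) (⟨ X₁ ⟩ ⊕ ⟨ X₂ ⟩ ⊕ ⟨ X₃ ⟩ ⊕ (⟨ Pa ⟩ ⊕ ⟨ Y ⟩ ⊕ ⟨ Pb ⟩)) refl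
                     (Pl-rot (Y ++ Pb) (cast (⟨ Y ⟩ ⊕ ⟨ Pb ⟩ ⊕ ⟨ X₁ ⟩ ⊕ ⟨ X₂ ⟩ ⊕ ⟨ X₃ ⟩ ⊕ ⟨ Pa ⟩) ((⟨ Y ⟩ ⊕ ⟨ Pb ⟩) ⊕ ⟨ X₁ ⟩ ⊕ ⟨ X₂ ⟩ ⊕ ⟨ X₃ ⟩ ⊕ ⟨ Pa ⟩) refl plY))
            ; I⊆P = λ i → [ (λ k → P→ (proj₂ (∖⁻ k)) (I⊆P ok (∖⊆ k))) , (λ k → P→ (proj₁ (proj₂ (J⊆ k))) (proj₁ (J⊆ k))) ]′ (∈-++⁻ (I ∖ v) i)
            ; indep = ind
            ; no3 = no3-++ ∖⊆ ∖⊆ noJ }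

      -- The last vertex of S joins the outer region.
      dropX₃ : (∀ {P' I'} → Ok A X₁ X₂ [] P' I' → W A (cost X₁ X₂ [] P' I')) → ∀ J →
        (∀ {u} → u ∈ A → u ∈ P → u ∈ X₃ → u ∈ J) → (∀ {u} → u ∈ J → u ∈ P × u ∉ I) → Independent (I ++ J) → Goal
      dropX₃ K J XP J⊆ ind = mono id id (λ {u} a → ≤-trans (≤-reflexive (s (ι u X₁) (ι u X₂) (ι u X₃) (ι u P) (ι u I)))
          (cost-≤ {u} {X₁} {X₂} {[]} {P} {I} (exchange {P = P} {I} {X₃ ++ P} {I ++ J} (u ∈? X₃) (∈-++⁺ʳ X₃) ∈-++⁺ˡ (I⊆P ok)
            (λ x p → let j = XP a p x in ∈-++⁺ʳ I j , proj₂ (J⊆ j)) (λ x _ → ∈-++⁺ˡ x)))) (K ok')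
        where
        s : ∀ x y z p i → x + y + z + p + i ≡ x + y + 0 + p + i + z
        s = solve-∀
        ok' : Ok A X₁ X₂ [] (X₃ ++ P) (I ++ J)
        ok' = record { pl = pl ok ; I⊆P = λ i → ∈-++⁺ʳ X₃ ([ I⊆P ok , (λ k → proj₁ (J⊆ k)) ]′ (∈-++⁻ I i)) ; indep = ind ; no3 = λ _ _ _ _ () }

      -- Remove a saving w, then b; their common neighbours Xl outside P join I.
      removeTwo : ∀ Pa b a w Pb (J Xl : List V) → P ≡ Pa ++ b ∷ a ∷ w ∷ Pb → Adj a w → ¬ Adj b w → a ∉ I →
        cost X₁ X₂ X₃ P I a < cost X₁ X₂ X₃ P I w → cost X₁ X₂ X₃ P I b ≤ 3 →
        (∀ {u} → u ∈ P → Adj a u → u ≡ b ⊎ u ≡ w) → (∀ {u} → u ∈ P → Adj b u → u ≡ a ⊎ u ∈ J) →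
        (∀ {u} → u ∈ J → u ∈ P × u ≢ a × u ≢ b × u ∉ I) →
        (∀ {u} → u ∈ A → u ∉ P → Adj a u → Adj b u → u ∈ Xl) → (∀ {u} → u ∈ Xl → u ∈ A × Adj b u) →
        Independent ((I ∖ b) ++ (J ++ Xl)) → (∀ {u} → u ∈ J ++ Xl → ¬ AllX u) → Goal
      removeTwo Pa b a w Pb J Xl eq aw ¬bw a∉I lt b≤3 ha hb J⊆ common Xl⊆ ind noJ = go (chord₂ Pa b [] a (w ∷ Pb) eq)
        where
        c : V → ℕ
        c = cost X₁ X₂ X₃ P I
        eqa : P ≡ (Pa ++ [ b ]) ++ a ∷ w ∷ Pb
        eqa = trans eq (sym (++-assoc Pa [ b ] (a ∷ w ∷ Pb)))
        eqw : P ≡ (Pa ++ b ∷ a ∷ []) ++ w ∷ Pb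
        eqw = trans eq (sym (++-assoc Pa (b ∷ a ∷ []) (w ∷ Pb)))
        a∈ : a ∈ A
        a∈ = atP (Pa ++ [ b ]) eqa
        b∈ : b ∈ A
        b∈ = atP Pa eq
        w∈ : w ∈ A
        w∈ = atP (Pa ++ b ∷ a ∷ []) eqw
        w∈P : w ∈ P
        w∈P = subst (w ∈_) (sym eqw) (∈-insert (Pa ++ b ∷ a ∷ []))
        b≢a : b ≢ a
        b≢a = proj₂ (beforeP (Pa ++ [ b ]) eqa (∈-++⁺ʳ Pa (here refl)))
        go : Chord₂ Pa b [] a (w ∷ Pb) → Goal
        go ch = removeSaving {c' = c″} a w a∈ w∈ aw lt
                  (λ {v} va ne nw → ≤-reflexive (sym (c″-other nw))) (≤-reflexive (sym c″-w))
                  (λ {v} va ne → c″≤4 va ne)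
                  (remove b (∖⁺ b∈ b≢a) (λ {u} i ne → final (∖⊆ i) (proj₂ (∖⁻ i)) ne , cost≤4 ok' (∖⁺ i ne))
                    (IH (≤-trans (s≤s (∖-≤ b)) (∖-shorter a∈)) ok'))
          where
          open Chord₂ ch
          P' I' : List V
          P' = Pa ++ L₁ ++ L₂ ++ w ∷ Pb
          I' = (I ∖ b) ++ (J ++ Xl)
          P→ : ∀ {u} → u ≢ a → u ≢ b → u ∈ P → u ∈ P'
          P→ na nb p with mid Pa eq p nb
          ... | inj₁ k = ∈-++⁺ˡ k
          ... | inj₂ (here e) = ⊥-elim (na e)
          ... | inj₂ (there k) = ∈-++⁺ʳ Pa (∈-++⁺ʳ L₁ (∈-++⁺ʳ L₂ k))
          ok' : Ok (A ∖ a ∖ b) X₁ X₂ X₃ P' I'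
          ok' = record
            { pl = Pl-sub (λ i → ∖⁺ (∖⁺ (∖⊆ (∖⊆ i)) (proj₂ (∖⁻ i))) (proj₂ (∖⁻ (∖⊆ i)))) ⊆-refl
                     (cast ((⟨ X₁ ⟩ ⊕ ⟨ X₂ ⟩ ⊕ ⟨ X₃ ⟩ ⊕ ⟨ Pa ⟩) ⊕ ⟨ L₁ ⟩ ⊕ ⟨ L₂ ⟩ ⊕ ⟨ w ∷ Pb ⟩) (⟨ X₁ ⟩ ⊕ ⟨ X₂ ⟩ ⊕ ⟨ X₃ ⟩ ⊕ (⟨ Pa ⟩ ⊕ ⟨ L₁ ⟩ ⊕ ⟨ L₂ ⟩ ⊕ ⟨ w ∷ Pb ⟩)) refl
                       (Pl-rot (L₁ ++ L₂ ++ w ∷ Pb) (cast (⟨ L₁ ⟩ ⊕ ⟨ L₂ ⟩ ⊕ ⟨ w ∷ Pb ⟩ ⊕ ⟨ X₁ ⟩ ⊕ ⟨ X₂ ⟩ ⊕ ⟨ X₃ ⟩ ⊕ ⟨ Pa ⟩) ((⟨ L₁ ⟩ ⊕ ⟨ L₂ ⟩ ⊕ ⟨ w ∷ Pb ⟩) ⊕ ⟨ X₁ ⟩ ⊕ ⟨ X₂ ⟩ ⊕ ⟨ X₃ ⟩ ⊕ ⟨ Pa ⟩) refl plC)))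
            ; I⊆P = λ i → [ (λ k → P→ (λ { refl → a∉I (∖⊆ k) }) (proj₂ (∖⁻ k)) (I⊆P ok (∖⊆ k)))
                          , (λ k → [ (λ j → let p , na , nb , _ = J⊆ j in P→ na nb p) , (λ x → ∈-++⁺ʳ Pa (∈-++⁺ˡ (ex₁ (proj₁ (Xl⊆ x)) (proj₂ (Xl⊆ x))))) ]′ (∈-++⁻ J k)) ]′ (∈-++⁻ (I ∖ b) i)
            ; indep = ind
            ; no3 = no3-++ (∖⊆ ∘ ∖⊆) ∖⊆ noJ }
          c″ : V → ℕ
          c″ u with u ≟ w
          ... | yes _ = c u
          ... | no _ = c u + ⟦ adj? a u ⟧
          c″-w : c″ w ≡ c w
          c″-w with w ≟ w
          ... | yes _ = refl
          ... | no ne = ⊥-elim (ne refl)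
          c″-other : ∀ {u} → u ≢ w → c″ u ≡ c u + ⟦ adj? a u ⟧
          c″-other {u} ne with u ≟ w
          ... | yes e = ⊥-elim (ne e)
          ... | no _ = refl
          c' : V → ℕ
          c' = cost X₁ X₂ X₃ P' I'
          final : ∀ {u} → u ∈ A → u ≢ a → u ≢ b → c″ u + ⟦ adj? b u ⟧ ≤ c' u
          final {u} uA na nb = by (u ≟ w)
            where
            by : Dec (u ≡ w) → c″ u + ⟦ adj? b u ⟧ ≤ c' u
            by (yes refl) = subst (λ z → z + ⟦ adj? b w ⟧ ≤ c' w) (sym c″-w)
              (cost-≤ {w} {X₁} {X₂} {X₃} {P} {I} (exchange {P = P} {I} {P'} {I'} (adj? b w) (P→ na nb) (λ i → ∈-++⁺ˡ (∖⁺ i nb)) (I⊆P ok) (λ bw → ⊥-elim (¬bw bw)) (λ bw → ⊥-elim (¬bw bw))))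
            by (no nw) = subst (λ z → z + ⟦ adj? b u ⟧ ≤ c' u) (sym (c″-other nw))
              (≤-trans (≤-reflexive (+-assoc (c u) ⟦ adj? a u ⟧ ⟦ adj? b u ⟧))
               (cost-≤ {u} {X₁} {X₂} {X₃} {P} {I} (≤-trans (≤-reflexive (sym (+-assoc (ι u P + ι u I) ⟦ adj? a u ⟧ ⟦ adj? b u ⟧)))
                (exchange₂ {P = P} {I} {P'} {I'} (adj? a u) (adj? b u) (P→ na nb) (λ i → ∈-++⁺ˡ (∖⁺ i nb)) (I⊆P ok)
                 offP
                 (λ bu p → [ (λ e → ⊥-elim (na e)) , (λ j → ∈-++⁺ʳ (I ∖ b) (∈-++⁺ˡ j) , proj₂ (proj₂ (proj₂ (J⊆ j)))) ]′ (hb p bu))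
                 (λ au → ∈-++⁺ʳ Pa (∈-++⁺ʳ L₁ (∈-++⁺ˡ (ex₂ (∖⁺ uA nb) au))))
                 (λ bu _ → ∈-++⁺ʳ Pa (∈-++⁺ˡ (ex₁ uA bu)))
                 (λ au bu → ∈-++⁺ʳ (I ∖ b) (∈-++⁺ʳ J (common uA (offP au) au bu)))))))
              where
              offP : Adj a u → u ∉ P
              offP au p = [ nb , nw ]′ (ha p au)
          c″≤4 : ∀ {u} → u ∈ A → u ≢ a → c″ u ≤ 4
          c″≤4 {u} uA na = by (u ≟ b)
            where
            by : Dec (u ≡ b) → c″ u ≤ 4
            by (no nb) = ≤-trans (m≤m+n _ _) (≤-trans (final uA na nb) (cost≤4 ok' (∖⁺ (∖⁺ uA na) nb)))
            -- If `b` is adjacent to `a`, it loses one before its own turn; this is where the bound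
            -- three on its loss comes from.
            by (yes refl) = ≤-trans (≤-reflexive (c″-other b≢w)) (+-mono-≤ b≤3 (⟦⟧≤1 (adj? a b)))
              where
              b≢w : b ≢ w
              b≢w = proj₂ (beforeP (Pa ++ b ∷ a ∷ []) eqw (∈-++⁺ʳ Pa (here refl)))

      -- The interior of the quadrangle vi m vj x, once m has been removed too, is
      -- an instance with its four corners as deleted vertices.
      beyond : ∀ {Pa vi m vj Pb} (c : Chord₂ Pa vi [ m ] vj Pb) {x la lb ra rb} (sc : SectorAt c x la lb ra rb) →
        Chord₂.L₁ c ≡ la ++ x ∷ lb → Chord₂.L₂ c ≡ ra ++ x ∷ rb → m ∈ Sector.B sc →
        ∀ {u} → u ∈ Sector.B sc → u ≢ m → Goal
      beyond {Pa} {vi} {m} {vj} {Pb} c {x} {la} {lb} {ra} {rb} sc e₁ e₂ m∈B {u₀} u∈B u≢m =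
        go (deleteV m∈B (cast (⟨ [ m ] ⟩ ⊕ ⟨ ra ⟩ ⊕ ⟨ Nₓ ⟩ ⊕ ⟨ lb ⟩) (⟨ [ m ] ⟩ ⊕ ⟨ ra ⟩ ⊕ ⟨ Nₓ ⟩ ⊕ ⟨ lb ⟩) refl
             (cast ((⟨ [ m ] ⟩ ⊕ ⟨ ra ⟩ ⊕ ⟨ Nₓ ⟩) ⊕ ⟨ lb ⟩) (⟨ [ m ] ⟩ ⊕ ⟨ ra ⟩ ⊕ ⟨ Nₓ ⟩ ⊕ ⟨ lb ⟩) refl
               (Pl-rot lb (cast ((⟨ lb ⟩ ⊕ ⟨ [ m ] ⟩ ⊕ ⟨ ra ⟩) ⊕ ⟨ Nₓ ⟩) (⟨ lb ⟩ ⊕ ⟨ [ m ] ⟩ ⊕ ⟨ ra ⟩ ⊕ ⟨ Nₓ ⟩) refl plB)))))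
        where
        open Chord₂ c
        open Sector sc
        go : Single B m (ra ++ Nₓ ++ lb) → Goal
        go record { Y = Y ; pl = plY ; exposed = ex } =
          -- There are only three segments for the four corners. The neighbourhood `Y` of `m` takes
          -- the place of the boundary, which costs the same and is free here: apart from `m`, no
          -- vertex of `P` lies inside.
          reduce {B ∖ m} {ra} {Nₓ} {lb} {Y} {[]} (nbrsIn (m ∷ x ∷ vi ∷ vj ∷ [])) (∖⁺ u∈B u≢m) (∖⊆ (∖⊆ (B⊆ m∈B))) (λ i → proj₂ (∖⁻ i) refl) (∖⊆ ∘ ∖⊆ ∘ B⊆ ∘ ∖⊆)
            nb le
            record { pl = cast ((⟨ ra ⟩ ⊕ ⟨ Nₓ ⟩ ⊕ ⟨ lb ⟩) ⊕ ⟨ Y ⟩) (⟨ ra ⟩ ⊕ ⟨ Nₓ ⟩ ⊕ ⟨ lb ⟩ ⊕ ⟨ Y ⟩) refl (Pl-rot Y plY) ; I⊆P = λ () ; indep = λ () ; no3 = λ _ () }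
          where
          nb : ∀ {u t} → u ∈ B ∖ m → t ∈ A → t ∉ B ∖ m → Adj t u → t ∈ nbrsIn (m ∷ x ∷ vi ∷ vj ∷ []) u
          nb {u} {t} i ta t∉ tu = ∈-filter⁺ (λ t → adj? t u) (by (t ≟ m)) tu
            where
            by : Dec (t ≡ m) → t ∈ m ∷ x ∷ vi ∷ vj ∷ []
            by (yes e) = here e
            by (no ne) = there (nbrs (∖⊆ i) ta (λ k → t∉ (∖⁺ k ne)) tu)
          le : ∀ {u} → u ∈ B ∖ m → cost X₁ X₂ X₃ P I u + length (nbrsIn (m ∷ x ∷ vi ∷ vj ∷ []) u) ≤ cost ra Nₓ lb Y [] u
          le {u} i = ineq (notQ (∖⊆ i)) (λ p → proj₂ (∖⁻ i) (∈-one (inM c (B⊆ (∖⊆ i)) (notQ (∖⊆ i)) p)))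
              (ex (∖⊆ i)) (exposed (∖⊆ i)) (λ a → inL₁ (∖⊆ i) (subst (u ∈_) e₁ (ex₁ (∖⊆ (∖⊆ (B⊆ (∖⊆ i)))) a))) (λ a → inL₂ (∖⊆ i) (subst (u ∈_) e₂ (ex₂ (∖⊆ (B⊆ (∖⊆ i))) a)))
            where
            eqN : length (nbrsIn (m ∷ x ∷ vi ∷ vj ∷ []) u) ≡ ⟦ adj? m u ⟧ + (⟦ adj? x u ⟧ + (⟦ adj? vi u ⟧ + (⟦ adj? vj u ⟧ + 0)))
            eqN = trans (nbrsIn-∷ m (x ∷ vi ∷ vj ∷ []) u) (cong (λ z → ⟦ adj? m u ⟧ + z) (trans (nbrsIn-∷ x (vi ∷ vj ∷ []) u) (cong (λ z → ⟦ adj? x u ⟧ + z) (nbrs₂ c u))))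
            s : ∀ m x a b → m + (x + (a + (b + 0))) ≡ b + x + a + m + 0
            s = solve-∀
            ineq : u ∉ Q° c → u ∉ P → (Adj m u → u ∈ Y) → (Adj x u → u ∈ Nₓ) → (Adj vi u → u ∈ lb) → (Adj vj u → u ∈ ra) →
              cost X₁ X₂ X₃ P I u + length (nbrsIn (m ∷ x ∷ vi ∷ vj ∷ []) u) ≤ cost ra Nₓ lb Y [] u
            ineq nq np fm fx fi fj rewrite ι-no (X₁∉ Pa Pb nq) | ι-no (X₂∉ Pa Pb nq) | ι-no (X₃∉ Pa Pb nq) | ι-no np | ι-no (np ∘ I⊆P ok) | eqN =
              ≤-trans (≤-reflexive (s ⟦ adj? m u ⟧ ⟦ adj? x u ⟧ ⟦ adj? vi u ⟧ ⟦ adj? vj u ⟧))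
                (+-mono-≤ (+-mono-≤ (+-mono-≤ (+-mono-≤ (⟦⟧-mono (adj? vj u) (u ∈? ra) fj) (⟦⟧-mono (adj? x u) (u ∈? Nₓ) fx)) (⟦⟧-mono (adj? vi u) (u ∈? lb) fi)) (⟦⟧-mono (adj? m u) (u ∈? Y) fm)) (z≤n {0}))

      -- Written with a continuation: a vertex other than `m` inside a quadrangle over `m` already
      -- reduces the problem, so the rest of the argument may assume that there is none. Then `m`
      -- sees only the corners. A second common neighbour `y` is excluded as well, since one of `x`
      -- and `y` lies inside the quadrangle of the other.
      isolated : ∀ Pa vi m vj Pb {x} → P ≡ Pa ++ vi ∷ m ∷ vj ∷ Pb → x ∈ A → x ∉ P → Adj vi x → Adj vj x →
        ((∀ {t} → t ∈ A → Adj t m → t ∈ x ∷ vi ∷ vj ∷ []) →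
         (∀ {y} → y ∈ A → Adj vi y → Adj vj y → y ≢ m → y ≡ x) → Goal) → Goal
      isolated Pa vi m vj Pb {x} eq xA xP ix jx K = go (chord₂ Pa vi [ m ] vj Pb eq)
        where
        eqm : P ≡ (Pa ++ [ vi ]) ++ m ∷ vj ∷ Pb
        eqm = trans eq (sym (++-assoc Pa [ vi ] (m ∷ vj ∷ Pb)))
        mA : m ∈ A
        mA = atP (Pa ++ [ vi ]) eqm
        mP : m ∈ P
        mP = subst (m ∈_) (sym eqm) (∈-insert (Pa ++ [ vi ]))
        m≢vi : m ≢ vi
        m≢vi = proj₂ (afterP Pa eq (here refl))
        m≢vj : m ≢ vj
        m≢vj = proj₂ (beforeP (Pa ++ vi ∷ [ m ]) (trans eq (sym (++-assoc Pa (vi ∷ [ m ]) (vj ∷ Pb)))) (∈-++⁺ʳ Pa (there (here refl))))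
        go : Chord₂ Pa vi [ m ] vj Pb → Goal
        go c = start (∈-∃++ (ex₁ xA ix)) (∈-∃++ (ex₂ (∖⁺ xA (λ { refl → Adj-irrefl ix })) jx))
          where
          open Chord₂ c
          in° : ∀ {y} → y ∈ A → Adj vi y → Adj vj y → y ∈ A° c
          in° a i j = inner c a (λ { refl → Adj-irrefl i }) (λ { refl → Adj-irrefl j })
          m° : m ∈ A° c
          m° = inner c mA m≢vi m≢vj
          inside : ∀ {z y la lb ra rb} → SectorAt c z la lb ra rb → L₁ ≡ la ++ z ∷ lb → L₂ ≡ ra ++ z ∷ rb → y ∈ A → Adj vi y → Adj vj y →
                   y ∈ lb → y ≢ z → y ≢ m → m ≢ z → Goal
          inside {lb = lb} sc e e' yA iy jy y∈ y≢z y≢m m≢z =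
            beyond c sc e e' (Sector.inB sc (∈-++⁺ʳ lb (here refl)) m° m≢z) (Sector.inB sc (∈-++⁺ˡ y∈) (in° yA iy jy) y≢z) y≢m
          start : (∃[ a ] ∃[ b ] L₁ ≡ a ++ [ x ] ++ b) → (∃[ a ] ∃[ b ] L₂ ≡ a ++ [ x ] ++ b) → Goal
          start (la , lb , e) (ra , rb , e') = with-sector (sectorAt c la lb ra rb e e' (in° xA ix jx))
            where
            m≢x : m ≢ x
            m≢x refl = xP mP
            with-sector : SectorAt c x la lb ra rb → Goal
            with-sector sc with any? (λ u → ¬? (u ≟ m)) (Sector.B sc)
            ... | yes some = let u , u∈ , ne = find some in beyond c sc e e' m∈B u∈ ne
              where
              m∈B = Sector.inB sc (∈-++⁺ʳ lb (here refl)) m° m≢x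
            ... | no none with any? (λ y → ¬? (y ≟ x) ×-dec ¬? (y ≟ m) ×-dec adj? vi y ×-dec adj? vj y) A
            ...   | no none' = K (λ {t} ta tm → Sector.nbrs sc m∈B ta (λ k → none (lose k (λ { refl → Adj-irrefl tm }))) tm)
                                 (λ {y} ya iy jy ne → eqx ya iy jy ne (y ≟ x))
              where
              m∈B = Sector.inB sc (∈-++⁺ʳ lb (here refl)) m° m≢x
              eqx : ∀ {y} → y ∈ A → Adj vi y → Adj vj y → y ≢ m → Dec (y ≡ x) → y ≡ x
              eqx ya iy jy ne (yes p) = p
              eqx ya iy jy ne (no p) = ⊥-elim (none' (lose ya (p , ne , iy , jy)))
            ...   | yes some with find some
            ...     | y , ya , y≢x , y≢m , iy , jy with ∈-order (ex₁ xA ix) (ex₁ ya iy) (y≢x ∘ sym)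
            ...       | inj₁ (la' , lb' , e₁ , y∈) = inside (sectorAt c la' lb' ra rb e₁ e' (in° xA ix jx)) e₁ e' ya iy jy y∈ y≢x y≢m m≢x
            ...       | inj₂ (la' , lb' , e₁ , x∈) with ∈-∃++ (ex₂ (∖⁺ ya (λ { refl → Adj-irrefl iy })) jy)
            ...         | ra' , rb' , e₂ = inside (sectorAt c la' lb' ra' rb' e₁ e₂ (in° ya iy jy)) e₁ e₂ xA ix jx x∈ (y≢x ∘ sym) (m≢x ∘ sym) (y≢m ∘ sym)

      -- Remove v₃ saving w, and v₁ saving v₂; then v₂ has only the neighbour x left
      -- and can wait until the end.
      removeThree : ∀ Pa v₁ v₂ v₃ w Pb x → P ≡ Pa ++ v₁ ∷ v₂ ∷ v₃ ∷ w ∷ Pb → x ∈ A → x ∉ P → Adj v₁ x → Adj v₃ x →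
        Adj v₁ v₂ → Adj v₃ w → v₁ ∉ I → v₃ ∉ I →
        cost X₁ X₂ X₃ P I v₃ < cost X₁ X₂ X₃ P I w → cost X₁ X₂ X₃ P I v₁ ≤ cost X₁ X₂ X₃ P I v₂ → cost X₁ X₂ X₃ P I v₂ ≤ 2 →
        (∀ {u} → u ∈ P → Adj v₁ u → u ≡ v₂) → Adj v₃ v₂ → (∀ {u} → u ∈ P → Adj v₃ u → u ≡ v₂ ⊎ u ≡ w) →
        (∀ {t} → t ∈ A → Adj t v₂ → t ∈ x ∷ v₁ ∷ v₃ ∷ []) →
        (∀ {y} → y ∈ A → Adj v₁ y → Adj v₃ y → y ≢ v₂ → y ≡ x) →
        (∀ {u} → u ∈ I → u ≢ v₂ → ¬ Adj x u) → ¬ AllX x → Goal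
      removeThree Pa v₁ v₂ v₃ w Pb x eq xA xP v₁x v₃x v₁v₂ v₃w v₁∉I v₃∉I lt le₁ v₂≤2 h₁ v₃v₂ h₃ N₂ common xI noX = go (chord₂ Pa v₁ [ v₂ ] v₃ (w ∷ Pb) eq)
        where
        c : V → ℕ
        c = cost X₁ X₂ X₃ P I
        eq₂ : P ≡ (Pa ++ [ v₁ ]) ++ v₂ ∷ v₃ ∷ w ∷ Pb
        eq₂ = trans eq (sym (++-assoc Pa [ v₁ ] _))
        eq₃ : P ≡ (Pa ++ v₁ ∷ v₂ ∷ []) ++ v₃ ∷ w ∷ Pb
        eq₃ = trans eq (sym (++-assoc Pa (v₁ ∷ v₂ ∷ []) _))
        eqw : P ≡ (Pa ++ v₁ ∷ v₂ ∷ v₃ ∷ []) ++ w ∷ Pb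
        eqw = trans eq (sym (++-assoc Pa (v₁ ∷ v₂ ∷ v₃ ∷ []) _))
        1∈ : v₁ ∈ A
        1∈ = atP Pa eq
        2∈ : v₂ ∈ A
        2∈ = atP (Pa ++ [ v₁ ]) eq₂
        3∈ : v₃ ∈ A
        3∈ = atP (Pa ++ v₁ ∷ v₂ ∷ []) eq₃
        w∈ : w ∈ A
        w∈ = atP (Pa ++ v₁ ∷ v₂ ∷ v₃ ∷ []) eqw
        w∈P : w ∈ P
        w∈P = subst (w ∈_) (sym eqw) (∈-insert (Pa ++ v₁ ∷ v₂ ∷ v₃ ∷ []))
        1≢3 : v₁ ≢ v₃
        1≢3 = proj₂ (beforeP (Pa ++ v₁ ∷ v₂ ∷ []) eq₃ (∈-++⁺ʳ Pa (here refl)))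
        2≢3 : v₂ ≢ v₃
        2≢3 = proj₂ (beforeP (Pa ++ v₁ ∷ v₂ ∷ []) eq₃ (∈-++⁺ʳ Pa (there (here refl))))
        1≢2 : v₁ ≢ v₂
        1≢2 = proj₂ (beforeP (Pa ++ [ v₁ ]) eq₂ (∈-++⁺ʳ Pa (here refl)))
        2≢w : v₂ ≢ w
        2≢w = proj₂ (beforeP (Pa ++ v₁ ∷ v₂ ∷ v₃ ∷ []) eqw (∈-++⁺ʳ Pa (there (here refl))))
        1≢w : v₁ ≢ w
        1≢w = proj₂ (beforeP (Pa ++ v₁ ∷ v₂ ∷ v₃ ∷ []) eqw (∈-++⁺ʳ Pa (here refl)))
        ¬31 : ¬ Adj v₃ v₁
        ¬31 a = 2≢3 (sym (h₁ (subst (v₃ ∈_) (sym eq₃) (∈-insert (Pa ++ v₁ ∷ v₂ ∷ []))) (Adj-sym a)))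
        -- the losses after the removal of v₃, then of v₁
        c₃ c₁ : V → ℕ
        c₃ u with u ≟ w
        ... | yes _ = c u
        ... | no _ = c u + ⟦ adj? v₃ u ⟧
        c₁ u with u ≟ v₂
        ... | yes _ = c₃ u
        ... | no _ = c₃ u + ⟦ adj? v₁ u ⟧
        c₃-w : c₃ w ≡ c w
        c₃-w with w ≟ w
        ... | yes _ = refl
        ... | no ne = ⊥-elim (ne refl)
        c₃-other : ∀ {u} → u ≢ w → c₃ u ≡ c u + ⟦ adj? v₃ u ⟧
        c₃-other {u} ne with u ≟ w
        ... | yes e = ⊥-elim (ne e)
        ... | no _ = refl
        c₁-2 : c₁ v₂ ≡ c₃ v₂
        c₁-2 with v₂ ≟ v₂
        ... | yes _ = refl
        ... | no ne = ⊥-elim (ne refl)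
        c₁-other : ∀ {u} → u ≢ v₂ → c₁ u ≡ c₃ u + ⟦ adj? v₁ u ⟧
        c₁-other {u} ne with u ≟ v₂
        ... | yes e = ⊥-elim (ne e)
        ... | no _ = refl
        c₃-2 : c₃ v₂ ≡ c v₂ + 1
        c₃-2 = trans (c₃-other 2≢w) (cong (λ z → c v₂ + z) (⟦⟧-yes (adj? v₃ v₂) v₃v₂))
        c₃-1 : c₃ v₁ ≡ c v₁
        c₃-1 = trans (c₃-other 1≢w) (trans (cong (λ z → c v₁ + z) (⟦⟧-no (adj? v₃ v₁) ¬31)) (+-identityʳ _))
        go : Chord₂ Pa v₁ [ v₂ ] v₃ (w ∷ Pb) → Goal
        go ch = removeSaving {c' = c₃} v₃ w 3∈ w∈ v₃w lt
                  (λ {v} _ _ nw → ≤-reflexive (sym (c₃-other nw))) (≤-reflexive (sym c₃-w)) (λ va ne → c₃≤4 va ne)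
                  (removeSaving {c' = c₁} v₁ v₂ (∖⁺ 1∈ 1≢3) (∖⁺ 2∈ 2≢3) v₁v₂
                    -- `v₃` is adjacent to `v₂` but not to `v₁`, so its deletion makes the
                    -- comparison `le₁` strict and the second saving legal.
                    (≤-trans (s≤s (≤-trans (≤-reflexive c₃-1) le₁)) (≤-reflexive (trans (+-comm 1 (c v₂)) (sym c₃-2))))
                    (λ {v} _ _ n2 → ≤-reflexive (sym (c₁-other n2))) (≤-reflexive (sym c₁-2)) (λ va n1 → c₁≤4 (∖⊆ va) (proj₂ (∖⁻ va)) n1)
                    (compose {B = B} {R = [ v₂ ]} {c₂ = λ _ → 4} (λ _ → [ x ]) split ∖⊆ (λ { (here refl) → ∖⁺ (∖⁺ 2∈ 2≢3) (1≢2 ∘ sym) })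
                      (λ { i (here refl) → proj₂ (∖⁻ i) refl })
                      (λ i → final (∖⊆ (∖⊆ (∖⊆ i))) (proj₂ (∖⁻ (∖⊆ (∖⊆ i)))) (proj₂ (∖⁻ (∖⊆ i))) (proj₂ (∖⁻ i)))
                      (λ { (here refl) t tv → here (only t tv) })
                      -- The account of `v₂`: at most two at the start, one for `v₃`, nothing for
                      -- `v₁`, which saves it, and one for `x`.
                      (λ { (here refl) → ≤-trans (≤-reflexive (cong (_+ 1) (trans c₁-2 c₃-2))) (+-mono-≤ (+-mono-≤ v₂≤2 (≤-refl {1})) (≤-refl {1})) , ≤-refl })
                      (IH (≤-trans (s≤s (≤-trans (∖-≤ v₂) (∖-≤ v₁))) (∖-shorter 3∈)) ok')
                      (step v₂ (here refl) (λ { (here refl) ne → ⊥-elim (ne refl) }) (λ ()) blank (λ ()) (done {A = []} {c = λ _ → 4} (λ ())))))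
          where
          open Chord₂ ch
          B : List V
          B = A ∖ v₃ ∖ v₁ ∖ v₂
          split : ∀ {v} → v ∈ A ∖ v₃ ∖ v₁ → v ∈ B ⊎ v ∈ [ v₂ ]
          split {v} i = by (v ≟ v₂)
            where
            by : Dec (v ≡ v₂) → v ∈ B ⊎ v ∈ [ v₂ ]
            by (yes e) = inj₂ (here e)
            by (no ne) = inj₁ (∖⁺ i ne)
          only : ∀ {t} → t ∈ B → Adj t v₂ → t ≡ x
          only i a with N₂ (∖⊆ (∖⊆ (∖⊆ i))) a
          ... | here e = e
          ... | there (here e) = ⊥-elim (proj₂ (∖⁻ (∖⊆ i)) e)
          ... | there (there (here e)) = ⊥-elim (proj₂ (∖⁻ (∖⊆ (∖⊆ i))) e)
          P' I' : List V
          P' = Pa ++ L₁ ++ L₂ ++ w ∷ Pb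
          I' = (I ∖ v₂) ++ [ x ]
          P→ : ∀ {u} → u ≢ v₁ → u ≢ v₂ → u ≢ v₃ → u ∈ P → u ∈ P'
          P→ n₁ n₂ n₃ p with mid Pa eq p n₁
          ... | inj₁ k = ∈-++⁺ˡ k
          ... | inj₂ (here e) = ⊥-elim (n₂ e)
          ... | inj₂ (there (here e)) = ⊥-elim (n₃ e)
          ... | inj₂ (there (there k)) = ∈-++⁺ʳ Pa (∈-++⁺ʳ L₁ (∈-++⁺ʳ L₂ k))
          ok' : Ok B X₁ X₂ X₃ P' I'
          ok' = record
            { pl = cast ((⟨ X₁ ⟩ ⊕ ⟨ X₂ ⟩ ⊕ ⟨ X₃ ⟩ ⊕ ⟨ Pa ⟩) ⊕ ⟨ L₁ ⟩ ⊕ ⟨ L₂ ⟩ ⊕ ⟨ w ∷ Pb ⟩) (⟨ X₁ ⟩ ⊕ ⟨ X₂ ⟩ ⊕ ⟨ X₃ ⟩ ⊕ (⟨ Pa ⟩ ⊕ ⟨ L₁ ⟩ ⊕ ⟨ L₂ ⟩ ⊕ ⟨ w ∷ Pb ⟩)) refl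
                (Pl-rot (L₁ ++ L₂ ++ w ∷ Pb) (cast (⟨ L₁ ⟩ ⊕ ⟨ L₂ ⟩ ⊕ ⟨ w ∷ Pb ⟩ ⊕ ⟨ X₁ ⟩ ⊕ ⟨ X₂ ⟩ ⊕ ⟨ X₃ ⟩ ⊕ ⟨ Pa ⟩) ((⟨ L₁ ⟩ ⊕ ⟨ L₂ ⟩ ⊕ ⟨ w ∷ Pb ⟩) ⊕ ⟨ X₁ ⟩ ⊕ ⟨ X₂ ⟩ ⊕ ⟨ X₃ ⟩ ⊕ ⟨ Pa ⟩) refl
                  (Pl-sub (λ i → ∖⁺ (∖⁺ (∖⊆ (∖⊆ (∖⊆ i))) (proj₂ (∖⁻ (∖⊆ i)))) (proj₂ (∖⁻ (∖⊆ (∖⊆ i)))))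
                    (++⁺ (⊆-refl {x = L₁}) (v₂ ∷ʳ ⊆-refl)) plC)))
            ; I⊆P = λ i → [ (λ k → P→ (λ { refl → v₁∉I (∖⊆ k) }) (proj₂ (∖⁻ k)) (λ { refl → v₃∉I (∖⊆ k) }) (I⊆P ok (∖⊆ k)))
                          , (λ { (here refl) → ∈-++⁺ʳ Pa (∈-++⁺ˡ (ex₁ xA v₁x)) }) ]′ (∈-++⁻ (I ∖ v₂) i)
            ; indep = indep-++ (λ i j → indep ok (∖⊆ i) (∖⊆ j)) indep-[ x ] (λ { i (here refl) ux → xI (∖⊆ i) (proj₂ (∖⁻ i)) (Adj-sym ux) })
            ; no3 = no3-++ (∖⊆ ∘ ∖⊆ ∘ ∖⊆) ∖⊆ (λ { (here refl) → noX }) }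
          final : ∀ {u} → u ∈ A → u ≢ v₃ → u ≢ v₁ → u ≢ v₂ → c₁ u ≤ cost X₁ X₂ X₃ P' I' u
          final {u} uA n₃ n₁ n₂ = subst (_≤ cost X₁ X₂ X₃ P' I' u) (sym (c₁-other n₂)) (by (u ≟ w))
            where
            ¬1P : Adj v₁ u → u ∉ P
            ¬1P a p = n₂ (h₁ p a)
            by : Dec (u ≡ w) → c₃ u + ⟦ adj? v₁ u ⟧ ≤ cost X₁ X₂ X₃ P' I' u
            by (yes refl) = subst (λ z → z + ⟦ adj? v₁ w ⟧ ≤ cost X₁ X₂ X₃ P' I' w) (sym c₃-w)
              (cost-≤ {w} {X₁} {X₂} {X₃} {P} {I} (exchange {P = P} {I} {P'} {I'} (adj? v₁ w) (P→ n₁ n₂ n₃) (λ i → ∈-++⁺ˡ (∖⁺ i n₂)) (I⊆P ok) (λ a _ → ⊥-elim (¬1P a w∈P)) (λ a → ⊥-elim (¬1P a w∈P))))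
            by (no nw) = subst (λ z → z + ⟦ adj? v₁ u ⟧ ≤ cost X₁ X₂ X₃ P' I' u) (sym (c₃-other nw))
              (≤-trans (≤-reflexive (+-assoc (c u) ⟦ adj? v₃ u ⟧ ⟦ adj? v₁ u ⟧))
               (cost-≤ {u} {X₁} {X₂} {X₃} {P} {I} (≤-trans (≤-reflexive (sym (+-assoc (ι u P + ι u I) ⟦ adj? v₃ u ⟧ ⟦ adj? v₁ u ⟧)))
                (exchange₂ {P = P} {I} {P'} {I'} (adj? v₃ u) (adj? v₁ u) (P→ n₁ n₂ n₃) (λ i → ∈-++⁺ˡ (∖⁺ i n₂)) (I⊆P ok)
                 (λ a p → [ n₂ , nw ]′ (h₃ p a))
                 (λ a p → ⊥-elim (¬1P a p))
                 (λ a → ∈-++⁺ʳ Pa (∈-++⁺ʳ L₁ (∈-++⁺ˡ (ex₂ (∖⁺ uA n₁) a))))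
                 (λ a _ → ∈-++⁺ʳ Pa (∈-++⁺ˡ (ex₁ uA a)))
                 (λ a b → ∈-++⁺ʳ (I ∖ v₂) (here (common uA b a n₂)))))))
          c₁≤4 : ∀ {u} → u ∈ A → u ≢ v₃ → u ≢ v₁ → c₁ u ≤ 4
          c₁≤4 {u} uA n₃ n₁ = by (u ≟ v₂)
            where
            by : Dec (u ≡ v₂) → c₁ u ≤ 4
            by (yes refl) = ≤-trans (≤-reflexive (trans c₁-2 c₃-2)) (≤-trans (+-mono-≤ v₂≤2 (≤-refl {1})) (s≤s (s≤s (s≤s z≤n))))
            by (no n₂) = ≤-trans (final uA n₃ n₁ n₂) (cost≤4 ok' (∖⁺ (∖⁺ (∖⁺ uA n₃) n₁) n₂))
          c₃≤4 : ∀ {u} → u ∈ A → u ≢ v₃ → c₃ u ≤ 4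
          c₃≤4 {u} uA n₃ = by (u ≟ v₁) (u ≟ v₂)
            where
            by : Dec (u ≡ v₁) → Dec (u ≡ v₂) → c₃ u ≤ 4
            by (yes refl) _ = ≤-trans (≤-reflexive c₃-1) (≤-trans le₁ (≤-trans v₂≤2 (s≤s (s≤s z≤n))))
            by (no n₁) (yes refl) = ≤-trans (≤-reflexive (sym c₁-2)) (c₁≤4 uA n₃ n₁)
            by (no n₁) (no n₂) = ≤-trans (m≤m+n _ _) (≤-trans (≤-reflexive (sym (c₁-other n₂))) (c₁≤4 uA n₃ n₁))

      -- The end of the boundary next to the last deleted vertex

      module Cases (dropped : ∀ {P' I'} → Ok A X₁ X₂ [] P' I' → W A (cost X₁ X₂ [] P' I')) where


        c : V → ℕ
        c = cost X₁ X₂ X₃ P I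

        -- A common neighbour `x` of `a` and `b` outside `P` loses two and must join `I`. Obstacles
        -- are a second common neighbour, membership in `X₁` (without which `x` cannot lie in all
        -- three segments), and a neighbour of `x` in `I`. Each of them gives a separating path of
        -- length two that starts at `b` and passes through a common neighbour.
        finishTwo : ∀ Pa b a w Pb J → P ≡ Pa ++ b ∷ a ∷ w ∷ Pb → Adj a w → Adj b a → a ∉ I →
          c a < c w → c b ≤ 3 →
          (∀ {u} → u ∈ P → Adj a u → u ≡ b ⊎ u ≡ w) → (∀ {u} → u ∈ P → Adj b u → u ≡ a ⊎ u ∈ J) →
          (∀ {u} → u ∈ J → u ∈ P × u ≢ a × u ≢ b × u ∉ I) → (∀ {u} → u ∈ I → u ∉ Pa) → (∀ {u} → u ∈ w ∷ Pb → ¬ Adj b u) →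
          Independent J → (∀ {u v} → u ∈ I → u ≢ b → v ∈ J → ¬ Adj u v) → (∀ {u} → u ∈ J → ¬ AllX u) →
          (∀ {u x} → u ∈ J → x ∈ A → x ∉ P → Adj a x → Adj b x → ¬ Adj u x) → Goal
        finishTwo Pa b a w Pb J eq aw ba a∉I lt b≤3 ha hb J⊆ I∩Pa hb' indJ cross noJ JX
          with any? (λ x → ¬? (x ∈? P) ×-dec adj? a x ×-dec adj? b x) A
        ... | no none = removeTwo Pa b a w Pb J [] eq aw (hb' (here refl)) a∉I lt b≤3 ha hb J⊆
              (λ uA uP au bu → ⊥-elim (none (lose uA (uP , au , bu)))) (λ ())
              (indep-++ (λ i j → indep ok (∖⊆ i) (∖⊆ j)) (indep-++ indJ indep-[] (λ _ ())) (λ i j → [ cross (∖⊆ i) (proj₂ (∖⁻ i)) , (λ ()) ]′ (∈-++⁻ J j)))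
              (λ i → [ noJ , (λ ()) ]′ (∈-++⁻ J i))
        ... | yes some with find some
        ...   | x , xA , xP , ax , bx = at-x (x ∈? X₁) (any? (λ y → ¬? (y ≟ x) ×-dec adj? a y ×-dec adj? b y) A) (any? (λ u → ¬? (u ≟ b) ×-dec adj? x u) I)
          where
          at-x : Dec (x ∈ X₁) → Dec (Any (λ y → y ≢ x × Adj a y × Adj b y) A) → Dec (Any (λ u → u ≢ b × Adj x u) I) → Goal
          at-x (yes xX) _ _ = twoPathFirst Pa b (a ∷ w ∷ Pb) eq xX xA xP bx (here refl)
            λ { i (here refl) _ _ → a∉I i ; i (there k) _ bu → hb' k bu }
          at-x (no _) (yes more) _ = let y , yA , y≢x , ay , by = find more in
            oneCommonNbr Pa b a (w ∷ Pb) eq xA yA (y≢x ∘ sym) bx ax by ay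
          at-x (no _) (no _) (yes adjI) with find adjI
          ... | u , uI , u≢b , xu with mid Pa eq (I⊆P ok uI) u≢b
          ...   | inj₁ k = ⊥-elim (I∩Pa uI k)
          ...   | inj₂ (here refl) = ⊥-elim (a∉I uI)
          ...   | inj₂ (there k) with ∈-∃++ k
          ...     | Pm , Pb' , e = twoPathP Pa b (a ∷ Pm) u Pb' (trans eq (cong (λ z → Pa ++ b ∷ a ∷ z) e)) xA xP bx (Adj-sym xu) (here refl)
                    (λ { i (here refl) _ _ _ → a∉I i ; i (there m) bz _ _ → hb' (subst (_ ∈_) (sym e) (∈-++⁺ˡ m)) bz })
          at-x (no xX) (no single) (no ¬xI) = removeTwo Pa b a w Pb J [ x ] eq aw (hb' (here refl)) a∉I lt b≤3 ha hb J⊆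
              (λ {u} uA uP au bu → here (the-one uA au bu (u ≟ x))) (λ { (here refl) → xA , bx })
              (indep-++ (λ i j → indep ok (∖⊆ i) (∖⊆ j)) (indep-++ indJ indep-[ x ] (λ { j (here refl) → JX j xA xP ax bx }))
                (λ i j → [ cross (∖⊆ i) (proj₂ (∖⁻ i)) , (λ { (here refl) ux → ¬xI (lose (∖⊆ i) (proj₂ (∖⁻ i) , Adj-sym ux)) }) ]′ (∈-++⁻ J j)))
              (λ i → [ noJ , (λ { (here refl) (q , _) → xX q }) ]′ (∈-++⁻ J i))
            where
            the-one : ∀ {u} → u ∈ A → Adj a u → Adj b u → Dec (u ≡ x) → u ≡ x
            the-one uA au bu (yes e) = e
            the-one uA au bu (no ne) = ⊥-elim (single (lose uA (ne , au , bu)))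

        chordFrom : ∀ Pa u m {Pb} → P ≡ Pa ++ u ∷ m ∷ Pb → ∀ {v} → v ∈ Pb → Adj u v → Goal
        chordFrom Pa u m eq v∈ uv with ∈-∃++ v∈
        ... | Pm , Pb' , refl = chordP Pa u (m ∷ Pm) _ Pb' eq uv (here refl)

        behind : ∀ {u v} Pa {Pb} → P ≡ Pa ++ v ∷ Pb → u ∈ Pb → u ∈ P
        behind Pa refl i = ∈-++⁺ʳ Pa (there i)

        module _ {v₁ v₂ P₂} (eq : P ≡ v₁ ∷ v₂ ∷ P₂) (noX₂ : ∀ {u} → u ∈ P → u ∉ X₂) (noX₃ : ∀ {u} → u ∈ v₂ ∷ P₂ → u ∉ X₃)
                 (no₁ : ∀ {u} → u ∈ P₂ → ¬ Adj v₁ u) where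

          v₁P : v₁ ∈ P
          v₁P = subst (v₁ ∈_) (sym eq) (here refl)
          v₂P : v₂ ∈ P
          v₂P = subst (v₂ ∈_) (sym eq) (there (here refl))
          noAll : ∀ {u} → u ∈ P → ¬ AllX u
          noAll p (_ , q , _) = noX₂ p q
          v₁≢v₂ : v₁ ≢ v₂
          v₁≢v₂ e = proj₂ (afterP [] eq (here refl)) (sym e)
          nbrs-v₁ : ∀ {u} → u ∈ P → Adj v₁ u → u ≡ v₂
          nbrs-v₁ p a with subst (_ ∈_) eq p
          ... | here refl = ⊥-elim (Adj-irrefl a)
          ... | there (here e) = e
          ... | there (there k) = ⊥-elim (no₁ k a)

          cost≤1 : ∀ {u} → u ∈ v₂ ∷ P₂ → u ∉ X₁ → u ∉ I → c u ≤ 1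
          cost≤1 {u} k x i rewrite ι-no x | ι-no (noX₂ (behind [] eq k)) | ι-no (noX₃ k) | ι-no i = ≤-trans (≤-reflexive (+-identityʳ _)) (⟦⟧≤1 (u ∈? P))

          -- Deleting `v₁` pushes `v₂` into `I` if they are adjacent. This fails only if `v₂` has
          -- another neighbour in `I`, which must be `v₃`, as a later one gives a chord. Then `v₂`
          -- goes first and saves `v₃`: its loss is at most one, that of `v₃` at least two.
          caseB : v₁ ∈ I → Goal
          caseB i₁ with adj? v₁ v₂
          ... | no ¬12 = removeP [] v₁ (v₂ ∷ P₂) [] eq (λ p a → ⊥-elim (¬12 (subst (Adj v₁) (nbrs-v₁ p a) a))) (λ ())
                (indep-++ (λ i j → indep ok (∖⊆ i) (∖⊆ j)) indep-[] (λ _ ())) (λ ())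
          ... | yes 12a with any? (λ u → ¬? (u ≟ v₁) ×-dec adj? v₂ u) I
          ...   | no none = removeP [] v₁ (v₂ ∷ P₂) [ v₂ ] eq (λ p a → here (nbrs-v₁ p a)) (λ { (here refl) → v₂P , v₁≢v₂ ∘ sym , λ i₂ → indep ok i₁ i₂ 12a })
                  (indep-++ (λ i j → indep ok (∖⊆ i) (∖⊆ j)) indep-[ v₂ ] (λ { i (here refl) a → none (lose (∖⊆ i) (proj₂ (∖⁻ i) , Adj-sym a)) }))
                  (λ { (here refl) → noAll v₂P })
          ...   | yes some with find some
          ...     | u , uI , u≢1 , 2u with subst (u ∈_) eq (I⊆P ok uI)
          ...       | here e = ⊥-elim (u≢1 e)
          ...       | there (here refl) = ⊥-elim (Adj-irrefl 2u)
          ...       | there (there k) = third k eq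
            where
            third : ∀ {P₂'} → u ∈ P₂' → P ≡ v₁ ∷ v₂ ∷ P₂' → Goal
            third {v₃ ∷ P₃} (there k) e = chordFrom [ v₁ ] v₂ v₃ e k 2u
            third {v₃ ∷ P₃} (here refl) e = go (v₂ ∈? X₁) (v₁ ∈? X₁) (any? (adj? v₂) P₃)
              where
              e₂ : P₂ ≡ v₃ ∷ P₃
              e₂ = ∷-injectiveʳ (∷-injectiveʳ (trans (sym eq) e))
              go : Dec (v₂ ∈ X₁) → Dec (v₁ ∈ X₁) → Dec (Any (Adj v₂) P₃) → Goal
              go (yes x) _ _ = chordFirst [ v₁ ] v₂ (v₃ ∷ P₃) e x (P⊆A v₂P) (here refl) (P⊆A (I⊆P ok uI)) (proj₂ (afterP [ v₁ ] e (here refl)))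
              go _ (yes x) _ = chordFirst [] v₁ (v₂ ∷ P₂) eq x (P⊆A v₁P) (here refl) (P⊆A v₂P) (v₁≢v₂ ∘ sym)
              go _ _ (yes a) = let _ , k , 2v = find a in chordFrom [ v₁ ] v₂ v₃ e k 2v
              go (no x₂) (no x₁) (no no₂) = finishTwo [] v₁ v₂ v₃ P₃ [] e 2u 12a (λ i₂ → indep ok i₁ i₂ 12a)
                (≤-trans (s≤s (cost≤1 (here refl) x₂ (λ i₂ → indep ok i₁ i₂ 12a))) (2≤cost {X₁} {X₂} {X₃} (I⊆P ok uI) uI))
                (c1≤3 x₁) ha (λ p a → inj₁ (nbrs-v₁ p a)) (λ ()) (λ _ ()) (λ k → no₁ (subst (_ ∈_) (sym e₂) k))
                indep-[] (λ _ _ ()) (λ ()) (λ ())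
                where
                c1≤3 : v₁ ∉ X₁ → c v₁ ≤ 3
                c1≤3 x rewrite ι-no x | ι-no (noX₂ v₁P) = +-mono-≤ (+-mono-≤ (⟦⟧≤1 (v₁ ∈? X₃)) (⟦⟧≤1 (v₁ ∈? P))) (⟦⟧≤1 (v₁ ∈? I))
                ha : ∀ {z} → z ∈ P → Adj v₂ z → z ≡ v₁ ⊎ z ≡ v₃
                ha p a with subst (_ ∈_) e p
                ... | here q = inj₁ q
                ... | there (here refl) = ⊥-elim (Adj-irrefl a)
                ... | there (there (here q)) = inj₂ q
                ... | there (there (there k)) = ⊥-elim (no₂ (lose k a))

          module _ (x₁ : v₁ ∈ X₃) (n₁ : v₁ ∉ I) (i₂ : v₂ ∈ I) (12a : Adj v₁ v₂) where

            cross₁ : ∀ {u v} → u ∈ I → u ≢ v₂ → v ∈ [ v₁ ] → ¬ Adj u v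
            cross₁ i ne (here refl) a = ne (nbrs-v₁ (I⊆P ok i) (Adj-sym a))

            removeV₂ : ∀ {Pb} J → P ≡ v₁ ∷ v₂ ∷ Pb → (∀ {u} → u ∈ Pb → Adj v₂ u → u ∈ J) →
              (∀ {u} → u ∈ J → u ∈ P₂ × u ∉ I × u ≢ v₂) → Independent J → (∀ {u v} → u ∈ I → u ≢ v₂ → v ∈ J → ¬ Adj u v) → Goal
            removeV₂ {Pb} J e nb J⊆ indJ cross = removeP [ v₁ ] v₂ Pb (v₁ ∷ J) e nb'
              (λ { (here refl) → v₁P , v₁≢v₂ , n₁ ; (there j) → behind [] eq (there (proj₁ (J⊆ j))) , proj₂ (proj₂ (J⊆ j)) , proj₁ (proj₂ (J⊆ j)) })
              (indep-++ (λ i j → indep ok (∖⊆ i) (∖⊆ j)) (indep-++ indep-[ v₁ ] indJ (λ { (here refl) j → no₁ (proj₁ (J⊆ j)) }))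
                (λ { i (here refl) → cross₁ (∖⊆ i) (proj₂ (∖⁻ i)) (here refl) ; i (there j) → cross (∖⊆ i) (proj₂ (∖⁻ i)) j }))
              (λ { (here refl) → noAll v₁P ; (there j) → noAll (behind [] eq (there (proj₁ (J⊆ j)))) })
              where
              nb' : ∀ {u} → u ∈ P → Adj v₂ u → u ∈ v₁ ∷ J
              nb' p a with subst (_ ∈_) e p
              ... | here q = here q
              ... | there (here refl) = ⊥-elim (Adj-irrefl a)
              ... | there (there k) = there (nb k a)

            module _ {v₃ v₄ P₄} (e₂ : P₂ ≡ v₃ ∷ v₄ ∷ P₄) (no₂ : ∀ {u} → u ∈ v₄ ∷ P₄ → ¬ Adj v₂ u) (23a : Adj v₂ v₃) (34a : Adj v₃ v₄) (i₄ : v₄ ∈ I) where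

              e : P ≡ v₁ ∷ v₂ ∷ v₃ ∷ v₄ ∷ P₄
              e = trans eq (cong (λ z → v₁ ∷ v₂ ∷ z) e₂)
              n₃ : v₃ ∉ I
              n₃ i = indep ok i₂ i 23a
              v₃P₂ : v₃ ∈ P₂
              v₃P₂ = subst (v₃ ∈_) (sym e₂) (here refl)
              v₃P : v₃ ∈ P
              v₃P = behind [] eq (there v₃P₂)
              rest⊆ : ∀ {u} → u ∈ v₄ ∷ P₄ → u ∈ P₂
              rest⊆ k = subst (_ ∈_) (sym e₂) (there k)

              nbrs-v₃ : ¬ Any (Adj v₃) P₄ → ∀ {u} → u ∈ P → Adj v₃ u → u ≡ v₂ ⊎ u ≡ v₄
              nbrs-v₃ no₃ p a with subst (_ ∈_) e p
              ... | here refl = ⊥-elim (no₁ v₃P₂ (Adj-sym a))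
              ... | there (here q) = inj₁ q
              ... | there (there (here refl)) = ⊥-elim (Adj-irrefl a)
              ... | there (there (there (here q))) = inj₂ q
              ... | there (there (there (there k))) = ⊥-elim (no₃ (lose k a))

              -- `v₃` cannot join `I` because of `v₄`, so it is deleted first and saves `v₄`; then
              -- `v₂` is deleted and `v₁` joins `I`. The common neighbours of `v₂` and `v₃` join `I`
              -- too, which is impossible for an `x` adjacent also to `v₁`. For such an `x`, unless
              -- a separation exists, `v₃` and `v₁` are deleted and `v₂` is postponed.
              caseDE : Goal
              caseDE = go (v₁ ∈? X₁) (v₂ ∈? X₁) (v₃ ∈? X₁) (any? (adj? v₃) P₄)
                where
                go : Dec (v₁ ∈ X₁) → Dec (v₂ ∈ X₁) → Dec (v₃ ∈ X₁) → Dec (Any (Adj v₃) P₄) → Goal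
                go (yes x) _ _ _ = chordFirst [] v₁ (v₂ ∷ P₂) eq x (P⊆A v₁P) (here refl) (P⊆A v₂P) (v₁≢v₂ ∘ sym)
                go _ (yes x) _ _ = chordFirst [ v₁ ] v₂ (v₃ ∷ v₄ ∷ P₄) e x (P⊆A v₂P) (here refl) (P⊆A v₃P) (proj₂ (afterP [ v₁ ] e (here refl)))
                go _ _ (yes x) _ = chordFirst (v₁ ∷ v₂ ∷ []) v₃ (v₄ ∷ P₄) e x (P⊆A v₃P) (here refl) (P⊆A (I⊆P ok i₄)) (proj₂ (afterP (v₁ ∷ v₂ ∷ []) e (here refl)))
                go _ _ _ (yes a) = let _ , k , 3v = find a in chordFrom (v₁ ∷ v₂ ∷ []) v₃ v₄ e k 3v
                go (no x₁') (no x₂') (no x₃') (no no₃) with any? (λ x → ¬? (x ∈? P) ×-dec adj? v₁ x ×-dec adj? v₂ x ×-dec adj? v₃ x) A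
                ... | no none = finishTwo [ v₁ ] v₂ v₃ v₄ P₄ [ v₁ ] e 34a 23a n₃ c₃<c₄ c₂≤3 (nbrs-v₃ no₃) hb
                      (λ { (here refl) → v₁P , proj₂ (beforeP (v₁ ∷ v₂ ∷ []) e (here refl)) , v₁≢v₂ , n₁ })
                      (λ { i (here refl) → n₁ i }) no₂ indep-[ v₁ ] cross₁ (λ { (here refl) → noAll v₁P })
                      (λ { (here refl) xA xP 3x 2x 1x → none (lose xA (xP , 1x , 2x , 3x)) })
                  where
                  c₃<c₄ : c v₃ < c v₄
                  c₃<c₄ = ≤-trans (s≤s (cost≤1 (there v₃P₂) x₃' n₃)) (2≤cost {X₁} {X₂} {X₃} (I⊆P ok i₄) i₄)
                  c₂≤3 : c v₂ ≤ 3
                  c₂≤3 rewrite ι-no x₂' | ι-no (noX₂ v₂P) | ι-no (noX₃ (here refl)) = ≤-trans (+-mono-≤ (⟦⟧≤1 (v₂ ∈? P)) (⟦⟧≤1 (v₂ ∈? I))) (n≤1+n 2)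
                  hb : ∀ {u} → u ∈ P → Adj v₂ u → u ≡ v₃ ⊎ u ∈ [ v₁ ]
                  hb p a with subst (_ ∈_) e p
                  ... | here q = inj₂ (here q)
                  ... | there (here refl) = ⊥-elim (Adj-irrefl a)
                  ... | there (there (here q)) = inj₁ q
                  ... | there (there (there k)) = ⊥-elim (no₂ k a)
                ... | yes some with find some
                ...   | x , xA , xP , 1x , 2x , 3x = at-x (x ∈? X₁) (any? (λ u → ¬? (u ≟ v₂) ×-dec adj? x u) I)
                  where
                  c₂≤2 : c v₂ ≤ 2
                  c₂≤2 rewrite ι-no x₂' | ι-no (noX₂ v₂P) | ι-no (noX₃ (here refl)) = +-mono-≤ (⟦⟧≤1 (v₂ ∈? P)) (⟦⟧≤1 (v₂ ∈? I))
                  c₁≤2 : c v₁ ≤ 2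
                  c₁≤2 rewrite ι-no x₁' | ι-no (noX₂ v₁P) | ι-no n₁ = ≤-trans (≤-reflexive (+-identityʳ _)) (+-mono-≤ (⟦⟧≤1 (v₁ ∈? X₃)) (⟦⟧≤1 (v₁ ∈? P)))
                  at-x : Dec (x ∈ X₁) → Dec (Any (λ u → u ≢ v₂ × Adj x u) I) → Goal
                  at-x (yes xX) _ = twoPathFirst [] v₁ (v₂ ∷ P₂) eq xX xA xP 1x (here refl)
                    λ { i (here refl) q _ → x₂' q ; i (there k) _ a → no₁ k a }
                  at-x (no _) (yes adjI) with find adjI
                  ... | u , uI , u≢2 , xu with subst (u ∈_) e (I⊆P ok uI)
                  ...   | here refl = ⊥-elim (n₁ uI)
                  ...   | there (here q) = ⊥-elim (u≢2 q)
                  ...   | there (there (here refl)) = ⊥-elim (n₃ uI)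
                  ...   | there (there (there k)) with ∈-∃++ k
                  ...     | Pm , Pb' , em = twoPathP [] v₁ (v₂ ∷ v₃ ∷ Pm) u Pb' (trans e (cong (λ z → v₁ ∷ v₂ ∷ v₃ ∷ z) em)) xA xP 1x (Adj-sym xu) (here refl)
                            (λ { i (here refl) _ uv _ → indep ok uI i uv ; i (there (here refl)) _ _ _ → n₃ i
                               ; i (there (there m)) 1z _ _ → no₁ (rest⊆ (subst (_ ∈_) (sym em) (∈-++⁺ˡ m))) 1z })
                  at-x (no xX) (no ¬xI) = isolated [] v₁ v₂ v₃ (v₄ ∷ P₄) e xA xP 1x 3x λ N₂ only →
                    removeThree [] v₁ v₂ v₃ v₄ P₄ x e xA xP 1x 3x 12a 34a n₁ n₃
                      (≤-trans (s≤s (cost≤1 (there v₃P₂) x₃' n₃)) (2≤cost {X₁} {X₂} {X₃} (I⊆P ok i₄) i₄))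
                      (≤-trans c₁≤2 (2≤cost {X₁} {X₂} {X₃} v₂P i₂)) c₂≤2 nbrs-v₁ (Adj-sym 23a) (nbrs-v₃ no₃) N₂ only
                      (λ i ne a → ¬xI (lose i (ne , a))) (λ (q , _) → xX q)

            -- Deleting `v₂` takes it out of `I` and puts `v₁`, and `v₃` if adjacent, in its place.
            -- The new set is independent unless `v₃` has a further neighbour in `I`, which is `v₄`
            -- or the end of a chord.
            caseC : Goal
            caseC = go P₂ refl
              where
              go : ∀ P₂' → P₂ ≡ P₂' → Goal
              go [] e₂ = removeV₂ [] eq (λ k _ → ⊥-elim (nope (subst (_ ∈_) e₂ k))) (λ ()) indep-[] (λ _ _ ())
                where
                nope : ∀ {u} → u ∈ [] → ⊥
                nope ()
              go (v₃ ∷ P₃) e₂ with any? (adj? v₂) P₃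
              ... | yes a = let _ , k , 2v = find a in chordFrom [ v₁ ] v₂ v₃ (trans eq (cong (λ z → v₁ ∷ v₂ ∷ z) e₂)) k 2v
              ... | no no₂ = by (adj? v₂ v₃)
                where
                v₃P₂' : v₃ ∈ P₂
                v₃P₂' = subst (v₃ ∈_) (sym e₂) (here refl)
                eq' : P ≡ v₁ ∷ v₂ ∷ v₃ ∷ P₃
                eq' = trans eq (cong (λ z → v₁ ∷ v₂ ∷ z) e₂)
                by : Dec (Adj v₂ v₃) → Goal
                by (no ¬23) = removeV₂ [] eq' (λ { (here refl) a → ⊥-elim (¬23 a) ; (there k) a → ⊥-elim (no₂ (lose k a)) }) (λ ()) indep-[] (λ _ _ ())
                by (yes 23a) with any? (λ u → ¬? (u ≟ v₂) ×-dec adj? v₃ u) I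
                ... | no none = removeV₂ [ v₃ ] eq' (λ { (here q) _ → here q ; (there k) a → ⊥-elim (no₂ (lose k a)) })
                      (λ { (here refl) → v₃P₂' , (λ i → indep ok i₂ i 23a) , λ { refl → Adj-irrefl 23a } }) indep-[ v₃ ]
                      (λ { i ne (here refl) a → none (lose i (ne , Adj-sym a)) })
                ... | yes some with find some
                ...   | u , uI , u≢2 , 3u with subst (u ∈_) eq' (I⊆P ok uI)
                ...     | here refl = ⊥-elim (n₁ uI)
                ...     | there (here q) = ⊥-elim (u≢2 q)
                ...     | there (there (here refl)) = ⊥-elim (Adj-irrefl 3u)
                ...     | there (there (there k)) = fourth P₃ refl k
                  where
                  fourth : ∀ P₃' → P₃ ≡ P₃' → u ∈ P₃' → Goal
                  fourth (v₄ ∷ P₄) e₃ (there k) = chordFrom (v₁ ∷ v₂ ∷ []) v₃ v₄ (trans eq' (cong (λ z → v₁ ∷ v₂ ∷ v₃ ∷ z) e₃)) k 3u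
                  fourth (v₄ ∷ P₄) e₃ (here refl) = caseDE (trans e₂ (cong (v₃ ∷_) e₃)) (λ k a → no₂ (lose (subst (_ ∈_) (sym e₃) k) a)) 23a 3u uI

        -- When no chord is left, `v₁` is the only vertex of `P` that can lie in `X₃`, and its only
        -- possible neighbour on `P` is `v₂`. So forgetting `X₃` fails in two situations: `v₁` is
        -- already in `I`, or `v₂` is in `I` and adjacent to `v₁`.
        core : Goal
        core = go P refl
          where
          go : ∀ P' → P ≡ P' → Goal
          go [] eq = dropX₃ dropped [] (λ _ p _ → ⊥-elim (nope (subst (_ ∈_) eq p))) (λ ()) (indep-++ (indep ok) indep-[] (λ _ ()))
            where
            nope : ∀ {u} → u ∈ [] → ⊥
            nope ()
          go (v ∷ []) eq = removeP [] v [] [] eq (λ p a → ⊥-elim (Adj-irrefl (subst (Adj v) (∈-one (subst (_ ∈_) eq p)) a))) (λ ())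
            (indep-++ (λ i j → indep ok (∖⊆ i) (∖⊆ j)) indep-[] (λ _ ())) (λ ())
          go (v₁ ∷ v₂ ∷ P₂) eq = by (any? (_∈? X₂) P) (any? (_∈? X₃) (v₂ ∷ P₂)) (any? (adj? v₁) P₂)
            where
            v₁P' : v₁ ∈ P
            v₁P' = subst (v₁ ∈_) (sym eq) (here refl)
            v₂P' : v₂ ∈ P
            v₂P' = subst (v₂ ∈_) (sym eq) (there (here refl))
            2≢1 : v₂ ≢ v₁
            2≢1 = proj₂ (afterP [] eq (here refl))
            by : Dec (Any (_∈ X₂) P) → Dec (Any (_∈ X₃) (v₂ ∷ P₂)) → Dec (Any (Adj v₁) P₂) → Goal
            by (yes a) _ _ = let v , p , x = find a in other v p x (v ≟ v₁)
              where
              other : ∀ v → v ∈ P → v ∈ X₂ → Dec (v ≡ v₁) → Goal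
              other v p x (yes refl) = chordMiddle p v₂P' 2≢1 x
              other v p x (no ne) = chordMiddle p v₁P' (ne ∘ sym) x
            by _ (yes a) _ with find a
            ... | v , k , x with ∈-∃++ k
            ...   | Pm , Pb , e = chordLast (v₁ ∷ Pm) v Pb e' x (atP (v₁ ∷ Pm) e') (here refl) (P⊆A v₁P') (proj₂ (beforeP (v₁ ∷ Pm) e' (here refl)))
              where
              e' : P ≡ v₁ ∷ Pm ++ v ∷ Pb
              e' = trans eq (cong (v₁ ∷_) e)
            by _ _ (yes a) = let _ , k , 1v = find a in chordFrom [] v₁ v₂ eq k 1v
            by (no nx₂) (no nx₃) (no n₁) = by' (v₁ ∈? X₃) (v₁ ∈? I) (v₂ ∈? I) (adj? v₁ v₂)
              where
              f₂ : ∀ {u} → u ∈ P → u ∉ X₂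
              f₂ p x = nx₂ (lose p x)
              f₃ : ∀ {u} → u ∈ v₂ ∷ P₂ → u ∉ X₃
              f₃ p x = nx₃ (lose p x)
              f₁ : ∀ {u} → u ∈ P₂ → ¬ Adj v₁ u
              f₁ p a = n₁ (lose p a)
              drop₁ : v₁ ∉ I → ¬ (v₂ ∈ I × Adj v₁ v₂) → Goal
              drop₁ i₁ no12 = dropX₃ dropped [ v₁ ] XP (λ { (here refl) → v₁P' , i₁ })
                (indep-++ (indep ok) indep-[ v₁ ] (λ { i (here refl) a → far i (subst (_ ∈_) eq (I⊆P ok i)) (Adj-sym a) }))
                where
                XP : ∀ {u} → u ∈ A → u ∈ P → u ∈ X₃ → u ∈ [ v₁ ]
                XP _ p x with subst (_ ∈_) eq p
                ... | here q = here q
                ... | there k = ⊥-elim (f₃ k x)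
                far : ∀ {u} → u ∈ I → u ∈ v₁ ∷ v₂ ∷ P₂ → ¬ Adj v₁ u
                far i (here refl) a = Adj-irrefl a
                far i (there (here refl)) a = no12 (i , a)
                far i (there (there k)) a = f₁ k a
              by' : Dec (v₁ ∈ X₃) → Dec (v₁ ∈ I) → Dec (v₂ ∈ I) → Dec (Adj v₁ v₂) → Goal
              by' (no x₁) _ _ _ = dropX₃ dropped [] (λ _ p x → ⊥-elim (off (subst (_ ∈_) eq p) x)) (λ ()) (indep-++ (indep ok) indep-[] (λ _ ()))
                where
                off : ∀ {u} → u ∈ v₁ ∷ v₂ ∷ P₂ → u ∉ X₃
                off (here refl) = x₁
                off (there k) = f₃ k
              by' (yes _) (yes i₁) _ _ = caseB eq f₂ f₃ f₁ i₁
              by' (yes x₁) (no i₁) (yes i₂) (yes 12a) = caseC eq f₂ f₃ f₁ x₁ i₁ i₂ 12a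
              by' (yes _) (no i₁) (no i₂) _ = drop₁ i₁ (i₂ ∘ proj₁)
              by' (yes _) (no i₁) (yes _) (no a) = drop₁ i₁ (a ∘ proj₂)

-- The induction

module Main {n : ℕ} (G : Graph n) (everyRoot : ∀ u → Planar.Pl G (allFin n) (u ∷ [])) where
  open Discs G
  open Weak G
  open Planar G
  open Instances G
  open Ok

  -- The case analysis speaks of the order of `P`, so each remaining vertex keeps just one of its
  -- corners there and the others are hidden.
  record Reduced (A P : List V) : Set where
    field
      R : List V
      R⊆ : R ⊆ P
      uniq : Unique R
      inA : ∀ {u} → u ∈ R → u ∈ A
      kept : ∀ {u} → u ∈ A → u ∈ P → u ∈ R

  reduced : ∀ A P → Reduced A P
  reduced A [] = record { R = [] ; R⊆ = [] ; uniq = [] ; inA = λ () ; kept = λ _ () }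
  reduced A (p ∷ P) with reduced A P
  ... | r with p ∈? A | p ∈? Reduced.R r
  ...   | yes a | no fresh = record { R = p ∷ R ; R⊆ = refl ∷ R⊆ ; uniq = AllP.¬Any⇒All¬ R fresh ∷ uniq
          ; inA = λ { (here refl) → a ; (there i) → inA i } ; kept = λ { _ (here e) → here e ; a (there i) → there (kept a i) } }
          where open Reduced r
  ...   | yes a | yes old = record { R = R ; R⊆ = p ∷ʳ R⊆ ; uniq = uniq ; inA = inA
          ; kept = λ { _ (here refl) → old ; a (there i) → kept a i } }
          where open Reduced r
  ...   | no na | _ = record { R = R ; R⊆ = p ∷ʳ R⊆ ; uniq = uniq ; inA = inA
          ; kept = λ { a (here refl) → ⊥-elim (na a) ; a (there i) → kept a i } }
          where open Reduced r

  module _ {A : List V}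
    (IH : ∀ {A' X₁' X₂' X₃' P' I'} → length A' < length A → Ok A' X₁' X₂' X₃' P' I' → W A' (cost X₁' X₂' X₃' P' I'))
    where

    -- With no deleted vertex at hand, `v` is made one: its deletion shrinks the graph, and its
    -- neighbourhood is the new `X₃`.
    extend : ∀ {P I v w} → v ∈ A → Pl A (v ∷ w) → (∀ {u} → u ∈ I → u ∈ P) → (∀ {u v} → u ∈ I → v ∈ I → ¬ Adj u v) →
      (∀ {u} → u ∈ A → u ∈ P → u ≢ v → u ∈ w) → W A (cost [] [] [] P I)
    extend {P} {I} {v} {w} v∈ p I⊆P ind cov = go (deleteV v∈ p)
      where
      I' : List V
      I' = filter (_∈? w) I
      go : Single A v w → W A (cost [] [] [] P I)
      go record { Y = Y ; pl = plY ; exposed = ex } = remove v v∈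
        (λ {u} a ne → ≤-trans (≤-reflexive (s (ι u P) (ι u I) ⟦ adj? v u ⟧))
           (+-mono-≤ (+-mono-≤ (⟦⟧-mono (adj? v u) (u ∈? Y) (ex a)) (ι-mono P w (λ i → cov a i ne)))
             (ι-mono I I' (λ i → ∈-filter⁺ (_∈? w) i (cov a (I⊆P i) ne)))) , cost≤4 ok' (∖⁺ a ne))
        (IH (∖-shorter v∈) ok')
        where
        s : ∀ p i a → p + i + a ≡ a + p + i
        s = solve-∀
        I⁻ : ∀ {u} → u ∈ I' → u ∈ I × u ∈ w
        I⁻ = ∈-filter⁻ (_∈? w)
        ok' : Ok (A ∖ v) [] [] Y w I'
        ok' = record { pl = plY ; I⊆P = proj₂ ∘ I⁻ ; indep = λ i j → ind (proj₁ (I⁻ i)) (proj₁ (I⁻ j)) ; no3 = λ _ _ () }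

    noS : ∀ {P I} → Ok A [] [] [] P I → W A (cost [] [] [] P I)
    noS {P} {I} ok with any? (_∈? A) P
    ... | yes some with find some
    ...   | v , v∈P , v∈ with ∈-∃++ v∈P
    ...     | Pa , Pb , refl = extend {P} {I} v∈ (Pl-rot Pa (pl ok)) (I⊆P ok) (indep ok)
              (λ _ i ne → [ ∈-++⁺ʳ Pb , (λ { (here e) → ⊥-elim (ne e) ; (there k) → ∈-++⁺ˡ k }) ]′ (∈-++⁻ Pa i))
    noS {P} {I} ok | no none = go A refl
      where
      go : ∀ A' → A ≡ A' → W A (cost [] [] [] P I)
      go [] eq = done (λ i → nope (subst (_ ∈_) eq i))
        where
        nope : ∀ {u : V} → u ∈ [] → ⊥
        nope ()
      -- No vertex of `A` lies on the boundary, so all losses are zero and the drawing can be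
      -- exchanged for one of the whole graph with `v` on its boundary.
      go (v ∷ A') eq = extend {P} {I} {v} {[]} (subst (v ∈_) (sym eq) (here refl)) (Pl-sub (λ _ → ∈-allFin _) ⊆-refl (everyRoot v)) (I⊆P ok) (indep ok)
        (λ a i _ → ⊥-elim (none (lose i a)))

    withS : ∀ {X₁ X₂ X₃ P I} → (∀ {P' I'} → Ok A X₁ X₂ [] P' I' → W A (cost X₁ X₂ [] P' I')) →
      Ok A X₁ X₂ X₃ P I → W A (cost X₁ X₂ X₃ P I)
    withS {X₁} {X₂} {X₃} {P} {I} dropped ok = mono id id
      (λ {u} a → +-mono-≤ (+-monoʳ-≤ (ι u X₁ + ι u X₂ + ι u X₃) (ι-mono P R (kept a))) (ι-mono I I' (λ i → ∈-filter⁺ (_∈? A) i a)))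
      (Induction.Reduced.Cases.core ok' IH inA uniq dropped)
      where
      open Reduced (reduced A P)
      I' : List V
      I' = filter (_∈? A) I
      I⁻ : ∀ {u} → u ∈ I' → u ∈ I × u ∈ A
      I⁻ = ∈-filter⁻ (_∈? A)
      ok' : Ok A X₁ X₂ X₃ R I'
      ok' = record
        { pl = Pl-sub id (++⁺ (⊆-refl {x = X₁}) (++⁺ (⊆-refl {x = X₂}) (++⁺ (⊆-refl {x = X₃}) R⊆))) (pl ok)
        ; I⊆P = λ i → kept (proj₂ (I⁻ i)) (I⊆P ok (proj₁ (I⁻ i)))
        ; indep = λ i j → indep ok (proj₁ (I⁻ i)) (proj₁ (I⁻ j))
        ; no3 = λ a i → no3 ok a (proj₁ (I⁻ i)) }

    -- The empty segment moves from the third place to the first. The word stays the same, and the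
    -- next deleted vertex becomes the last one.
    shiftS : ∀ {X₁ X₂ P I} → (Ok A [] X₁ X₂ P I → W A (cost [] X₁ X₂ P I)) → Ok A X₁ X₂ [] P I → W A (cost X₁ X₂ [] P I)
    shiftS {X₁} {X₂} {P} {I} f ok = mono id id (λ {u} _ → ≤-reflexive (s (ι u X₁) (ι u X₂) (ι u P) (ι u I)))
      (f record { pl = pl ok ; I⊆P = I⊆P ok ; indep = indep ok ; no3 = λ _ _ () })
      where
      s : ∀ x y p i → x + y + 0 + p + i ≡ x + y + p + i
      s = solve-∀

    -- The nesting is the inner induction on the number of deleted vertices, from none to three, for
    -- a fixed vertex set.
    inductionStep : ∀ {X₁ X₂ X₃ P I} → Ok A X₁ X₂ X₃ P I → W A (cost X₁ X₂ X₃ P I)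
    inductionStep = withS (shiftS (withS (shiftS (withS noS))))

  degenerate : ∀ k {A X₁ X₂ X₃ P I} → length A < k → Ok A X₁ X₂ X₃ P I → W A (cost X₁ X₂ X₃ P I)
  degenerate (suc k) lt = inductionStep (λ lt' → degenerate k (≤-trans lt' (s≤s⁻¹ lt)))

  theorem : ∀ {A X₁ X₂ X₃ P I} → Ok A X₁ X₂ X₃ P I → W A (cost X₁ X₂ X₃ P I)
  theorem = degenerate _ ≤-refl

-- Connectivity and counting

T-∧ : ∀ {a b} → T a → T b → T (a ∧ b)
T-∧ {true} {true} _ _ = tt

T-∧ˡ : ∀ {a b} → T (a ∧ b) → T a
T-∧ˡ {true} _ = tt

T-∧ʳ : ∀ {a b} → T (a ∧ b) → T b
T-∧ʳ {true} t = t

T-∨ˡ : ∀ {a b} → T a → T (a ∨ b)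
T-∨ˡ {true} _ = tt

T-∨ʳ : ∀ {a b} → T b → T (a ∨ b)
T-∨ʳ {true} _ = tt
T-∨ʳ {false} t = t

T-∨⁻ : ∀ {a b} → T (a ∨ b) → T a ⊎ T b
T-∨⁻ {true} t = inj₁ t
T-∨⁻ {false} t = inj₂ t

does-≟ : ∀ {n} {u v : Fin n} → T (does (u ≟ v)) → u ≡ v
does-≟ {u = u} {v} t with u ≟ v
... | yes e = e

does-refl : ∀ {n} (u : Fin n) → T (does (u ≟ u))
does-refl u with u ≟ u
... | yes _ = tt
... | no ne = ne refl

anyV⁺ : ∀ {n} (p : Fin n → Bool) i → T (p i) → T (anyV p)
anyV⁺ p Fin.zero t = T-∨ˡ t
anyV⁺ p (Fin.suc i) t = T-∨ʳ {p Fin.zero} (anyV⁺ (λ i → p (Fin.suc i)) i t)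

anyV⁻ : ∀ {n} (p : Fin n → Bool) → T (anyV p) → ∃[ i ] T (p i)
anyV⁻ {suc n} p t with T-∨⁻ {p Fin.zero} t
... | inj₁ x = Fin.zero , x
... | inj₂ y = let i , z = anyV⁻ (λ i → p (Fin.suc i)) y in Fin.suc i , z

allBelow⁻ : ∀ {m p k} → T (allBelow m p) → k < m → T (p k)
allBelow⁻ {suc m} {p} {k} t lt with m≤n⇒m<n∨m≡n lt
... | inj₁ l = allBelow⁻ {m} (T-∧ˡ t) (s≤s⁻¹ l)
... | inj₂ refl = T-∧ʳ {allBelow m p} t

unique-⊆-length : ∀ {X : Set} {xs ys : List X} → Unique xs → (∀ {x} → x ∈ xs → x ∈ ys) → length xs ≤ length ys
unique-⊆-length {xs = []} _ _ = z≤n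
unique-⊆-length {xs = x ∷ xs} (px ∷ u) f with ∈-∃++ (f (here refl))
... | a , b , refl = ≤-trans (s≤s (unique-⊆-length u g)) (≤-reflexive (sym (trans (length-++ a) (trans (+-suc (length a) (length b)) (cong suc (sym (length-++ a)))))))
  where
  g : ∀ {y} → y ∈ xs → y ∈ a ++ b
  g {y} i with ∈-++⁻ a (f (there i))
  ... | inj₁ k = ∈-++⁺ˡ k
  ... | inj₂ (here refl) = ⊥-elim (All.lookup px i refl)
  ... | inj₂ (there k) = ∈-++⁺ʳ a k

cat : ∀ {m} {X : Set} → (Fin m → List X) → List X
cat {zero} f = []
cat {suc m} f = f Fin.zero ++ cat (λ i → f (Fin.suc i))

cat-length : ∀ {m} {X : Set} (f : Fin m → List X) → length (cat f) ≡ ∑ (λ i → length (f i))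
cat-length {zero} f = refl
cat-length {suc m} f = trans (length-++ (f Fin.zero)) (cong (λ z → length (f Fin.zero) + z) (cat-length (λ i → f (Fin.suc i))))

cat⁺ : ∀ {m} {X : Set} (f : Fin m → List X) i {x} → x ∈ f i → x ∈ cat f
cat⁺ f Fin.zero k = ∈-++⁺ˡ k
cat⁺ f (Fin.suc i) k = ∈-++⁺ʳ (f Fin.zero) (cat⁺ (λ i → f (Fin.suc i)) i k)

cat⁻ : ∀ {m} {X : Set} (f : Fin m → List X) {x} → x ∈ cat f → ∃[ i ] x ∈ f i
cat⁻ {suc m} f k with ∈-++⁻ (f Fin.zero) k
... | inj₁ j = Fin.zero , j
... | inj₂ j = let i , l = cat⁻ (λ i → f (Fin.suc i)) j in Fin.suc i , l

cat-unique : ∀ {m} {X : Set} (f : Fin m → List X) → (∀ i → Unique (f i)) → (∀ i j {x} → x ∈ f i → x ∈ f j → i ≡ j) → Unique (cat f)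
cat-unique {zero} f u d = []
cat-unique {suc m} f u d = UniqueP.++⁺ (u Fin.zero)
  (cat-unique (λ i → f (Fin.suc i)) (λ i → u (Fin.suc i)) (λ i j x y → FinP.suc-injective (d _ _ x y)))
  λ { (x , y) → let i , z = cat⁻ (λ i → f (Fin.suc i)) y in FinP.0≢1+n (d _ _ x z) }

∑-cong : ∀ {m} {f g : Fin m → ℕ} → (∀ i → f i ≡ g i) → ∑ f ≡ ∑ g
∑-cong {zero} e = refl
∑-cong {suc m} e = cong₂ _+_ (e Fin.zero) (∑-cong (λ i → e (Fin.suc i)))

module _ {n : ℕ} where

  single? : Bool → Fin n → List (Fin n)
  single? b i = if b then [ i ] else []

  -- The counts in Euler's formula are sums of indicators. Listing the counted objects without
  -- repetition turns bounds on the sums into inclusions of lists.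
  satisfying : (Fin n → Bool) → List (Fin n)
  satisfying p = cat (λ i → single? (p i) i)

  satisfying⁺ : ∀ {p i} → T (p i) → i ∈ satisfying p
  satisfying⁺ {p} {i} t = cat⁺ (λ i → single? (p i) i) i (go (p i) t)
    where
    go : ∀ b → T b → i ∈ single? b i
    go true _ = here refl

  single⁻ : ∀ b {i j} → i ∈ single? b j → i ≡ j × T b
  single⁻ true (here e) = e , tt

  satisfying⁻ : ∀ {p i} → i ∈ satisfying p → T (p i)
  satisfying⁻ {p} k with cat⁻ (λ i → single? (p i) i) k
  ... | j , l with single⁻ (p j) l
  ...   | refl , t = t

  satisfying-unique : ∀ p → Unique (satisfying p)
  satisfying-unique p = cat-unique _ (λ i → go (p i)) (λ i j x y → trans (sym (proj₁ (single⁻ (p i) x))) (proj₁ (single⁻ (p j) y)))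
    where
    go : ∀ b {i} → Unique (single? b i)
    go true = [] ∷ []
    go false = []

  satisfying-length : ∀ p → length (satisfying p) ≡ # p
  satisfying-length p = trans (cat-length (λ i → single? (p i) i)) (∑-cong (λ i → go (p i)))
    where
    go : ∀ b {i} → length (single? b i) ≡ (if b then 1 else 0)
    go true = refl
    go false = refl

  satisfying₂ : (Fin n → Fin n → Bool) → List (Fin n × Fin n)
  satisfying₂ p = cat (λ u → map (u ,_) (satisfying (p u)))

  satisfying₂⁺ : ∀ {p u v} → T (p u v) → (u , v) ∈ satisfying₂ p
  satisfying₂⁺ {p} {u} t = cat⁺ (λ u → map (u ,_) (satisfying (p u))) u (∈-map⁺ (u ,_) (satisfying⁺ t))

  satisfying₂⁻ : ∀ {p u v} → (u , v) ∈ satisfying₂ p → T (p u v)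
  satisfying₂⁻ {p} k with cat⁻ (λ u → map (u ,_) (satisfying (p u))) k
  ... | w , l with ∈-map⁻ (w ,_) l
  ...   | _ , m , refl = satisfying⁻ m

  satisfying₂-unique : ∀ p → Unique (satisfying₂ p)
  satisfying₂-unique p = cat-unique _ (λ u → UniqueP.map⁺ ,-injectiveʳ (satisfying-unique (p u)))
    λ u v x y → let _ , _ , e = ∈-map⁻ (u ,_) x ; _ , _ , e' = ∈-map⁻ (v ,_) y in trans (sym (cong proj₁ e)) (cong proj₁ e')

  satisfying₂-length : ∀ p → length (satisfying₂ p) ≡ #₂ p
  satisfying₂-length p = trans (cat-length (λ u → map (u ,_) (satisfying (p u)))) (∑-cong (λ u → trans (length-map (u ,_) (satisfying (p u))) (satisfying-length (p u))))

  #-≥ : ∀ {p xs} → Unique xs → (∀ {i} → i ∈ xs → T (p i)) → length xs ≤ # p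
  #-≥ {p} u f = ≤-trans (unique-⊆-length u (λ i → satisfying⁺ {p} (f i))) (≤-reflexive (satisfying-length p))

  #-≤ : ∀ {p xs} → (∀ {i} → T (p i) → i ∈ xs) → # p ≤ length xs
  #-≤ {p} f = ≤-trans (≤-reflexive (sym (satisfying-length p))) (unique-⊆-length (satisfying-unique p) (λ i → f (satisfying⁻ {p} i)))

  #₂-≥ : ∀ {p xs} → Unique xs → (∀ {u v} → (u , v) ∈ xs → T (p u v)) → length xs ≤ #₂ p
  #₂-≥ {p} u f = ≤-trans (unique-⊆-length u (λ i → satisfying₂⁺ {p} (f i))) (≤-reflexive (satisfying₂-length p))

  data Reach (E : Fin n → Fin n → Bool) (u : Fin n) : Fin n → Set where
    here : Reach E u u
    _▸_ : ∀ {w v} → Reach E u w → T (E w v) → Reach E u v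

  module _ (E : Fin n → Fin n → Bool) (u : Fin n) where

    reachB⇒Reach : ∀ k {v} → T (reachB E k u v) → Reach E u v
    reachB⇒Reach zero t = subst (Reach E u) (does-≟ t) here
    reachB⇒Reach (suc k) {v} t with T-∨⁻ {reachB E k u v} t
    ... | inj₁ x = reachB⇒Reach k x
    ... | inj₂ y = let w , z = anyV⁻ _ y in reachB⇒Reach k (T-∧ˡ z) ▸ T-∧ʳ {reachB E k u w} z

    reachB-suc : ∀ k {w v} → T (reachB E k u w) → T (E w v) → T (reachB E (suc k) u v)
    reachB-suc k {w} {v} t e = T-∨ʳ {reachB E k u v} (anyV⁺ (λ w → reachB E k u w ∧ E w v) w (T-∧ t e))

    Stable : ℕ → Set
    Stable k = ∀ {w v} → T (reachB E k u w) → T (E w v) → T (reachB E k u v)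

    stable-suc : ∀ k → Stable k → Stable (suc k)
    stable-suc k s t e = T-∨ˡ (s (back t) e)
      where
      back : ∀ {w} → T (reachB E (suc k) u w) → T (reachB E k u w)
      back {w} t with T-∨⁻ {reachB E k u w} t
      ... | inj₁ x = x
      ... | inj₂ y = let x , z = anyV⁻ _ y in s (T-∧ˡ z) (T-∧ʳ {reachB E k u x} z)

    decB : ∀ b → Dec (T b)
    decB true = yes tt
    decB false = no id

    -- Until it is stable, the set reached grows with every step.
    grow : ∀ k → Stable k ⊎ ∃[ xs ] (Unique xs × length xs ≡ suc k × (∀ {v} → v ∈ xs → T (reachB E k u v)))
    grow zero = inj₂ ([ u ] , [] ∷ [] , refl , λ { (here refl) → does-refl u })
    grow (suc k) with grow k
    ... | inj₁ s = inj₁ (stable-suc k s)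
    ... | inj₂ (xs , uq , len , inR) with any? (λ v → decB (fresh v)) (allFin n)
      where
      fresh : Fin n → Bool
      fresh v = reachB E (suc k) u v ∧ (if reachB E k u v then false else true)
    ...   | yes some = let v , _ , t = find some in inj₂ (v ∷ xs , AllP.¬Any⇒All¬ xs (λ i → not⁻ (T-∧ʳ {reachB E (suc k) u v} t) (inR i)) ∷ uq , cong suc len ,
              λ { (here refl) → T-∧ˡ t ; (there i) → T-∨ˡ (inR i) })
      where
      not⁻ : ∀ {b} → T (if b then false else true) → T b → ⊥
      not⁻ {true} () _
    ...   | no none = inj₁ (stable-suc k λ {w} {v} t e → old v (reachB-suc k t e))
      where
      not⁺ : ∀ {b} → ¬ T b → T (if b then false else true)
      not⁺ {true} f = f tt
      not⁺ {false} _ = tt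
      old : ∀ v → T (reachB E (suc k) u v) → T (reachB E k u v)
      old v t with decB (reachB E k u v)
      ... | yes x = x
      ... | no nx = ⊥-elim (none (lose (∈-allFin v) (T-∧ t (not⁺ nx))))

    -- If the reached set were still growing after `n` steps, it would have `n + 1` members.
    stable : Stable n
    stable with grow n
    ... | inj₁ s = s
    ... | inj₂ (xs , uq , len , _) = ⊥-elim (1+n≰n (≤-trans (≤-reflexive (sym len)) (≤-trans (unique-⊆-length uq (λ {x} _ → ∈-allFin x)) (≤-reflexive (length-tabulate id)))))

    reachB-refl : ∀ k → T (reachB E k u u)
    reachB-refl zero = does-refl u
    reachB-refl (suc k) = T-∨ˡ (reachB-refl k)

    Reach⇒connB : ∀ {v} → Reach E u v → T (connB E u v)
    Reach⇒connB here = reachB-refl n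
    Reach⇒connB (r ▸ e) = stable (Reach⇒connB r) e

    connB⇒Reach : ∀ {v} → T (connB E u v) → Reach E u v
    connB⇒Reach = reachB⇒Reach n

  Reach-trans : ∀ {E u v w} → Reach E u v → Reach E v w → Reach E u w
  Reach-trans r here = r
  Reach-trans r (s ▸ e) = Reach-trans r s ▸ e

  Reach-sym : ∀ {E} → (∀ {u v} → T (E u v) → T (E v u)) → ∀ {u v} → Reach E u v → Reach E v u
  Reach-sym f here = here
  Reach-sym f (r ▸ e) = Reach-trans (here ▸ f e) (Reach-sym f r)

-- Walks and their darts

module _ {X : Set} where

  darts : List X → List (X × X)
  darts [] = []
  darts (x ∷ []) = []
  darts (x ∷ y ∷ l) = (x , y) ∷ darts (y ∷ l)

  darts-++ : ∀ p {x q} → darts (p ++ x ∷ q) ≡ darts (p ++ [ x ]) ++ darts (x ∷ q)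
  darts-++ [] = refl
  darts-++ (y ∷ []) = refl
  darts-++ (y ∷ z ∷ p) = cong ((y , z) ∷_) (darts-++ (z ∷ p))

  darts-ends : ∀ {x y} l → (x , y) ∈ darts l → x ∈ l × y ∈ l
  darts-ends (a ∷ b ∷ l) (here refl) = here refl , there (here refl)
  darts-ends (a ∷ b ∷ l) (there i) = let p , q = darts-ends (b ∷ l) i in there p , there q

  darts-∃ : ∀ {x y} l → (x , y) ∈ darts l → ∃[ p ] ∃[ q ] l ≡ p ++ x ∷ y ∷ q
  darts-∃ (a ∷ b ∷ l) (here refl) = [] , l , refl
  darts-∃ (a ∷ b ∷ l) (there i) = let p , q , e = darts-∃ (b ∷ l) i in a ∷ p , q , cong (a ∷_) e

  darts-at : ∀ p {x y q} → (x , y) ∈ darts (p ++ x ∷ y ∷ q)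
  darts-at p {x} {y} {q} = subst ((x , y) ∈_) (sym (darts-++ p)) (∈-++⁺ʳ (darts (p ++ [ x ])) (here refl))

  darts-from : ∀ p {v w q y} → v ∉ p → v ∉ w ∷ q → (v , y) ∈ darts (p ++ v ∷ w ∷ q) → y ≡ w
  darts-from p {v} {w} {q} v∉p v∉q i with ∈-++⁻ (darts (p ++ [ v ])) (subst (_ ∈_) (darts-++ p) i)
  ... | inj₂ (here refl) = refl
  ... | inj₂ (there k) = ⊥-elim (v∉q (proj₁ (darts-ends (w ∷ q) k)))
  ... | inj₁ k = ⊥-elim (no-tail p v∉p k)
    where
    no-tail : ∀ p {v y} → v ∉ p → (v , y) ∈ darts (p ++ [ v ]) → ⊥
    no-tail (a ∷ []) v∉ (here refl) = v∉ (here refl)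
    no-tail (a ∷ b ∷ p) v∉ (here refl) = v∉ (here refl)
    no-tail (a ∷ b ∷ p) v∉ (there k) = no-tail (b ∷ p) (v∉ ∘ there) k

  data Ends (x : X) : List X → Set where
    end : Ends x [ x ]
    more : ∀ {y l} → Ends x l → Ends x (y ∷ l)

  Ends-++ : ∀ {x} p {l} → Ends x l → Ends x (p ++ l)
  Ends-++ [] e = e
  Ends-++ (y ∷ p) e = more (Ends-++ p e)

  Ends-suffix : ∀ {x} p {b c} → Ends x (p ++ b ∷ c) → Ends x (b ∷ c)
  Ends-suffix [] e = e
  Ends-suffix (y ∷ []) (more e) = e
  Ends-suffix (y ∷ z ∷ p) (more e) = Ends-suffix (z ∷ p) e

  Ends-∈ : ∀ {x l} → Ends x l → x ∈ l
  Ends-∈ end = here refl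
  Ends-∈ (more e) = there (Ends-∈ e)

-- Closed walks around trees

module Trees {n : ℕ} (G : Graph n) where
  open Discs G

  del : V → List V → List V
  del v [] = []
  del v (x ∷ l) with v ≟ x
  ... | yes _ = del v l
  ... | no _ = x ∷ del v l

  occ : V → List V → ℕ
  occ v [] = 0
  occ v (x ∷ l) with v ≟ x
  ... | yes _ = suc (occ v l)
  ... | no _ = occ v l

  occ+del : ∀ v l → occ v l + length (del v l) ≡ length l
  occ+del v [] = refl
  occ+del v (x ∷ l) with v ≟ x
  ... | yes _ = cong suc (occ+del v l)
  ... | no _ = trans (+-suc _ _) (cong suc (occ+del v l))

  occ-del : ∀ {u} v l → u ≢ v → occ u (del v l) ≡ occ u l
  occ-del v [] ne = refl
  occ-del {u} v (x ∷ l) ne with v ≟ x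
  ... | yes refl with u ≟ x
  ...   | yes e = ⊥-elim (ne e)
  ...   | no _ = occ-del v l ne
  occ-del {u} v (x ∷ l) ne | no _ with u ≟ x
  ...   | yes _ = cong suc (occ-del v l ne)
  ...   | no _ = occ-del v l ne

  occ-pos : ∀ {v l} → v ∈ l → 1 ≤ occ v l
  occ-pos {v} {x ∷ l} i with v ≟ x
  ... | yes _ = s≤s z≤n
  occ-pos (here e) | no ne = ⊥-elim (ne e)
  occ-pos (there i) | no _ = occ-pos i

  occ-once : ∀ {v} l → occ v l ≡ 1 → ∃[ p ] ∃[ q ] (l ≡ p ++ v ∷ q × v ∉ p × v ∉ q)
  occ-once {v} (x ∷ l) e with v ≟ x
  ... | yes refl = [] , l , refl , (λ ()) , λ i → 1+n≰n (≤-trans (occ-pos i) (≤-reflexive (cong ℕ.pred e)))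
  ... | no ne = let p , q , e' , a , b = occ-once l e in x ∷ p , q , cong (x ∷_) e' , (λ { (here r) → ne r ; (there i) → a i }) , b

  twice : ∀ {U} W → Unique U → (∀ {v} → v ∈ U → 2 ≤ occ v W) → length U + length U ≤ length W
  twice {[]} W _ f = z≤n
  twice {v ∷ U} W (px ∷ u) f = ≤-trans (≤-reflexive (cong suc (+-suc (length U) (length U))))
    (≤-trans (+-mono-≤ (f (here refl)) (twice (del v W) u λ {w} i → ≤-trans (f (there i)) (≤-reflexive (sym (occ-del v W (λ { refl → All.lookup px i refl }))))))
             (≤-reflexive (occ+del v W)))

  onceIn : ∀ {U} W → Unique U → (∀ {v} → v ∈ U → v ∈ W) → length W < length U + length U → ∃[ v ] (v ∈ U × occ v W ≡ 1)
  onceIn {U} W u f lt with any? (λ v → occ v W ℕ.≟ 1) U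
  ... | yes some = find some
  ... | no none = ⊥-elim (1+n≰n (≤-trans lt (twice W u λ i → ≥2 (occ-pos (f i)) (λ e → none (lose i e)))))
    where
    ≥2 : ∀ {k} → 1 ≤ k → k ≢ 1 → 2 ≤ k
    ≥2 {suc zero} _ ne = ⊥-elim (ne refl)
    ≥2 {suc (suc k)} _ _ = s≤s (s≤s z≤n)

  record Drawn (W : List V) : Set where
    field
      A : List V
      E : List (V × V)
      disc : Disc A E W
      A⊆ : ∀ {v} → v ∈ A → v ∈ W
      E⊇ : ∀ {x y} → (x , y) ∈ darts W → (x , y) ∈ E ⊎ (y , x) ∈ E

  -- A closed walk that traverses every edge in both directions, and visits more
  -- than |W| / 2 vertices, goes around a tree: a vertex visited once is a leaf.
  tree : ∀ k {x₀ W l U} → W ≡ x₀ ∷ l → Ends x₀ W → Unique U → (∀ {v} → v ∈ U → v ∈ W) → length W < length U + length U →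
         (∀ {x y} → (x , y) ∈ darts W → (y , x) ∈ darts W) → (∀ {x y} → (x , y) ∈ darts W → Adj x y) → length W ≤ k → Drawn W
  tree k {x₀} {W} {[]} refl e u f lt s a len = record { A = [ x₀ ] ; E = [] ; disc = new x₀ ; A⊆ = id ; E⊇ = λ () }
  tree zero {l = _ ∷ _} refl _ _ _ _ _ _ ()
  tree (suc k) {x₀} {W} {y ∷ l} {U} eq e u f lt s a len with onceIn W u f lt
  ... | v , vU , o with occ-once W o
  ...   | p , q , eqW , v∉p , v∉q with initLast p
  -- The first vertex of a walk with at least one step is also its last, so it is visited twice.
  tree (suc k) {x₀} eq e u f lt s a len | v , vU , o | .[] , q , refl , _ , v∉q | [] with eq | e
  ... | refl | more e' = ⊥-elim (v∉q (Ends-∈ e'))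
  tree (suc k) {x₀} eq e u f lt s a len | v , vU , o | .(p' ++ [ t ]) , [] , refl , v∉p , _ | p' ∷ʳ′ t with Ends-suffix (p' ++ [ t ]) e
  ... | end = ⊥-elim (v∉p (first p' eq))
    where
    first : ∀ p' {t r l} → (p' ++ [ t ]) ++ r ≡ v ∷ l → v ∈ p' ++ [ t ]
    first [] refl = here refl
    first (x ∷ p') refl = here refl
  tree (suc k) {x₀} {U = U} eq e u f lt s a len | v , vU , o | .(p' ++ [ t ]) , w ∷ q , refl , v∉p , v∉q | p' ∷ʳ′ t = by-eq peq
    where
    W≡ : (p' ++ [ t ]) ++ v ∷ w ∷ q ≡ p' ++ t ∷ v ∷ w ∷ q
    W≡ = ++-assoc p' [ t ] (v ∷ w ∷ q)
    -- Being visited once, `v` is left by a single dart, towards `w`; the reverse of the dart that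
    -- enters it from `t` must be this one.
    peq : t ≡ w
    peq = darts-from (p' ++ [ t ]) v∉p v∉q (s (subst (λ z → (t , v) ∈ darts z) (sym W≡) (darts-at p')))
    by-eq : t ≡ w → Drawn ((p' ++ [ t ]) ++ v ∷ w ∷ q)
    by-eq refl = finish rec
      where
      W' : List V
      W' = p' ++ t ∷ q
      dW : darts ((p' ++ [ t ]) ++ v ∷ t ∷ q) ≡ darts (p' ++ [ t ]) ++ (t , v) ∷ (v , t) ∷ darts (t ∷ q)
      dW = trans (cong darts W≡) (darts-++ p')
      dW' : darts W' ≡ darts (p' ++ [ t ]) ++ darts (t ∷ q)
      dW' = darts-++ p'
      v∉W' : v ∉ W'
      v∉W' i with ∈-++⁻ p' i
      ... | inj₁ j = v∉p (∈-++⁺ˡ j)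
      ... | inj₂ (here refl) = v∉p (∈-insert p')
      ... | inj₂ (there j) = v∉q (there j)
      up : ∀ {d} → d ∈ darts W' → d ∈ darts ((p' ++ [ t ]) ++ v ∷ t ∷ q)
      up i with ∈-++⁻ (darts (p' ++ [ t ])) (subst (_ ∈_) dW' i)
      ... | inj₁ j = subst (_ ∈_) (sym dW) (∈-++⁺ˡ j)
      ... | inj₂ j = subst (_ ∈_) (sym dW) (∈-++⁺ʳ (darts (p' ++ [ t ])) (there (there j)))
      down : ∀ {x y} → (x , y) ∈ darts ((p' ++ [ t ]) ++ v ∷ t ∷ q) → (x , y) ∈ darts W' ⊎ (x , y) ≡ (t , v) ⊎ (x , y) ≡ (v , t)
      down i with ∈-++⁻ (darts (p' ++ [ t ])) (subst (_ ∈_) dW i)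
      ... | inj₁ j = inj₁ (subst (_ ∈_) (sym dW') (∈-++⁺ˡ j))
      ... | inj₂ (here e) = inj₂ (inj₁ e)
      ... | inj₂ (there (here e)) = inj₂ (inj₂ e)
      ... | inj₂ (there (there j)) = inj₁ (subst (_ ∈_) (sym dW') (∈-++⁺ʳ (darts (p' ++ [ t ])) j))
      s' : ∀ {x y} → (x , y) ∈ darts W' → (y , x) ∈ darts W'
      s' i with down (s (up i))
      ... | inj₁ j = j
      ... | inj₂ (inj₁ refl) = ⊥-elim (v∉W' (proj₁ (darts-ends W' i)))
      ... | inj₂ (inj₂ refl) = ⊥-elim (v∉W' (proj₂ (darts-ends W' i)))
      start : ∃[ l' ] W' ≡ x₀ ∷ l'
      start = go p' eq
        where
        go : ∀ p' {l} → (p' ++ [ t ]) ++ v ∷ t ∷ q ≡ x₀ ∷ l → ∃[ l' ] p' ++ t ∷ q ≡ x₀ ∷ l'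
        go [] refl = _ , refl
        go (z ∷ p') refl = _ , refl
      U∖ = del v U
      del-∈ : ∀ {z} L → z ∈ del v L → z ∈ L × z ≢ v
      del-∈ (x ∷ L) i with v ≟ x
      ... | yes refl = let p , q = del-∈ L i in there p , q
      del-∈ (x ∷ L) (here refl) | no ne = here refl , ne ∘ sym
      del-∈ (x ∷ L) (there i) | no ne = let p , q = del-∈ L i in there p , q
      del-unique : ∀ {L} → Unique L → Unique (del v L)
      del-unique [] = []
      del-unique {x ∷ L} (px ∷ uL) with v ≟ x
      ... | yes _ = del-unique uL
      ... | no _ = All.tabulate (λ i → All.lookup px (proj₁ (del-∈ L i))) ∷ del-unique uL
      occ-unique : ∀ {L} → Unique L → occ v L ≤ 1
      occ-unique [] = z≤n
      occ-unique {x ∷ L} (px ∷ uL) with v ≟ x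
      ... | no _ = occ-unique uL
      ... | yes refl = s≤s (none (λ i → All.lookup px i refl))
        where
        none : ∀ {L} → v ∉ L → occ v L ≤ 0
        none {[]} _ = z≤n
        none {x ∷ L} ni with v ≟ x
        ... | yes refl = ⊥-elim (ni (here refl))
        ... | no _ = none (ni ∘ there)
      U∖⊆ : ∀ {z} → z ∈ U∖ → z ∈ W'
      U∖⊆ i with del-∈ U i
      ... | j , ne with ∈-++⁻ (p' ++ [ t ]) (f j)
      ...   | inj₂ (here e) = ⊥-elim (ne e)
      ...   | inj₂ (there (here refl)) = ∈-insert p'
      ...   | inj₂ (there (there k)) = ∈-++⁺ʳ p' (there k)
      ...   | inj₁ k with ∈-++⁻ p' k
      ...     | inj₁ l = ∈-++⁺ˡ l
      ...     | inj₂ (here refl) = ∈-insert p'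
      lenW : length ((p' ++ [ t ]) ++ v ∷ t ∷ q) ≡ 2 + length W'
      lenW = trans (cong length W≡) (trans (length-++ p') (trans (+-suc (length p') _) (cong suc (trans (+-suc (length p') _) (cong suc (sym (length-++ p')))))))
      -- The walk loses two letters and `U` at most one vertex, which preserves the bound.
      lt' : length W' < length U∖ + length U∖
      lt' = s≤s⁻¹ (s≤s⁻¹ (≤-trans (s≤s (≤-reflexive (sym lenW))) (≤-trans lt (≤-trans (+-mono-≤ lenU lenU) (≤-reflexive (cong suc (+-suc _ _)))))))
        where
        lenU : length U ≤ suc (length U∖)
        lenU = ≤-trans (≤-reflexive (sym (occ+del v U))) (+-mono-≤ (occ-unique u) ≤-refl)
      rec : Drawn W'
      rec = tree k (proj₂ start) (Ends-++ p' (Ends-suffix (p' ++ t ∷ [ v ]) (subst (Ends x₀) (sym (trans (++-assoc p' (t ∷ [ v ]) (t ∷ q)) (sym W≡))) e)))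
              (del-unique u) U∖⊆ lt' s' (a ∘ up) (≤-trans (n≤1+n _) (s≤s⁻¹ (≤-trans (≤-reflexive (sym lenW)) len)))
      finish : Drawn W' → Drawn ((p' ++ [ t ]) ++ v ∷ t ∷ q)
      finish record { A = A ; E = E ; disc = D ; A⊆ = A⊆ ; E⊇ = E⊇ } = record
        { A = A ++ [ v ] ; E = (t , v) ∷ (E ++ [])
        -- In the drawing for the shorter walk the corner `t` is doubled, the leaf `v` is placed
        -- between the copies, and the edge is drawn along the new boundary.
        ; disc = subst (Disc _ _) (sym W≡) (at p' {t ∷ [ v ]} {t ∷ [ v ]} (edge tv) (subst (Disc _ _) W≡
                   (insert (p' ++ [ t ]) (subst (Disc A E) (sym (++-assoc p' [ t ] (t ∷ q))) (at p' {[ t ]} {t ∷ [ t ]} dup D)) (new v) (λ { i (here refl) → v∉W' (A⊆ i) }))))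
        ; A⊆ = A⊆' ; E⊇ = E⊇' }
        where
        tv : Adj t v
        tv = a (subst ((t , v) ∈_) (sym dW) (∈-++⁺ʳ (darts (p' ++ [ t ])) (here refl)))
        A⊆' : ∀ {z} → z ∈ A ++ [ v ] → z ∈ (p' ++ [ t ]) ++ v ∷ t ∷ q
        A⊆' i with ∈-++⁻ A i
        ... | inj₂ (here refl) = ∈-insert (p' ++ [ t ])
        ... | inj₁ j with ∈-++⁻ p' (A⊆ j)
        ...   | inj₁ k = ∈-++⁺ˡ (∈-++⁺ˡ k)
        ...   | inj₂ (here refl) = ∈-++⁺ˡ (∈-insert p')
        ...   | inj₂ (there k) = ∈-++⁺ʳ (p' ++ [ t ]) (there (there k))
        E⊇' : ∀ {x y} → (x , y) ∈ darts ((p' ++ [ t ]) ++ v ∷ t ∷ q) → (x , y) ∈ (t , v) ∷ (E ++ []) ⊎ (y , x) ∈ (t , v) ∷ (E ++ [])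
        E⊇' i with down i
        ... | inj₁ j = Sum.map (there ∘ ∈-++⁺ˡ) (there ∘ ∈-++⁺ˡ) (E⊇ j)
        ... | inj₂ (inj₁ refl) = inj₁ (here refl)
        ... | inj₂ (inj₂ refl) = inj₂ (here refl)

-- Faces of a rotation system

module _ {X : Set} (f : X → X) where

  iter-+ : ∀ m k x → iter f (m + k) x ≡ iter f m (iter f k x)
  iter-+ zero k x = refl
  iter-+ (suc m) k x = cong f (iter-+ m k x)

  iter-* : ∀ p j x → iter f p x ≡ x → iter f (j * p) x ≡ x
  iter-* p zero x e = refl
  iter-* p (suc j) x e = trans (iter-+ p (j * p) x) (trans (cong (iter f p) (iter-* p j x e)) e)

  -- `N + 1 = (k + 1) * (l + 1)` is a common multiple of the two periods, so the same power of `f`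
  -- leads from `f a` back to `a` and from `f b` back to `b`.
  cycle-injective : ∀ {a b} k l → f a ≡ f b → iter f k (f a) ≡ a → iter f l (f b) ≡ b → a ≡ b
  cycle-injective {a} {b} k l e p q = trans (sym p') (trans (cong (λ z → iter f N z) e) q')
    where
    N : ℕ
    N = k + suc k * l
    comm : ∀ k l → k + suc k * l ≡ l + suc l * k
    comm = solve-∀
    per : ∀ {c} k l → iter f k (f c) ≡ c → iter f (k + l * suc k) (f c) ≡ c
    per {c} k l p = trans (iter-+ k (l * suc k) (f c)) (trans (cong (iter f k) (iter-* (suc k) l (f c) (cong f p))) p)
    p' : iter f N (f a) ≡ a
    p' = trans (cong (λ z → iter f (k + z) (f a)) (*-comm (suc k) l)) (per k l p)
    q' : iter f N (f b) ≡ b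
    q' = trans (cong (λ z → iter f z (f b)) (trans (comm k l) (cong (λ z → l + z) (*-comm (suc l) k)))) (per l k q)

least : ∀ {P : ℕ → Set} → (∀ k → Dec (P k)) → ∀ k → P k → ∃[ m ] (m ≤ k × P m × (∀ j → j < m → ¬ P j))
least {P} P? k pk = subst (λ z → ∃[ m ] (m ≤ z × P m × (∀ j → j < m → ¬ P j))) (+-identityʳ k)
  (go k zero (λ _ ()) (subst P (sym (+-identityʳ k)) pk))
  where
  go : ∀ d m → (∀ j → j < m → ¬ P j) → P (d + m) → ∃[ m' ] (m' ≤ d + m × P m' × (∀ j → j < m' → ¬ P j))
  go zero m lo p = m , ≤-refl , p , lo
  go (suc d) m lo p with P? m
  ... | yes q = m , m≤n+m m (suc d) , q , lo
  ... | no nq with go d (suc m) (λ j lt → [ (λ l → lo j l) , (λ { refl → nq }) ]′ (m≤n⇒m<n∨m≡n (s≤s⁻¹ lt))) (subst P (sym (+-suc d m)) p)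
  ...   | m' , le , q , lo' = m' , ≤-trans le (≤-reflexive (+-suc d m)) , q , lo'

module _ {X : Set} where

  darts-applyUpTo : ∀ (f : ℕ → X × X) k → (∀ i → proj₁ (f (suc i)) ≡ proj₂ (f i)) →
    darts (applyUpTo (proj₁ ∘ f) k ++ [ proj₁ (f k) ]) ≡ applyUpTo f k
  darts-applyUpTo f zero e = refl
  darts-applyUpTo f (suc zero) e = cong (λ z → (proj₁ (f 0) , z) ∷ []) (e 0)
  darts-applyUpTo f (suc (suc k)) e = cong₂ _∷_ (cong (proj₁ (f 0) ,_) (e 0)) (darts-applyUpTo (f ∘ suc) (suc k) (e ∘ suc))

  darts-length : ∀ (x : X) l → length (darts (x ∷ l)) ≡ length l
  darts-length x [] = refl
  darts-length x (y ∷ l) = cong suc (darts-length y l)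

module Faces {n : ℕ} (G : PlaneGraph n) where
  open PlaneGraph G using (graph; adj; rot; rot-adj; rot-cyc; euler)
  open Discs graph hiding (rot)

  Dart : Set
  Dart = V × V

  IsDart : Dart → Set
  IsDart (u , v) = Adj u v

  flip : Dart → Dart
  flip (u , v) = v , u

  Φ : Dart → Dart
  Φ = φ graph rot

  rep : Dart → Bool
  rep (u , v) = orbitRep graph rot u v

  Φ-dart : ∀ {d} → IsDart d → IsDart (Φ d)
  Φ-dart {u , v} a = rot-adj v u (Adj-sym a)

  iter-dart : ∀ k {d} → IsDart d → IsDart (iter Φ k d)
  iter-dart zero a = a
  iter-dart (suc k) a = Φ-dart (iter-dart k a)

  -- The second vertex of the dart is visible in its image. The first one is recovered because the
  -- rotation there is cyclic on the neighbours, hence injective.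
  Φ-injective : ∀ {d e} → IsDart d → IsDart e → Φ d ≡ Φ e → d ≡ e
  Φ-injective {u , v} {u' , v'} a b eq with cong proj₁ eq
  ... | refl = cong (_, v) (cycle-injective (rot v) (proj₁ p) (proj₁ q) (cong proj₂ eq) (proj₂ p) (proj₂ q))
    where
    p = rot-cyc v (rot v u) u (rot-adj v u (Adj-sym a)) (Adj-sym a)
    q = rot-cyc v (rot v u') u' (rot-adj v u' (Adj-sym b)) (Adj-sym b)

  unwind : ∀ {d} → IsDart d → ∀ i j → iter Φ i d ≡ iter Φ (i + j) d → d ≡ iter Φ j d
  unwind a zero j e = e
  unwind a (suc i) j e = unwind a i j (Φ-injective (iter-dart i a) (iter-dart (i + j) a) e)

  _≟ᵈ_ : (d e : Dart) → Dec (d ≡ e)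
  _≟ᵈ_ = ≡-dec _≟_ _≟_

  open import Data.List.Membership.DecPropositional _≟ᵈ_ using () renaming (_∈?_ to _∈ᵈ?_)

  record Orbit (d : Dart) : Set where
    field
      k : ℕ
      closed : iter Φ (suc k) d ≡ d
      bound : suc k ≤ n * n
      minimal : ∀ j → j < k → iter Φ (suc j) d ≢ d

  -- Among `n * n + 1` iterates two coincide. By injectivity the coincidence unwinds to a return to
  -- `d`, of which the least is taken.
  orbit : ∀ {d} → IsDart d → Orbit d
  orbit {d} a = go (FinP.pigeonhole (n<1+n (n * n)) (λ i → let u , v = iter Φ (toℕ i) d in combine u v))
    where
    go : (∃[ i ] ∃[ j ] (i Fin.< j × combine (proj₁ (iter Φ (toℕ i) d)) (proj₂ (iter Φ (toℕ i) d)) ≡ combine (proj₁ (iter Φ (toℕ j) d)) (proj₂ (iter Φ (toℕ j) d)))) → Orbit d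
    go (i , j , lt , e) = record { k = proj₁ l ; closed = proj₁ (proj₂ (proj₂ l)) ; bound = ≤-trans (s≤s (proj₁ (proj₂ l))) bnd ; minimal = proj₂ (proj₂ (proj₂ l)) }
      where
      q : ℕ
      q = toℕ j ∸ suc (toℕ i)
      qe : q + suc (toℕ i) ≡ toℕ j
      qe = m∸n+n≡m lt
      qe' : toℕ i + suc q ≡ toℕ j
      qe' = trans (+-suc (toℕ i) q) (trans (cong suc (+-comm (toℕ i) q)) (trans (sym (+-suc q (toℕ i))) qe))
      same : iter Φ (toℕ i) d ≡ iter Φ (toℕ j) d
      same = let x , y = FinP.combine-injective _ _ _ _ e in cong₂ _,_ x y
      ret : iter Φ (suc q) d ≡ d
      ret = sym (unwind a (toℕ i) (suc q) (trans same (cong (λ z → iter Φ z d) (sym qe'))))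
      bnd : suc q ≤ n * n
      bnd = ≤-trans (≤-trans (m≤n+m (suc q) (toℕ i)) (≤-reflexive qe')) (s≤s⁻¹ (FinP.toℕ<n j))
      l = least (λ k → iter Φ (suc k) d ≟ᵈ d) q ret

  code-injective : ∀ d e → code graph rot d ≡ code graph rot e → d ≡ e
  code-injective (u , v) (u' , v') e = cong₂ _,_ (proj₁ both) (proj₂ both)
    where
    both : u ≡ u' × v ≡ v'
    both = FinP.combine-injective u v u' v' (FinP.toℕ-injective
      (trans (FinP.toℕ-combine u v) (trans (cong (_+ toℕ v) (*-comm n (toℕ u)))
        (trans e (trans (cong (_+ toℕ v') (*-comm (toℕ u') n)) (sym (FinP.toℕ-combine u' v')))))))

  module _ {d : Dart} (a : IsDart d) (o : Orbit d) where
    open Orbit o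

    face : List Dart
    face = applyUpTo (λ i → iter Φ i d) (suc k)

    face-unique : Unique face
    face-unique = UniqueP.applyUpTo⁺₁ _ (suc k) λ {i} {j} i<j j<k e →
      let q = j ∸ suc i
          qe : i + suc q ≡ j
          qe = trans (+-suc i q) (trans (cong suc (+-comm i q)) (trans (sym (+-suc q i)) (m∸n+n≡m i<j)))
      in minimal q (s≤s⁻¹ (≤-trans (s≤s (≤-trans (m≤n+m (suc q) i) (≤-reflexive qe))) j<k)) (sym (unwind a i (suc q) (trans e (cong (λ z → iter Φ z d) (sym qe)))))

    face-Φ : ∀ {e} → e ∈ face → Φ e ∈ face
    face-Φ i with ∈-applyUpTo⁻ (λ i → iter Φ i d) i
    ... | j , lt , refl with m≤n⇒m<n∨m≡n lt
    ...   | inj₁ l = ∈-applyUpTo⁺ (λ i → iter Φ i d) l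
    ...   | inj₂ refl = subst (_∈ face) (sym closed) (here refl)

    face-dart : ∀ {e} → e ∈ face → IsDart e
    face-dart i with ∈-applyUpTo⁻ (λ i → iter Φ i d) i
    ... | j , _ , refl = iter-dart j a

    face-iter : ∀ {e} → e ∈ face → ∃[ j ] iter Φ j e ≡ d
    face-iter i with ∈-applyUpTo⁻ (λ i → iter Φ i d) i
    ... | j , lt , refl = suc k ∸ j , trans (sym (iter-+ Φ (suc k ∸ j) j d)) (trans (cong (λ z → iter Φ z d) (m∸n+n≡m (<⇒≤ lt))) closed)

    within : ∀ {e e'} → e ∈ face → e' ∈ face → ∃[ m ] (m < n * n × iter Φ m e ≡ e')
    within x y with ∈-applyUpTo⁻ (λ i → iter Φ i d) x | ∈-applyUpTo⁻ (λ i → iter Φ i d) y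
    ... | i , li , refl | j , lj , refl with i ≤? j
    ...   | yes le = j ∸ i , <-≤-trans (≤-<-trans (m∸n≤m j i) lj) bound , trans (sym (iter-+ Φ (j ∸ i) i d)) (cong (λ z → iter Φ z d) (m∸n+n≡m le))
    ...   | no nle = j + (suc k ∸ i) , <-≤-trans (≤-trans (+-monoˡ-< (suc k ∸ i) (≰⇒> nle)) (≤-reflexive (trans (+-comm i (suc k ∸ i)) (m∸n+n≡m (<⇒≤ li))))) bound ,
            trans (sym (iter-+ Φ (j + (suc k ∸ i)) i d)) (trans (cong (λ z → iter Φ z d) (trans (+-assoc j (suc k ∸ i) i) (cong (λ z → j + z) (m∸n+n≡m (<⇒≤ li)))))
              (trans (iter-+ Φ j (suc k) d) (cong (iter Φ j) closed)))

    -- Both have the least code of the face. The comparison is available because each is reached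
    -- from the other within the `n * n` iterates that `orbitRep` inspects; this is the purpose of
    -- the bound on the orbit.
    face-rep : ∀ {e e'} → e ∈ face → e' ∈ face → T (rep e) → T (rep e') → e ≡ e'
    face-rep {e} {e'} x y r r' = code-injective e e' (≤-antisym (le r (within x y)) (le r' (within y x)))
      where
      le : ∀ {e e'} → T (rep e) → ∃[ m ] (m < n * n × iter Φ m e ≡ e') → code graph rot e ≤ code graph rot e'
      le {u , v} r (m , lt , refl) = ≤ᵇ⇒≤ _ _ (allBelow⁻ {n * n} r lt)

Unique-↭ : ∀ {X : Set} {xs ys : List X} → xs ↭ ys → Unique xs → Unique ys
Unique-↭ p = PermS.Unique-resp-↭ (setoid _) (↭⇒↭ₛ p)

-- Merging the faces of a component

module Components {n : ℕ} (G : PlaneGraph n) (r s : Fin n) (rs : T (PlaneGraph.adj G r s)) where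
  open PlaneGraph G using (graph; adj; rot; rot-adj; rot-cyc; euler)
  open Discs graph hiding (rot)
  open Planar graph using (hideSub)
  open Trees graph
  open Faces G
  open import Data.List.Membership.DecPropositional _≟ᵈ_ using () renaming (_∈?_ to _∈ᵈ?_)

  C : V → Set
  C v = T (connB adj r v)

  C-adj : ∀ {u v} → C u → Adj u v → C v
  C-adj c a = Reach⇒connB adj r (connB⇒Reach adj r c ▸ a)

  -- The faces met so far have been merged into one by deleting the edges in Del;
  -- W is the boundary walk of the merged face.
  record State (W : List V) (Del : List Dart) (m : ℕ) : Set where
    L : List Dart
    L = darts W ++ Del
    field
      {x₀} : V
      {l} : List V
      starts : W ≡ x₀ ∷ l
      ends : Ends x₀ W
      uniq : Unique L
      Φ-closed : ∀ {d} → d ∈ L → Φ d ∈ L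
      isDart : ∀ {d} → d ∈ L → IsDart d
      inC : ∀ {v} → v ∈ W → C v
      del-sym : ∀ {d} → d ∈ Del → flip d ∈ Del
      del-W : ∀ {d} → d ∈ Del → proj₁ d ∈ W
      del-length : length Del ≡ m + m
      -- A face has at most one representative, and each of the `m` deleted edges has brought in one
      -- face besides the first. This becomes the upper bound on the number of faces.
      reps : ∀ {xs} → Unique xs → (∀ {d} → d ∈ xs → d ∈ L × T (rep d)) → length xs ≤ suc m
      seed : Dart
      seed∈ : seed ∈ L

  record Result (W : List V) (Del : List Dart) : Set where
    field
      A : List V
      E : List Dart
      disc : Disc A E W
      A⊆ : ∀ {v} → v ∈ A → C v
      A⊇ : ∀ {v} → C v → v ∈ A
      full : ∀ {u v} → C u → Adj u v → ((u , v) ∈ E ⊎ (v , u) ∈ E) ⊎ (u , v) ∈ Del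

  module Final {W Del m} (S : State W Del m) (done : ∀ {d} → d ∈ darts W → flip d ∈ State.L S) where
    open State S

    flip-closed : ∀ {d} → d ∈ L → flip d ∈ L
    flip-closed i with ∈-++⁻ (darts W) i
    ... | inj₁ j = done j
    ... | inj₂ j = ∈-++⁺ʳ (darts W) (del-sym j)

    AllAt : V → Set
    AllAt v = ∀ {y} → Adj v y → (v , y) ∈ L

    -- `Φ (x , v)` is `(v , rot v x)`. So closure under reversal and under face tracing gives
    -- closure under the rotation at `v`, which reaches every neighbour.
    allAt : ∀ {v x} → (v , x) ∈ L → AllAt v
    allAt {v} {x} i {y} a = let k , e = rot-cyc v x y (isDart i) a in subst (λ z → (v , z) ∈ L) e (go k)
      where
      go : ∀ k → (v , iter (rot v) k x) ∈ L
      go zero = i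
      go (suc k) = Φ-closed (flip-closed (go k))

    at-seed : AllAt (proj₁ seed)
    at-seed = allAt seed∈

    C-seed : C (proj₁ seed)
    C-seed = inC ([ (λ j → proj₁ (darts-ends W j)) , del-W ]′ (∈-++⁻ (darts W) seed∈))

    everywhere : ∀ {v} → Reach adj (proj₁ seed) v → AllAt v × ∃[ y ] (v , y) ∈ L
    everywhere here = at-seed , proj₂ seed , seed∈
    everywhere (_▸_ {w} {v} p a) = let i = flip-closed (proj₁ (everywhere p) a) in allAt i , w , i

    from-seed : ∀ {v} → C v → Reach adj (proj₁ seed) v
    from-seed c = Reach-trans (Reach-sym Adj-sym (connB⇒Reach adj r C-seed)) (connB⇒Reach adj r c)

    all : ∀ {u v} → C u → Adj u v → (u , v) ∈ L
    all c = proj₁ (everywhere (from-seed c))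

    C⊆W : ∀ {v} → C v → v ∈ W
    C⊆W c with everywhere (from-seed c)
    ... | _ , y , i = [ (λ j → proj₁ (darts-ends W j)) , del-W ]′ (∈-++⁻ (darts W) i)

    L-C : ∀ {u v} → (u , v) ∈ L → C u
    L-C i = inC ([ (λ j → proj₁ (darts-ends W j)) , del-W ]′ (∈-++⁻ (darts W) i))

    faces≤ : Fc graph rot r ≤ suc m
    faces≤ = ≤-trans (≤-reflexive (sym (satisfying₂-length p))) (reps (satisfying₂-unique p) λ {d} i →
        let t = satisfying₂⁻ {p = p} i in all (T-∧ˡ t) (T-∧ˡ (T-∧ʳ {connB adj r (proj₁ d)} t)) , T-∧ʳ {adj (proj₁ d) (proj₂ d)} (T-∧ʳ {connB adj r (proj₁ d)} t))
      where
      p : V → V → Bool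
      p u v = connB adj r u ∧ adj u v ∧ orbitRep graph rot u v

    darts≤ : length (darts W) + (m + m) ≤ Dc graph rot r
    darts≤ = ≤-trans (≤-reflexive (sym (trans (length-++ (darts W)) (cong (λ z → length (darts W) + z) del-length))))
      (#₂-≥ uniq λ i → T-∧ (L-C i) (isDart i))

    U : List V
    U = satisfying (connB adj r)

    -- Euler's formula leaves |C| - 1 edges.
    short : length W < length U + length U
    short = subst₂' (satisfying-length (connB adj r)) (+-cancelʳ-≤ (suc (suc (m + m))) _ _ (begin
        suc (length W) + suc (suc (m + m)) ≡⟨ cong (λ z → suc z + suc (suc (m + m))) lenW ⟩
        suc (suc (length (darts W))) + suc (suc (m + m)) ≡⟨ s1 (length (darts W)) m ⟩
        (length (darts W) + (m + m)) + 4 ≤⟨ +-mono-≤ darts≤ (≤-refl {4}) ⟩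
        Dc graph rot r + 4 ≡⟨ sym (euler r s rs) ⟩
        2 * Vc graph rot r + 2 * Fc graph rot r ≤⟨ +-monoʳ-≤ (2 * Vc graph rot r) (+-mono-≤ faces≤ (+-mono-≤ faces≤ z≤n)) ⟩
        2 * Vc graph rot r + (suc m + (suc m + 0)) ≡⟨ s2 (Vc graph rot r) m ⟩
        (Vc graph rot r + Vc graph rot r) + suc (suc (m + m)) ∎))
      where
      open Data.Nat.Properties.≤-Reasoning
      subst₂' : ∀ {a b : ℕ} → a ≡ b → suc (length W) ≤ b + b → suc (length W) ≤ a + a
      subst₂' refl p = p
      lenW : length W ≡ suc (length (darts W))
      lenW = trans (cong length starts) (cong suc (sym (trans (cong (length ∘ darts) starts) (darts-length x₀ l))))
      s1 : ∀ d m → suc (suc d) + suc (suc (m + m)) ≡ (d + (m + m)) + 4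
      s1 = solve-∀
      s2 : ∀ v m → 2 * v + (suc m + (suc m + 0)) ≡ (v + v) + suc (suc (m + m))
      s2 = solve-∀

    -- `Del` is symmetric and disjoint from the darts of `W`, so the reverse of a dart of `W` cannot
    -- lie in it.
    back : ∀ {x y} → (x , y) ∈ darts W → (y , x) ∈ darts W
    back {x} {y} i with ∈-++⁻ (darts W) (done i)
    ... | inj₁ j = j
    ... | inj₂ j = ⊥-elim (clash (darts W) uniq i (del-sym j))
      where
      clash : ∀ (xs : List Dart) {ys d} → Unique (xs ++ ys) → d ∈ xs → d ∉ ys
      clash (x ∷ xs) (px ∷ u) (here refl) j = All.lookup px (∈-++⁺ʳ xs j) refl
      clash (x ∷ xs) (px ∷ u) (there i) j = clash xs u i j

    result : Result W Del
    result with tree (length W) starts ends (satisfying-unique (connB adj r)) (λ i → C⊆W (satisfying⁻ i)) short back (λ i → isDart (∈-++⁺ˡ i)) ≤-refl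
    ... | record { A = A ; E = E ; disc = D ; A⊆ = A⊆ ; E⊇ = E⊇ } = record
      { A = A ; E = E ; disc = D ; A⊆ = inC ∘ A⊆ ; A⊇ = λ c → word⊆ D (C⊆W c)
      ; full = λ c a → Sum.map E⊇ id (∈-++⁻ (darts W) (all c a)) }

  -- Deleting the edge ab replaces it in W by the rest of the face on its other side.
  module Merge {W Del m} (S : State W Del m) {a b : V} (p q : List V) (eq : W ≡ p ++ a ∷ b ∷ q) (fresh : (b , a) ∉ State.L S) where
    open State S

    ab∈ : (a , b) ∈ darts W
    ab∈ = subst (λ w → (a , b) ∈ darts w) (sym eq) (darts-at p)

    ba : IsDart (b , a)
    ba = Adj-sym (isDart (∈-++⁺ˡ ab∈))

    module _ (o : Orbit (b , a)) where
      open Orbit o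

      f : ℕ → Dart
      f i = iter Φ i (b , a)

      O : List Dart
      O = face ba o

      -- `f 0` is `(b , a)` and `f 1` starts at `a`, so the vertices of the face strictly between
      -- `a` and `b` are the starts of `f 2` up to `f k`.
      ys : List V
      ys = applyUpTo (proj₁ ∘ f ∘ suc ∘ suc) (ℕ.pred k)

      F D₁ D₂ : List Dart
      F = applyUpTo (f ∘ suc) k
      D₁ = darts (p ++ [ a ])
      D₂ = darts (b ∷ q)

      -- A face with a single dart would be a loop.
      k>0 : ∃[ k' ] k ≡ suc k'
      k>0 = go k closed
        where
        go : ∀ k → iter Φ (suc k) (b , a) ≡ (b , a) → ∃[ k' ] k ≡ suc k'
        go zero e = ⊥-elim (Adj-irrefl (subst (λ z → Adj z a) (sym (cong proj₁ e)) ba))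
        go (suc k) _ = k , refl

      W' : List V
      W' = p ++ a ∷ ys ++ b ∷ q

      inner : darts ((a ∷ ys) ++ [ b ]) ≡ F
      inner = go k k>0 closed
        where
        go : ∀ k → (∃[ k' ] k ≡ suc k') → iter Φ (suc k) (b , a) ≡ (b , a) →
             darts ((a ∷ applyUpTo (proj₁ ∘ f ∘ suc ∘ suc) (ℕ.pred k)) ++ [ b ]) ≡ applyUpTo (f ∘ suc) k
        go (suc k') _ e = trans (cong (λ z → darts ((a ∷ applyUpTo (proj₁ ∘ f ∘ suc ∘ suc) k') ++ [ z ])) (sym (cong proj₁ e)))
                                (darts-applyUpTo (f ∘ suc) (suc k') (λ i → refl))

      dW : darts W ≡ D₁ ++ (a , b) ∷ D₂
      dW = trans (cong darts eq) (darts-++ p)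

      dW' : darts W' ≡ D₁ ++ F ++ D₂
      dW' = trans (darts-++ p) (cong (D₁ ++_) (trans (darts-++ (a ∷ ys)) (cong (_++ D₂) inner)))

      Del' : List Dart
      Del' = (a , b) ∷ (b , a) ∷ Del

      -- Counted in darts, merging adds exactly the new face: `(a , b)` passes from the walk to
      -- `Del`, and so does `(b , a)` from the new face.
      perm : darts W' ++ Del' ↭ O ++ L
      perm = ↭-trans (↭-reflexive (trans (cong (_++ Del') dW') (trans (++-assoc D₁ (F ++ D₂) Del') (cong (D₁ ++_) (++-assoc F D₂ Del')))))
        (↭-trans (shifts D₁ F) (↭-trans (++⁺ˡ F (++⁺ˡ D₁ move)) (↭-trans (++⁺ˡ F (shift (b , a) D₁ _)) (↭-trans (shift (b , a) F _)
          (↭-reflexive (cong (λ z → (b , a) ∷ F ++ z) (trans (sym (++-assoc D₁ ((a , b) ∷ D₂) Del)) (cong (_++ Del) (sym dW)))))))))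
        where
        move : D₂ ++ Del' ↭ (b , a) ∷ (a , b) ∷ D₂ ++ Del
        move = ↭-trans (shift (a , b) D₂ _) (↭-trans (prep (a , b) (shift (b , a) D₂ Del)) (_↭_.swap (a , b) (b , a) ↭-refl))

      disjoint : ∀ {d} → d ∈ O → d ∉ L
      disjoint i j = let t , e = face-iter ba o i in fresh (subst (_∈ L) e (go t j))
        where
        go : ∀ t {d} → d ∈ L → iter Φ t d ∈ L
        go zero j = j
        go (suc t) j = Φ-closed (go t j)

      L' : List Dart
      L' = darts W' ++ Del'

      split : ∀ {d} → d ∈ L' → d ∈ O ⊎ d ∈ L
      split i = ∈-++⁻ O (∈-resp-↭ perm i)

      fromO : ∀ {d} → d ∈ O → d ∈ L'
      fromO i = ∈-resp-↭ (↭-sym perm) (∈-++⁺ˡ i)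

      fromL : ∀ {d} → d ∈ L → d ∈ L'
      fromL i = ∈-resp-↭ (↭-sym perm) (∈-++⁺ʳ O i)

      W⊆ : ∀ {v} → v ∈ W → v ∈ W'
      W⊆ i with ∈-++⁻ p (subst (_ ∈_) eq i)
      ... | inj₁ j = ∈-++⁺ˡ j
      ... | inj₂ (here e) = ∈-++⁺ʳ p (here e)
      ... | inj₂ (there j) = ∈-++⁺ʳ p (there (∈-++⁺ʳ ys j))

      a∈W : a ∈ W
      a∈W = proj₁ (darts-ends W ab∈)

      b∈W : b ∈ W
      b∈W = proj₂ (darts-ends W ab∈)

      orbit-C : ∀ i → C (proj₁ (f i)) × Adj (proj₁ (f i)) (proj₂ (f i))
      orbit-C zero = inC b∈W , ba
      orbit-C (suc i) = let c , d = orbit-C i in C-adj c d , Φ-dart d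

      ys-C : ∀ {v} → v ∈ ys → C v
      ys-C i with ∈-applyUpTo⁻ (proj₁ ∘ f ∘ suc ∘ suc) i
      ... | j , _ , refl = proj₁ (orbit-C (suc (suc j)))

      -- The new face contributes at most one representative; without it the old bound applies.
      reps' : ∀ {xs} → Unique xs → (∀ {d} → d ∈ xs → d ∈ L' × T (rep d)) → length xs ≤ suc (suc m)
      reps' {xs} u g with any? (_∈ᵈ? O) xs
      ... | no none = ≤-trans (reps u (λ i → [ (λ o → ⊥-elim (none (lose i o))) , id ]′ (split (proj₁ (g i))) , proj₂ (g i))) (n≤1+n _)
      ... | yes some with find some
      ...   | e , e∈ , e∈O with ∈-∃++ e∈
      ...     | ys , zs , refl = ≤-trans (≤-reflexive (↭-length (shift e ys zs))) (s≤s (reps (rest u') λ {d} i →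
                  [ (λ o' → ⊥-elim (apart u' i (face-rep ba o e∈O o' (proj₂ (g e∈)) (proj₂ (g (back i)))))) , id ]′ (split (proj₁ (g (back i)))) , proj₂ (g (back i))))
        where
        u' : Unique (e ∷ ys ++ zs)
        u' = Unique-↭ (shift e ys zs) u
        rest : ∀ {x : Dart} {xs} → Unique (x ∷ xs) → Unique xs
        rest (_ ∷ u) = u
        apart : ∀ {x : Dart} {xs y} → Unique (x ∷ xs) → y ∈ xs → x ≢ y
        apart (px ∷ _) i = All.lookup px i
        back : ∀ {d} → d ∈ ys ++ zs → d ∈ ys ++ e ∷ zs
        back i = ∈-resp-↭ (↭-sym (shift e ys zs)) (there i)

      state : State W' Del' (suc m)
      state = record
        { starts = proj₂ st ; ends = ends'
        ; uniq = Unique-↭ (↭-sym perm) (UniqueP.++⁺ (face-unique ba o) uniq (λ (i , j) → disjoint i j))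
        ; Φ-closed = λ i → [ fromO ∘ face-Φ ba o , fromL ∘ Φ-closed ]′ (split i)
        ; isDart = λ i → [ face-dart ba o , isDart ]′ (split i)
        ; inC = λ i → inC' i
        ; del-sym = λ { (here refl) → there (here refl) ; (there (here refl)) → here refl ; (there (there i)) → there (there (del-sym i)) }
        ; del-W = λ { (here refl) → W⊆ a∈W ; (there (here refl)) → W⊆ b∈W ; (there (there i)) → W⊆ (del-W i) }
        ; del-length = cong suc (trans (cong suc del-length) (sym (+-suc m m)))
        ; reps = reps' ; seed = seed ; seed∈ = fromL seed∈ }
        where
        st : ∃[ l' ] W' ≡ x₀ ∷ l'
        st = go p (trans (sym eq) starts)
          where
          go : ∀ p {l} → p ++ a ∷ b ∷ q ≡ x₀ ∷ l → ∃[ l' ] p ++ a ∷ ys ++ b ∷ q ≡ x₀ ∷ l'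
          go [] refl = _ , refl
          go (z ∷ p) refl = _ , refl
        ends' : Ends x₀ W'
        ends' = Ends-++ p (more (Ends-++ ys (Ends-suffix (p ++ [ a ]) (subst (Ends x₀) (trans eq (sym (++-assoc p [ a ] (b ∷ q)))) ends))))
        inC' : ∀ {v} → v ∈ W' → C v
        inC' i with ∈-++⁻ p i
        ... | inj₁ j = inC (subst (_ ∈_) (sym eq) (∈-++⁺ˡ j))
        ... | inj₂ (here refl) = inC a∈W
        ... | inj₂ (there j) with ∈-++⁻ ys j
        ...   | inj₁ k = ys-C k
        ...   | inj₂ k = inC (subst (_ ∈_) (sym eq) (∈-++⁺ʳ p (there k)))

      longer : length (State.L S) < length L'
      longer = ≤-trans (s≤s (m≤n+m (length L) (length F))) (≤-reflexive (sym (trans (↭-length perm) (length-++ O))))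

      -- Undoes the merge in the drawing: hiding `ys` makes the corners `a` and `b` consecutive, and
      -- the deleted edge is drawn between them.
      restore : Result W' Del' → Result W Del
      restore record { A = A ; E = E ; disc = D ; A⊆ = A⊆ ; A⊇ = A⊇ ; full = full } = record
        { A = A ; E = (a , b) ∷ E
        ; disc = subst (Disc A _) (sym eq) (at p {a ∷ [ b ]} {a ∷ [ b ]} (edge (Adj-sym ba)) (subst (Disc A E) (++-assoc p [ a ] (b ∷ q))
            (hideSub (p ++ [ a ]) (⊆-++⁺ˡ ys ⊆-refl) (subst (Disc A E) (sym (++-assoc p [ a ] (ys ++ b ∷ q))) D))))
        ; A⊆ = A⊆ ; A⊇ = A⊇
        ; full = λ c e → fix (full c e) }
        where
        fix : ∀ {u v} → ((u , v) ∈ E ⊎ (v , u) ∈ E) ⊎ (u , v) ∈ Del' → ((u , v) ∈ (a , b) ∷ E ⊎ (v , u) ∈ (a , b) ∷ E) ⊎ (u , v) ∈ Del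
        fix (inj₁ e) = inj₁ (Sum.map there there e)
        fix (inj₂ (here refl)) = inj₁ (inj₁ (here refl))
        fix (inj₂ (there (here refl))) = inj₁ (inj₂ (here refl))
        fix (inj₂ (there (there i))) = inj₂ i

  -- `L` consists of distinct darts of the component and grows with each merge, so `fuel` bounds the
  -- number of merges still possible.
  merge : ∀ fuel {W Del m} (S : State W Del m) → Dc graph rot r < length (State.L S) + fuel → Result W Del
  merge fuel {W} S lt with any? (λ d → ¬? (flip d ∈ᵈ? State.L S)) (darts W)
  merge fuel {W} S lt | no none = Final.result S λ {d} i → dec (flip d ∈ᵈ? State.L S) (λ ne → none (lose i ne))
    where
    dec : ∀ {d} → Dec (d ∈ State.L S) → ¬ (d ∉ State.L S) → d ∈ State.L S
    dec (yes i) _ = i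
    dec (no ne) k = ⊥-elim (k ne)
  merge zero {W} S lt | yes some = ⊥-elim (1+n≰n (≤-trans lt (≤-trans (≤-reflexive (+-identityʳ _)) (#₂-≥ (State.uniq S) λ i → T-∧ (c i) (State.isDart S i)))))
    where
    c : ∀ {d} → d ∈ State.L S → C (proj₁ d)
    c i = State.inC S ([ (λ j → proj₁ (darts-ends W j)) , State.del-W S ]′ (∈-++⁻ (darts W) i))
  merge (suc fuel) {W} S lt | yes some with find some
  ... | (a , b) , i , fresh with darts-∃ W i
  ...   | p , q , eq = restore o (merge fuel (state o) (≤-trans lt (≤-trans (≤-reflexive (+-suc _ fuel)) (+-mono-≤ (longer o) ≤-refl))))
    where
    open Merge S p q eq fresh
    o = orbit ba

  outerWalk : ∀ {a b} → Adj a b → Orbit (a , b) → List V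
  outerWalk {a} {b} _ o = applyUpTo (λ i → proj₁ (iter Φ i (a , b))) (suc (Orbit.k o)) ++ [ a ]

  -- The process starts from the face of one dart and all merges are undone in the end, so the
  -- boundary word is the walk around that face. The choice of the dart is the choice of the outer
  -- face.
  component : ∀ {a b} (ca : C a) (ab : Adj a b) (o : Orbit (a , b)) → Result (outerWalk ab o) []
  component {a} {b} ca ab o = merge (suc (Dc graph rot r)) start (≤-trans (s≤s (m≤n+m _ _)) (≤-reflexive (sym (+-suc _ _))))
    where
    open Orbit o
    f : ℕ → Dart
    f i = iter Φ i (a , b)
    dW : darts (outerWalk ab o) ≡ face ab o
    dW = trans (cong (λ z → darts (applyUpTo (proj₁ ∘ f) (suc k) ++ [ z ])) (sym (cong proj₁ closed))) (darts-applyUpTo f (suc k) (λ i → refl))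
    L≡ : darts (outerWalk ab o) ++ [] ≡ face ab o
    L≡ = trans (Data.List.Properties.++-identityʳ _) dW
    toF : ∀ {d} → d ∈ darts (outerWalk ab o) ++ [] → d ∈ face ab o
    toF = subst (_ ∈_) L≡
    orbit-C : ∀ i → C (proj₁ (f i)) × Adj (proj₁ (f i)) (proj₂ (f i))
    orbit-C zero = ca , ab
    orbit-C (suc i) = let c , d = orbit-C i in C-adj c d , Φ-dart d
    start : State (outerWalk ab o) [] 0
    start = record
      { starts = refl ; ends = Ends-++ (applyUpTo (proj₁ ∘ f) (suc k)) end
      ; uniq = subst Unique (sym L≡) (face-unique ab o)
      ; Φ-closed = λ i → subst (_ ∈_) (sym L≡) (face-Φ ab o (toF i))
      ; isDart = λ i → face-dart ab o (toF i)
      ; inC = λ i → inC' (∈-++⁻ (applyUpTo (proj₁ ∘ f) (suc k)) i)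
      ; del-sym = λ () ; del-W = λ () ; del-length = refl
      ; reps = reps'
      ; seed = (a , b) ; seed∈ = subst (_ ∈_) (sym L≡) (here refl) }
      where
      inC' : ∀ {v} → v ∈ applyUpTo (proj₁ ∘ f) (suc k) ⊎ v ∈ [ a ] → C v
      inC' (inj₂ (here refl)) = ca
      inC' (inj₁ j) with ∈-applyUpTo⁻ (proj₁ ∘ f) j
      ... | t , _ , refl = proj₁ (orbit-C t)
      reps' : ∀ {xs} → Unique xs → (∀ {d} → d ∈ xs → d ∈ darts (outerWalk ab o) ++ [] × T (rep d)) → length xs ≤ 1
      reps' {[]} _ _ = z≤n
      reps' {x ∷ []} _ _ = ≤-refl
      reps' {x ∷ y ∷ xs} ((ne ∷ _) ∷ _) g = ⊥-elim (ne (face-rep ab o (toF (proj₁ (g (here refl)))) (toF (proj₁ (g (there (here refl)))))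
        (proj₂ (g (here refl))) (proj₂ (g (there (here refl))))))

module _ {X : Set} where

  darts-infix : ∀ p {w q} {d : X × X} → d ∈ darts w → d ∈ darts (p ++ w ++ q)
  darts-infix p {w} {q} i with darts-∃ w i
  ... | a , b , refl = subst (λ z → _ ∈ darts z) eq (darts-at (p ++ a))
    where
    eq : (p ++ a) ++ _ ∷ _ ∷ (b ++ q) ≡ p ++ (a ++ _ ∷ _ ∷ b) ++ q
    eq = trans (++-assoc p a _) (cong (p ++_) (sym (++-assoc a _ q)))

first-step : ∀ {n} {E : Fin n → Fin n → Bool} {u v} → Reach E u v → u ≡ v ⊎ ∃[ x ] T (E u x)
first-step here = inj₁ refl
first-step (_▸_ {v = v} r e) with first-step r
... | inj₁ refl = inj₂ (v , e)
... | inj₂ x = inj₂ x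

-- Drawings of the whole graph

module Whole {n : ℕ} (G : PlaneGraph n) where
  open PlaneGraph G using (graph; adj; rot; outerDart; outerIso; outerDart-adj; outerDart-φ; outerDart-one; outerIso-iso; ∂V)
  open Discs graph hiding (rot)
  open Weak graph
  open Planar graph
  open Faces G

  Conn : V → V → Set
  Conn u v = T (connB adj u v)

  conn-trans : ∀ {u v w} → Conn u v → Conn v w → Conn u w
  conn-trans {u} {v} p q = Reach⇒connB adj u (Reach-trans (connB⇒Reach adj u p) (connB⇒Reach adj v q))

  conn-sym : ∀ {u v} → Conn u v → Conn v u
  conn-sym {u} {v} p = Reach⇒connB adj v (Reach-sym Adj-sym (connB⇒Reach adj u p))

  conn-refl : ∀ {u} → Conn u u
  conn-refl {u} = Reach⇒connB adj u here

  record Comp (r : V) : Set where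
    field
      A w : List V
      E : List (V × V)
      disc : Disc A E w
      A⊆ : ∀ {v} → v ∈ A → Conn r v
      A⊇ : ∀ {v} → Conn r v → v ∈ A
      full : ∀ {u v} → Conn r u → Adj u v → (u , v) ∈ E ⊎ (v , u) ∈ E

  rooted : ∀ {r s} → Adj r s → ∀ {a b} → Conn r a → Adj a b → Comp r
  rooted {r} {s} rs ca ab = record { disc = disc ; A⊆ = A⊆ ; A⊇ = A⊇ ; full = λ c e → [ id , (λ ()) ]′ (full c e) }
    where
    open Components G r s rs
    open Result (component ca ab (orbit ab))

  rooted-darts : ∀ {r s} (rs : Adj r s) {a b} (ca : Conn r a) (ab : Adj a b) k → iter Φ k (a , b) ∈ darts (Comp.w (rooted rs ca ab))
  rooted-darts {r} {s} rs {a} {b} ca ab k = subst (_ ∈_) (sym dW) (go k)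
    where
    o = orbit ab
    dW : darts (Components.outerWalk G r s rs ab o) ≡ face ab o
    dW = trans (cong (λ z → darts (applyUpTo (λ i → proj₁ (iter Φ i (a , b))) (suc (Orbit.k o)) ++ [ z ])) (sym (cong proj₁ (Orbit.closed o))))
           (darts-applyUpTo (λ i → iter Φ i (a , b)) (suc (Orbit.k o)) (λ i → refl))
    go : ∀ k → iter Φ k (a , b) ∈ face ab o
    go zero = here refl
    go (suc k) = face-Φ ab o (go k)

  isolated-only : ∀ {r} → ¬ (∃[ s ] Adj r s) → ∀ {v} → Conn r v → r ≡ v
  isolated-only {r} none c with first-step (connB⇒Reach adj r c)
  ... | inj₁ e = e
  ... | inj₂ x = ⊥-elim (none x)

  isolated-comp : ∀ {r} → ¬ (∃[ s ] Adj r s) → Comp r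
  isolated-comp {r} none = record { A = [ r ] ; w = [ r ] ; E = [] ; disc = new r
    ; A⊆ = λ { (here refl) → conn-refl } ; A⊇ = λ c → here (sym (isolated-only none c))
    ; full = λ c e → ⊥-elim (none (_ , subst (λ z → Adj z _) (sym (isolated-only none c)) e)) }

  record Union (cd : ∀ r → Comp r) (rs : List V) : Set where
    field
      A w : List V
      E : List (V × V)
      disc : Disc A E w
      covers : ∀ {v} → v ∈ rs → v ∈ A
      closed : ∀ {u v} → u ∈ A → Conn u v → v ∈ A
      full : ∀ {u v} → u ∈ A → Adj u v → (u , v) ∈ E ⊎ (v , u) ∈ E
      parts : ∀ {v} → v ∈ A → ∃[ r ] (Conn r v × ∃[ p ] ∃[ q ] w ≡ p ++ Comp.w (cd r) ++ q)

  -- The components are drawn side by side, even those nested in a face of another one. Each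
  -- component keeps its word as an unbroken stretch, recorded in `parts`, so that consecutive
  -- letters stay consecutive.
  union : (cd : ∀ r → Comp r) → ∀ rs → Union cd rs
  union cd [] = record { disc = nil ; covers = λ () ; closed = λ () ; full = λ () ; parts = λ () }
  union cd (r ∷ rs) = go (union cd rs)
    where
    go : Union cd rs → Union cd (r ∷ rs)
    go U with r ∈? Union.A U
    ... | yes i = record { disc = disc ; covers = λ { (here refl) → i ; (there j) → covers j } ; closed = closed ; full = full ; parts = parts }
      where open Union U
    ... | no ni = record
      { disc = uni Cr.disc disc (λ i j → ni (closed j (conn-sym (Cr.A⊆ i))))
      ; covers = λ { (here refl) → ∈-++⁺ˡ (Cr.A⊇ conn-refl) ; (there j) → ∈-++⁺ʳ Cr.A (covers j) }
      ; closed = λ i c → [ (λ j → ∈-++⁺ˡ (Cr.A⊇ (conn-trans (Cr.A⊆ j) c))) , (λ j → ∈-++⁺ʳ Cr.A (closed j c)) ]′ (∈-++⁻ Cr.A i)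
      ; full = λ i a → [ (λ j → Sum.map ∈-++⁺ˡ ∈-++⁺ˡ (Cr.full (Cr.A⊆ j) a)) , (λ j → Sum.map (∈-++⁺ʳ Cr.E) (∈-++⁺ʳ Cr.E) (full j a)) ]′ (∈-++⁻ Cr.A i)
      ; parts = λ i → [ (λ j → r , Cr.A⊆ j , [] , w , refl) ,
                        (λ j → let r' , c , p , q , e = parts j in r' , c , Cr.w ++ p , q , trans (cong (Cr.w ++_) e) (sym (++-assoc Cr.w p _))) ]′ (∈-++⁻ Cr.A i) }
      where
      open Union U
      module Cr = Comp (cd r)

  toPl : ∀ {cd} (U : Union cd (allFin n)) → Pl (allFin n) (Union.w U)
  toPl U = record { disc = hideSub [] (filter-⊆ (_∈? allFin n) w) disc ; alive = covers ; full = λ i _ a → full (covers i) a }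
    where open Union U

  hasNbr? : ∀ r → Dec (∃[ s ] Adj r s)
  hasNbr? r with any? (λ s → adj? r s) (allFin n)
  ... | yes some = let s , _ , a = find some in yes (s , a)
  ... | no none = no λ (s , a) → none (lose (∈-allFin s) a)

  -- In the component of `u`, the face of a dart leaving `u` is taken as the outer face, which
  -- brings `u` to the boundary.
  rootAt : V → ∀ r → Comp r
  rootAt u r with hasNbr? r
  ... | no none = isolated-comp none
  ... | yes (s , rs) with decT (connB adj r u) | hasNbr? u
  ...   | yes c | yes (y , uy) = rooted rs c uy
  ...   | _ | _ = rooted rs conn-refl rs

  rootAt-∈ : ∀ u r → Conn r u → u ∈ Comp.w (rootAt u r)
  rootAt-∈ u r c with hasNbr? r
  ... | no none = here (sym (isolated-only none c))
  ... | yes (s , rs) with decT (connB adj r u) | hasNbr? u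
  ...   | yes _ | yes (y , uy) = here refl
  ...   | no nc | _ = ⊥-elim (nc c)
  ...   | yes _ | no none = ⊥-elim (none (s , subst (λ z → Adj z s) (sym (isolated-only none (conn-sym c))) rs))

  everyRoot : ∀ u → Pl (allFin n) (u ∷ [])
  everyRoot u with union (rootAt u) (allFin n)
  ... | U with Union.parts U (Union.covers U (∈-allFin u))
  ...   | r , c , p , q , e = Pl-sub id (from∈ (subst (u ∈_) (sym e) (∈-++⁺ʳ p (∈-++⁺ˡ (rootAt-∈ u r c))))) (toPl U)

  outerIn? : ∀ r → Dec (∃[ a ] ∃[ b ] (Conn r a × T (outerDart a b)))
  outerIn? r with any? (λ a → decT (connB adj r a ∧ anyV (outerDart a))) (allFin n)
  ... | yes some = let a , _ , t = find some ; b , o = anyV⁻ (outerDart a) (T-∧ʳ {connB adj r a} t) in yes (a , b , T-∧ˡ t , o)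
  ... | no none = no λ (a , b , c , o) → none (lose (∈-allFin a) (T-∧ c (anyV⁺ (outerDart a) b o)))

  outer : ∀ r → Comp r
  outer r with hasNbr? r
  ... | no none = isolated-comp none
  ... | yes (s , rs) with outerIn? r
  ...   | yes (a , b , c , o) = rooted rs c (outerDart-adj a b o)
  ...   | no _ = rooted rs conn-refl rs

  -- By `outerDart-one` the outer darts of a component form a single orbit, so tracing the face of
  -- the chosen one meets all of them.
  outer-darts : ∀ r {u v} → Conn r u → T (outerDart u v) → (u , v) ∈ darts (Comp.w (outer r))
  outer-darts r {u} {v} c o with hasNbr? r
  ... | no none = ⊥-elim (none (v , subst (λ z → Adj z v) (sym (isolated-only none c)) (outerDart-adj u v o)))
  ... | yes (s , rs) with outerIn? r
  ...   | no ni = ⊥-elim (ni (u , v , c , o))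
  ...   | yes (a , b , ca , oab) with outerDart-one a b u v oab o (conn-trans (conn-sym ca) c)
  ...     | k , e = subst (_∈ darts (Comp.w (rooted rs ca (outerDart-adj a b oab)))) e (rooted-darts rs ca (outerDart-adj a b oab) k)

  outer-iso : ∀ r {v} → Conn r v → T (outerIso v) → v ∈ Comp.w (outer r)
  outer-iso r {v} c t with hasNbr? r
  ... | no none = here (sym (isolated-only none c))
  ... | yes (s , rs) = ⊥-elim (alone (first-step (connB⇒Reach adj v (conn-sym c))))
    where
    no-nbr : ∀ {x} → ¬ Adj v x
    no-nbr {x} a = subst T (outerIso-iso v x t) a
    alone : v ≡ r ⊎ ∃[ x ] Adj v x → ⊥
    alone (inj₁ refl) = no-nbr rs
    alone (inj₂ (x , a)) = no-nbr a

  -- Components that do not meet the outer face are drawn with some face outside, so `w` may contain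
  -- inner vertices. This only raises losses.
  record OuterWord : Set where
    field
      w : List V
      pl : Pl (allFin n) w
      bound : ∀ {v} → T (∂V v) → v ∈ w
      consecutive : ∀ {u v} → T (outerDart u v) → (u , v) ∈ darts w

  outerWord : OuterWord
  outerWord = record { w = w ; pl = toPl U ; bound = bound ; consecutive = cons }
    where
    U : Union outer (allFin n)
    U = union outer (allFin n)
    open Union U
    cons : ∀ {u v} → T (outerDart u v) → (u , v) ∈ darts w
    cons {u} o with parts (covers (∈-allFin u))
    ... | r , c , p , q , e = subst (λ z → _ ∈ darts z) (sym e) (darts-infix p (outer-darts r c o))
    bound : ∀ {v} → T (∂V v) → v ∈ w
    bound {v} t with T-∨⁻ {outerIso v} t
    ... | inj₂ o = let x , y = anyV⁻ (outerDart v) o in proj₁ (darts-ends w (cons y))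
    ... | inj₁ i with parts (covers (∈-allFin v))
    ...   | r , c , p , q , e = subst (v ∈_) (sym e) (∈-++⁺ʳ p (∈-++⁺ˡ (outer-iso r c i)))

-- Deleting S

Ends-∃ : ∀ {X : Set} {x : X} {l} → Ends x l → ∃[ l' ] l ≡ l' ++ [ x ]
Ends-∃ end = [] , refl
Ends-∃ (more {y} e) = let l' , q = Ends-∃ e in y ∷ l' , cong (y ∷_) q

unique₃ : ∀ {X : Set} {a t c : X} → Unique (a ∷ t ∷ c ∷ []) → a ≢ t × a ≢ c × t ≢ c
unique₃ ((p ∷ q ∷ []) ∷ (r ∷ []) ∷ _) = p , q , r

unique₃⁺ : ∀ {X : Set} {a t c : X} → a ≢ t → a ≢ c → t ≢ c → Unique (a ∷ t ∷ c ∷ [])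
unique₃⁺ p q r = (p ∷ q ∷ []) ∷ (r ∷ []) ∷ [] ∷ []

darts-init : ∀ {X : Set} {t u v : X} l → (u , v) ∈ darts (l ++ [ t ]) → v ≢ t → (u , v) ∈ darts l
darts-init (x ∷ []) (here refl) ne = ⊥-elim (ne refl)
darts-init (x ∷ y ∷ l) (here refl) ne = here refl
darts-init (x ∷ y ∷ l) (there i) ne = there (darts-init (y ∷ l) i ne)

module Final {n : ℕ} (G : PlaneGraph n) (S I : Fin n → Bool)
  (consecutive : Consecutive G S) (small : # S ≤ 3)
  (I-outer : ∀ v → T (I v) → T (PlaneGraph.∂V G v ∧ not (S v)))
  (I-indep : ∀ u v → T (I u) → T (I v) → T (not (PlaneGraph.adj G u v)))
  (I-deg : ∀ v → T (I v) → degIn (PlaneGraph.adj G) S v ≢ 3) where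

  open PlaneGraph G using (graph; adj; outerDart; outerDart-adj; ∂V; ∂E)
  open Discs graph
  open Weak graph
  open Planar graph
  open Instances graph
  open Whole G
  open Main graph everyRoot using (theorem)
  open OuterWord outerWord renaming (pl to pl₀; consecutive to consec)

  deg : V → ℕ
  deg = degIn adj S

  full : List V
  full = allFin n

  every : ∀ {v} → v ∈ full
  every = ∈-allFin _

  alive : List V
  alive = satisfying (λ v → not (S v))

  not⁺ : ∀ {b} → ¬ T b → T (not b)
  not⁺ {true} k = k tt
  not⁺ {false} _ = tt

  not⁻ : ∀ {b} → T (not b) → ¬ T b
  not⁻ {false} _ ()

  alive⁺ : ∀ {v} → ¬ T (S v) → v ∈ alive
  alive⁺ k = satisfying⁺ {p = λ v → not (S v)} (not⁺ k)

  alive⁻ : ∀ {v} → v ∈ alive → ¬ T (S v)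
  alive⁻ i = not⁻ (satisfying⁻ {p = λ v → not (S v)} i)

  Il : List V
  Il = satisfying I

  -- This is `4 - f` for the function of the theorem, because `I` lies on the outer boundary.
  c₀ : V → ℕ
  c₀ v = deg v + ⟦ decT (∂V v) ⟧ + ⟦ decT (I v) ⟧

  deg-≤ : ∀ {v} L → (∀ {x} → T (S x) → Adj v x → x ∈ L) → deg v ≤ length (filter (λ t → adj? t v) L)
  deg-≤ {v} L f = #-≤ {p = λ x → S x ∧ adj v x} λ {x} t → ∈-filter⁺ (λ t → adj? t v) (f (T-∧ˡ t) (T-∧ʳ {S x} t)) (Adj-sym (T-∧ʳ {S x} t))

  count-∷ : ∀ t L v → length (filter (λ t → adj? t v) (t ∷ L)) ≡ ⟦ adj? t v ⟧ + length (filter (λ t → adj? t v) L)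
  count-∷ t L v with adj? t v
  ... | yes _ = refl
  ... | no _ = refl

  deg₃ : ∀ {v a b c X Y Z} → (∀ {x} → T (S x) → Adj v x → x ∈ a ∷ b ∷ c ∷ []) →
    (Adj a v → v ∈ X) → (Adj b v → v ∈ Y) → (Adj c v → v ∈ Z) → deg v ≤ ι v X + ι v Y + ι v Z
  deg₃ {v} {a} {b} {c} {X} {Y} {Z} f p q r = ≤-trans (deg-≤ (a ∷ b ∷ c ∷ []) f)
    (≤-trans (≤-reflexive (trans (count-∷ a (b ∷ [ c ]) v) (trans (cong (λ z → ⟦ adj? a v ⟧ + z) (trans (count-∷ b [ c ] v) (cong (λ z → ⟦ adj? b v ⟧ + z) (count-∷ c [] v)))) (s ⟦ adj? a v ⟧ ⟦ adj? b v ⟧ ⟦ adj? c v ⟧))))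
      (+-mono-≤ (+-mono-≤ (⟦⟧-mono (adj? a v) (v ∈? X) p) (⟦⟧-mono (adj? b v) (v ∈? Y) q)) (⟦⟧-mono (adj? c v) (v ∈? Z) r)))
    where
    s : ∀ a b c → a + (b + (c + 0)) ≡ a + b + c
    s = solve-∀

  deg₂ : ∀ {v b c Y Z} → (∀ {x} → T (S x) → Adj v x → x ∈ b ∷ c ∷ []) → (Adj b v → v ∈ Y) → (Adj c v → v ∈ Z) → deg v ≤ ι v Y + ι v Z
  deg₂ {v} {b} {c} {Y} {Z} f q r = ≤-trans (deg-≤ (b ∷ c ∷ []) f)
    (≤-trans (≤-reflexive (trans (count-∷ b [ c ] v) (cong (λ z → ⟦ adj? b v ⟧ + z) (trans (count-∷ c [] v) (+-identityʳ _)))))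
      (+-mono-≤ (⟦⟧-mono (adj? b v) (v ∈? Y) q) (⟦⟧-mono (adj? c v) (v ∈? Z) r)))

  deg₁ : ∀ {v c Z} → (∀ {x} → T (S x) → Adj v x → x ∈ c ∷ []) → (Adj c v → v ∈ Z) → deg v ≤ ι v Z
  deg₁ {v} {c} {Z} f r = ≤-trans (deg-≤ (c ∷ []) f) (≤-trans (≤-reflexive (trans (count-∷ c [] v) (+-identityʳ _))) (⟦⟧-mono (adj? c v) (v ∈? Z) r))

  ∂-I : ∀ {v} → T (I v) → T (∂V v)
  ∂-I {v} i = T-∧ˡ (I-outer v i)

  -- The passage to the general instance: its boundary may exceed the outer face and its segments
  -- may overcount neighbours in `S`, and `mono` then returns to `c₀`.
  piece : ∀ {B X₁ X₂ X₃ P} → Pl B (X₁ ++ X₂ ++ X₃ ++ P) → (∀ {v} → v ∈ B → T (∂V v) → v ∈ P) →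
    (∀ {v} → v ∈ B → deg v ≤ ι v X₁ + ι v X₂ + ι v X₃) →
    (∀ {v} → v ∈ B → T (I v) → v ∈ X₁ → v ∈ X₂ → v ∈ X₃ → ⊥) → W B c₀
  piece {B} {X₁} {X₂} {X₃} {P} p onP d no3 = mono id id
      (λ {v} b → +-mono-≤ (+-mono-≤ (d b) (⟦⟧-mono (decT (∂V v)) (v ∈? P) (onP b))) (⟦⟧-mono (decT (I v)) (v ∈? I') (λ i → ∈-filter⁺ (_∈? P) (satisfying⁺ {p = I} i) (onP b (∂-I i)))))
      (theorem record { pl = p ; I⊆P = λ i → proj₂ (I⁻ i)
        ; indep = λ {u} {v} i j a → not⁻ (I-indep u v (satisfying⁻ (proj₁ (I⁻ i))) (satisfying⁻ (proj₁ (I⁻ j)))) a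
        ; no3 = λ b i → no3 b (satisfying⁻ (proj₁ (I⁻ i))) })
    where
    I' : List V
    I' = filter (_∈? P) Il
    I⁻ : ∀ {u} → u ∈ I' → u ∈ Il × u ∈ P
    I⁻ = ∈-filter⁻ (_∈? P)

  deg≤3 : ∀ v → deg v ≤ 3
  deg≤3 v = ≤-trans (#-≤ {p = λ x → S x ∧ adj v x} {xs = satisfying S} (λ t → satisfying⁺ {p = S} (T-∧ˡ t))) (≤-trans (≤-reflexive (satisfying-length S)) small)

  three-nbrs : ∀ {v a b c} → Unique (a ∷ b ∷ c ∷ []) → T (S a) → T (S b) → T (S c) → T (I v) → Adj a v → Adj b v → Adj c v → ⊥
  three-nbrs {v} u sa sb sc i av bv cv = I-deg v i (≤-antisym
      (deg≤3 v)
      (#-≥ {p = λ x → S x ∧ adj v x} u λ { (here refl) → T-∧ sa (Adj-sym av) ; (there (here refl)) → T-∧ sb (Adj-sym bv) ; (there (there (here refl))) → T-∧ sc (Adj-sym cv) }))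

  aliveIff : ∀ {A} → (∀ {v} → v ∈ A → ¬ T (S v)) → (∀ {v} → ¬ T (S v) → v ∈ A) → W A c₀ → W alive c₀
  aliveIff f g = mono (λ i → alive⁺ (f i)) (λ i → g (alive⁻ i)) (λ _ → ≤-refl)

  join : ∀ {A B C} → (∀ {v} → v ∈ A → v ∈ B ⊎ v ∈ C) → (∀ {v} → v ∈ B → v ∈ A) → (∀ {v} → v ∈ C → v ∈ A) → Disjoint B C →
    (∀ {v t} → v ∈ C → t ∈ B → ¬ Adj t v) → (∀ {v} → v ∈ C → c₀ v ≤ 4) → W B c₀ → W C c₀ → W A c₀
  join spl b c dj sep le = compose (λ _ → []) spl b c dj (λ _ → ≤-refl) (λ i j a → ⊥-elim (sep i j a))
    (λ i → ≤-reflexive (+-identityʳ _) , le i)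

  S-list : List V
  S-list = satisfying S

  c₀≤4 : ∀ {v} → ¬ T (S v) → c₀ v ≤ 4
  c₀≤4 {v} _ with decT (I v)
  ... | no _ = ≤-trans (≤-reflexive (+-identityʳ _)) (+-mono-≤ (deg≤3 v) (⟦⟧≤1 (decT (∂V v))))
  ... | yes i = +-mono-≤ (+-mono-≤ (strict (deg≤3 v) (I-deg v i)) (⟦⟧≤1 (decT (∂V v)))) ≤-refl
    where
    strict : ∀ {k} → k ≤ 3 → k ≢ 3 → k ≤ 2
    strict {zero} _ _ = z≤n
    strict {suc zero} _ _ = s≤s z≤n
    strict {suc (suc zero)} _ _ = s≤s (s≤s z≤n)
    strict {suc (suc (suc zero))} _ ne = ⊥-elim (ne refl)
    strict {suc (suc (suc (suc _)))} (s≤s (s≤s (s≤s ()))) _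

  Pl-dup : ∀ {A v w} → v ∈ A → Pl A (v ∷ w) → Pl A (v ∷ v ∷ w)
  Pl-dup {A} {v} {w} i p = record
    { disc = subst (Disc _ _) (sym (trans (filter-accept (_∈? A) {xs = v ∷ w} i) (cong (v ∷_) (filter-accept (_∈? A) {xs = w} i))))
        (dup (subst (Disc _ _) (filter-accept (_∈? A) {xs = w} i) (Pl.disc p)))
    ; alive = Pl.alive p ; full = Pl.full p }

  case₀ : (∀ {x} → ¬ T (S x)) → W alive c₀
  case₀ none = aliveIff {full} (λ _ → none) (λ _ → every)
    (piece {X₁ = []} {[]} {[]} pl₀ (λ _ → bound) (λ {v} _ → deg-≤ {v} [] (λ s _ → ⊥-elim (none s))) (λ _ _ ()))

  case₁ : ∀ {s} → T (S s) → (∀ {x} → T (S x) → x ∈ [ s ]) → W alive c₀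
  case₁ {s} ss only with ∈-∃++ (bound (proj₁ consecutive s ss))
  ... | x , y , e = go (deleteV every (Pl-rot x (subst (Pl full) e pl₀)))
    where
    go : Single full s (y ++ x) → W alive c₀
    go record { Y = Y ; pl = plY ; exposed = ex } = aliveIff {full ∖ s} (λ i t → proj₂ (∖⁻ i) (∈-one (only t))) (λ k → ∖⁺ every (λ { refl → k ss }))
      (piece {X₁ = []} {[]} {Y} plY onP (λ _ → deg₁ (λ t _ → only t) (ex every)) (λ _ _ ()))
      where
      onP : ∀ {v} → v ∈ full ∖ s → T (∂V v) → v ∈ y ++ x
      onP i t with ∈-++⁻ x (subst (_ ∈_) e (bound t))
      ... | inj₁ j = ∈-++⁺ʳ y j
      ... | inj₂ (here q) = ⊥-elim (proj₂ (∖⁻ i) q)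
      ... | inj₂ (there j) = ∈-++⁺ˡ j

  case₂ : ∀ {s t} → s ≢ t → T (S s) → T (S t) → (∀ {x} → T (S x) → x ∈ s ∷ t ∷ []) → (s , t) ∈ darts w → W alive c₀
  case₂ {s} {t} s≢t ss st only st∈ with darts-∃ w st∈
  ... | x , y , e = go (deleteV every (cast ((⟨ [ t ] ⟩ ⊕ ⟨ y ⟩) ⊕ ⟨ x ⟩ ⊕ ⟨ [ s ] ⟩) (⟨ [ t ] ⟩ ⊕ ⟨ y ⟩ ⊕ ⟨ x ⟩ ⊕ ⟨ [ s ] ⟩) refl
            (Pl-rot (x ++ [ s ]) (subst (Pl full) (trans e (sym (++-assoc x [ s ] (t ∷ y)))) pl₀))))
    where
    go : Single full t (y ++ x ++ [ s ]) → W alive c₀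
    go record { Y = Y ; pl = plY ; exposed = exY } = go' (deleteV (∖⁺ every s≢t)
        (Pl-rot (Y ++ y ++ x) (cast (⟨ Y ⟩ ⊕ ⟨ y ⟩ ⊕ ⟨ x ⟩ ⊕ ⟨ [ s ] ⟩) ((⟨ Y ⟩ ⊕ ⟨ y ⟩ ⊕ ⟨ x ⟩) ⊕ ⟨ [ s ] ⟩) refl plY)))
      where
      go' : Single (full ∖ t) s (Y ++ y ++ x) → W alive c₀
      go' record { Y = X ; pl = plX ; exposed = exX } = aliveIff {full ∖ t ∖ s} notS (λ k → ∖⁺ (∖⁺ every (λ { refl → k st })) (λ { refl → k ss }))
        (piece {X₁ = []} {X} {Y} plX onP (λ i → deg₂ (λ t _ → only t) (exX (∖⊆ i)) (exY every)) (λ _ _ ()))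
        where
        notS : ∀ {v} → v ∈ full ∖ t ∖ s → ¬ T (S v)
        notS i sv with only sv
        ... | here q = proj₂ (∖⁻ i) q
        ... | there (here q) = proj₂ (∖⁻ (∖⊆ i)) q
        onP : ∀ {v} → v ∈ full ∖ t ∖ s → T (∂V v) → v ∈ y ++ x
        onP i b with ∈-++⁻ x (subst (_ ∈_) e (bound b))
        ... | inj₁ j = ∈-++⁺ʳ y j
        ... | inj₂ (here q) = ⊥-elim (proj₂ (∖⁻ i) q)
        ... | inj₂ (there (here q)) = ⊥-elim (proj₂ (∖⁻ (∖⊆ i)) q)
        ... | inj₂ (there (there j)) = ∈-++⁺ˡ j

  -- t is the middle vertex of S; its removal between two of its outer corners
  -- leaves two independent pieces.
  module Three {a t c : V} (u : Unique (a ∷ t ∷ c ∷ [])) (sa : T (S a)) (st : T (S t)) (sc : T (S c))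
    (only : ∀ {x} → T (S x) → x ∈ a ∷ t ∷ c ∷ []) where

    a≢t : a ≢ t
    a≢t = proj₁ (unique₃ u)
    a≢c : a ≢ c
    a≢c = proj₁ (proj₂ (unique₃ u))
    t≢c : t ≢ c
    t≢c = proj₂ (proj₂ (unique₃ u))

    -- `s` stands at one end of its stretch of the boundary, next to the neighbourhood of `t`, so
    -- the two segments are adjacent in the word as an instance requires. The other end vertex `s'`
    -- of `S` has no neighbours in this piece.
    endPiece : ∀ {B Y s s'} p₁ p₂ → p₁ ≡ [] ⊎ p₂ ≡ [] → Pl B ((p₁ ++ s ∷ p₂) ++ Y) → s ∈ B →
      (∀ {v} → v ∈ B → T (∂V v) → v ∈ p₁ ++ s ∷ p₂) → (∀ {v} → v ∈ B → Adj t v → v ∈ Y) →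
      (∀ {x} → T (S x) → x ≡ s ⊎ x ≡ t ⊎ x ≡ s') → (∀ {v} → v ∈ B → ¬ Adj v s') → W (B ∖ s) c₀
    endPiece {B} {Y} {s} {s'} p₁ p₂ ends p sB onB exY onl noS' = go ends (deleteV sB (cast ((⟨ [ s ] ⟩ ⊕ ⟨ p₂ ⟩ ⊕ ⟨ Y ⟩) ⊕ ⟨ p₁ ⟩) (⟨ [ s ] ⟩ ⊕ ⟨ p₂ ⟩ ⊕ ⟨ Y ⟩ ⊕ ⟨ p₁ ⟩) refl
        (Pl-rot p₁ (cast ((⟨ p₁ ⟩ ⊕ ⟨ [ s ] ⟩ ⊕ ⟨ p₂ ⟩) ⊕ ⟨ Y ⟩) (⟨ p₁ ⟩ ⊕ ⟨ [ s ] ⟩ ⊕ ⟨ p₂ ⟩ ⊕ ⟨ Y ⟩) refl p))))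
      where
      inST : ∀ {v} → v ∈ B ∖ s → ∀ {x} → T (S x) → Adj v x → x ∈ s ∷ t ∷ []
      inST i sx a with onl sx
      ... | inj₁ e = here e
      ... | inj₂ (inj₁ e) = there (here e)
      ... | inj₂ (inj₂ refl) = ⊥-elim (noS' (∖⊆ i) a)
      off : ∀ {v} → v ≢ s → v ∈ p₁ ++ s ∷ p₂ → v ∈ p₁ ++ p₂
      off ne i with ∈-++⁻ p₁ i
      ... | inj₁ j = ∈-++⁺ˡ j
      ... | inj₂ (here e) = ⊥-elim (ne e)
      ... | inj₂ (there j) = ∈-++⁺ʳ p₁ j
      go : p₁ ≡ [] ⊎ p₂ ≡ [] → Single B s (p₂ ++ Y ++ p₁) → W (B ∖ s) c₀
      go (inj₁ e) record { Y = X ; pl = plX ; exposed = exX } = piece {X₁ = []} {Y} {X} {p₁ ++ p₂}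
            (subst (λ z → Pl _ (Y ++ X ++ z ++ p₂)) (sym e) (cast ((⟨ Y ⟩ ⊕ ⟨ [] ⟩) ⊕ (⟨ X ⟩ ⊕ ⟨ p₂ ⟩)) (⟨ Y ⟩ ⊕ ⟨ X ⟩ ⊕ ⟨ p₂ ⟩) refl (Pl-rot (X ++ p₂)
              (cast (⟨ X ⟩ ⊕ ⟨ p₂ ⟩ ⊕ ⟨ Y ⟩ ⊕ ⟨ [] ⟩) ((⟨ X ⟩ ⊕ ⟨ p₂ ⟩) ⊕ ⟨ Y ⟩ ⊕ ⟨ [] ⟩) refl (subst (λ z → Pl _ (X ++ p₂ ++ Y ++ z)) e plX)))))
            (λ i b → off (proj₂ (∖⁻ i)) (onB (∖⊆ i) b))
            (λ {v} i → ≤-trans (deg₂ (inST i) (exX (∖⊆ i)) (exY (∖⊆ i))) (≤-reflexive (+-comm (ι v X) (ι v Y))))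
            (λ _ _ ())
      go (inj₂ e) record { Y = X ; pl = plX ; exposed = exX } = piece {X₁ = []} {X} {Y} {p₁ ++ p₂}
            (subst (λ z → Pl _ (X ++ Y ++ p₁ ++ z)) (sym e) (cast (⟨ X ⟩ ⊕ ⟨ Y ⟩ ⊕ ⟨ p₁ ⟩) (⟨ X ⟩ ⊕ ⟨ Y ⟩ ⊕ ⟨ p₁ ⟩ ⊕ ⟨ [] ⟩) refl (subst (λ z → Pl _ (X ++ z ++ Y ++ p₁)) e plX)))
            (λ i b → off (proj₂ (∖⁻ i)) (onB (∖⊆ i) b))
            (λ i → deg₂ (inST i) (exX (∖⊆ i)) (exY (∖⊆ i)))
            (λ _ _ ())

    module Sides {p q : List V} (cov : ∀ {v} → T (∂V v) → v ≢ t → v ∈ p ⊎ v ∈ q) (sp : Split full t p q) where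
      open Split sp

      onP₁ : ∀ {v} → v ∈ A₁ → T (∂V v) → v ∈ p
      onP₁ i b with cov b (proj₂ (sub₁ i))
      ... | inj₁ j = j
      ... | inj₂ j = ⊥-elim (disj i (in₂ j every (proj₂ (sub₁ i))))

      onP₂ : ∀ {v} → v ∈ A₂ → T (∂V v) → v ∈ q
      onP₂ i b with cov b (proj₂ (sub₂ i))
      ... | inj₂ j = j
      ... | inj₁ j = ⊥-elim (disj (in₁ j every (proj₂ (sub₂ i))) i)

    -- The corners of `t` separate the end vertices of `S`, so each side sees only `t` and one of
    -- them.
    apart : ∀ {s₁ s₂ α₁ β₁ α₂ β₂} → (∀ {v} → T (∂V v) → v ≢ t → v ∈ α₁ ++ s₁ ∷ β₁ ⊎ v ∈ α₂ ++ s₂ ∷ β₂) → Split full t (α₁ ++ s₁ ∷ β₁) (α₂ ++ s₂ ∷ β₂) →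
      (∀ {x} → T (S x) → x ≡ s₁ ⊎ x ≡ t ⊎ x ≡ s₂) → T (S s₁) → T (S s₂) → s₁ ≢ t → s₂ ≢ t →
      α₁ ≡ [] ⊎ β₁ ≡ [] → α₂ ≡ [] ⊎ β₂ ≡ [] → W alive c₀
    apart {s₁} {s₂} {α₁} {β₁} {α₂} {β₂} cov sp onl S₁ S₂ s₁≢t s₂≢t e₁ e₂ =
      join spl (λ i → alive⁺ (n₁ i)) (λ i → alive⁺ (n₂ i))
        (λ i j → disj (∖⊆ i) (∖⊆ j)) (λ i j a → sep (∖⊆ j) (∖⊆ i) a) (λ i → c₀≤4 (n₂ i))
        (endPiece {s' = s₂} α₁ β₁ e₁ pl₁ s₁∈ onP₁ exposed₁ onl (λ i → sep i s₂∈))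
        (endPiece {s' = s₁} α₂ β₂ e₂ pl₂ s₂∈ onP₂ exposed₂ (swap ∘ onl) (λ i a → sep s₁∈ i (Adj-sym a)))
      where
      open Split sp
      open Sides cov sp
      s₁∈ : s₁ ∈ A₁
      s₁∈ = in₁ (∈-insert α₁) every s₁≢t
      s₂∈ : s₂ ∈ A₂
      s₂∈ = in₂ (∈-insert α₂) every s₂≢t
      swap : ∀ {x} → x ≡ s₁ ⊎ x ≡ t ⊎ x ≡ s₂ → x ≡ s₂ ⊎ x ≡ t ⊎ x ≡ s₁
      swap = [ inj₂ ∘ inj₂ , [ inj₂ ∘ inj₁ , inj₁ ]′ ]′
      n₁ : ∀ {v} → v ∈ A₁ ∖ s₁ → ¬ T (S v)
      n₁ i sv with onl sv
      ... | inj₁ e = proj₂ (∖⁻ i) e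
      ... | inj₂ (inj₁ e) = proj₂ (sub₁ (∖⊆ i)) e
      ... | inj₂ (inj₂ refl) = disj (∖⊆ i) s₂∈
      n₂ : ∀ {v} → v ∈ A₂ ∖ s₂ → ¬ T (S v)
      n₂ i sv with onl sv
      ... | inj₁ refl = disj s₁∈ (∖⊆ i)
      ... | inj₂ (inj₁ e) = proj₂ (sub₂ (∖⊆ i)) e
      ... | inj₂ (inj₂ e) = proj₂ (∖⁻ i) e
      spl : ∀ {v} → v ∈ alive → v ∈ A₁ ∖ s₁ ⊎ v ∈ A₂ ∖ s₂
      spl {v} i = Sum.map (λ j → ∖⁺ j (λ { refl → ns S₁ })) (λ j → ∖⁺ j (λ { refl → ns S₂ })) (cover every (λ { refl → ns st }))
        where
        ns : ¬ T (S v)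
        ns = alive⁻ i

    -- Both end vertices lie on the side whose word is `s₂`, `β`, `s₁`, followed by the neighbours
    -- of `t`. Deleting them turns this cyclic word into N(`s₁`) N(`t`) N(`s₂`) `β`, an instance
    -- with three deleted vertices. The other side sees only `t`.
    together : ∀ {s₁ s₂ p β} → (∀ {v} → T (∂V v) → v ≢ t → v ∈ p ⊎ v ∈ s₂ ∷ β ++ [ s₁ ]) → Split full t p (s₂ ∷ β ++ [ s₁ ]) →
      (∀ {x} → T (S x) → x ∈ s₁ ∷ t ∷ s₂ ∷ []) → T (S s₁) → T (S s₂) → Unique (s₁ ∷ t ∷ s₂ ∷ []) → W alive c₀
    together {s₁} {s₂} {p} {β} cov sp onl S₁ S₂ uq@((s₁≢t ∷ s₁≢s₂ ∷ []) ∷ (t≢s₂ ∷ []) ∷ _) = go (deleteV s₂∈ (cast ((⟨ [ s₂ ] ⟩ ⊕ ⟨ β ⟩ ⊕ ⟨ [ s₁ ] ⟩) ⊕ ⟨ Y₂ ⟩) (⟨ [ s₂ ] ⟩ ⊕ ⟨ β ⟩ ⊕ ⟨ [ s₁ ] ⟩ ⊕ ⟨ Y₂ ⟩) refl pl₂))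
      where
      open Split sp
      open Sides cov sp
      s₂∈ : s₂ ∈ A₂
      s₂∈ = in₂ (here refl) every (t≢s₂ ∘ sym)
      s₁∈ : s₁ ∈ A₂
      s₁∈ = in₂ (there (∈-insert β)) every s₁≢t
      n₁ : ∀ {v} → v ∈ A₁ → ¬ T (S v)
      n₁ i sv with onl sv
      ... | here refl = disj i s₁∈
      ... | there (here e) = proj₂ (sub₁ i) e
      ... | there (there (here refl)) = disj i s₂∈
      n₂ : ∀ {v} → v ∈ A₂ ∖ s₂ ∖ s₁ → ¬ T (S v)
      n₂ i sv with onl sv
      ... | here e = proj₂ (∖⁻ i) e
      ... | there (here e) = proj₂ (sub₂ (∖⊆ (∖⊆ i))) e
      ... | there (there (here e)) = proj₂ (∖⁻ (∖⊆ i)) e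
      only-t : ∀ {v} → v ∈ A₁ → ∀ {x} → T (S x) → Adj v x → x ∈ [ t ]
      only-t i sx a with onl sx
      ... | here refl = ⊥-elim (sep i s₁∈ a)
      ... | there (here e) = here e
      ... | there (there (here refl)) = ⊥-elim (sep i s₂∈ a)
      side : W A₁ c₀
      side = piece {X₁ = []} {[]} {Y₁} {p} (Pl-rot p pl₁) onP₁ (λ i → deg₁ (only-t i) (exposed₁ i)) (λ _ _ ())
      spl : ∀ {v} → v ∈ alive → v ∈ A₁ ⊎ v ∈ A₂ ∖ s₂ ∖ s₁
      spl {v} i = Sum.map id (λ j → ∖⁺ (∖⁺ j (λ { refl → ns S₂ })) (λ { refl → ns S₁ })) (cover every (λ { refl → ns st }))
        where
        ns : ¬ T (S v)
        ns = alive⁻ i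
      go : Single A₂ s₂ (β ++ [ s₁ ] ++ Y₂) → W alive c₀
      go record { Y = X ; pl = plX ; exposed = exX ; nbr = nbX } = go' (deleteV (∖⁺ s₁∈ s₁≢s₂)
          (cast ((⟨ [ s₁ ] ⟩ ⊕ ⟨ Y₂ ⟩) ⊕ (⟨ X ⟩ ⊕ ⟨ β ⟩)) (⟨ [ s₁ ] ⟩ ⊕ ⟨ Y₂ ⟩ ⊕ ⟨ X ⟩ ⊕ ⟨ β ⟩) refl (Pl-rot (X ++ β) (cast (⟨ X ⟩ ⊕ ⟨ β ⟩ ⊕ ⟨ [ s₁ ] ⟩ ⊕ ⟨ Y₂ ⟩) ((⟨ X ⟩ ⊕ ⟨ β ⟩) ⊕ ⟨ [ s₁ ] ⟩ ⊕ ⟨ Y₂ ⟩) refl plX))))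
        where
        go' : Single (A₂ ∖ s₂) s₁ (Y₂ ++ X ++ β) → W alive c₀
        go' record { Y = Z ; pl = plZ ; exposed = exZ ; nbr = nbZ } =
          join spl (λ i → alive⁺ (n₁ i)) (λ i → alive⁺ (n₂ i))
            (λ i j → disj i (∖⊆ (∖⊆ j))) (λ i j a → sep j (∖⊆ (∖⊆ i)) a) (λ i → c₀≤4 (n₂ i)) side
            (piece {X₁ = Z} {Y₂} {X} {β} plZ onβ (λ i → deg₃ (λ sx _ → onl sx) (exZ (∖⊆ i)) (exposed₂ (∖⊆ (∖⊆ i))) (exX (∖⊆ (∖⊆ i))))
              (λ _ iv z y x → three-nbrs uq S₁ st S₂ iv (nbZ z) (nbr₂ y) (nbX x)))
          where
          onβ : ∀ {v} → v ∈ A₂ ∖ s₂ ∖ s₁ → T (∂V v) → v ∈ β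
          onβ i b with onP₂ (∖⊆ (∖⊆ i)) b
          ... | here e = ⊥-elim (proj₂ (∖⁻ (∖⊆ i)) e)
          ... | there j with ∈-++⁻ β j
          ...   | inj₁ k = k
          ...   | inj₂ (here e) = ⊥-elim (proj₂ (∖⁻ i) e)

    word-from : ∀ {x s y} → w ≡ x ++ s ∷ y → Pl full (s ∷ y ++ x)
    word-from {x} e = Pl-rot x (subst (Pl full) e pl₀)

    onl₁ : ∀ {x} → T (S x) → x ≡ c ⊎ x ≡ t ⊎ x ≡ a
    onl₁ s with only s
    ... | here e = inj₂ (inj₂ e)
    ... | there (here e) = inj₂ (inj₁ e)
    ... | there (there (here e)) = inj₁ e

    module AtT {x y} (e : w ≡ x ++ a ∷ t ∷ y) where
      z : List V
      z = y ++ x ++ [ a ]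
      w≡ : w ≡ (x ++ [ a ]) ++ t ∷ y
      w≡ = trans e (sym (++-assoc x [ a ] (t ∷ y)))
      plT : Pl full (t ∷ z)
      plT = word-from {x ++ [ a ]} w≡
      ends-z : Ends a (t ∷ z)
      ends-z = more (Ends-++ y (Ends-++ x end))
      -- The word of the whole graph is not one closed walk. Rotating it to start at this corner of
      -- `t` breaks the dart from `a` to `t`, and every other dart survives.
      turn : ∀ {u v} → (u , v) ∈ darts w → (u , v) ≢ (a , t) → (u , v) ∈ darts (t ∷ z)
      turn i ne with ∈-++⁻ (darts (x ++ [ a ])) (subst (_ ∈_) (trans (cong darts e) (darts-++ x)) i)
      ... | inj₁ j = darts-tail (t ∷ y) j
        where
        darts-tail : ∀ l {m} {d : V × V} → d ∈ darts m → d ∈ darts (l ++ m)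
        darts-tail l {m} j = subst (λ m → _ ∈ darts (l ++ m)) (++-identityʳ m) (darts-infix l j)
      ... | inj₂ (here q) = ⊥-elim (ne q)
      ... | inj₂ (there j) = darts-infix [] j
      on-z : ∀ {v} → T (∂V v) → v ≢ t → v ∈ z
      on-z b ne with ∈-++⁻ (x ++ [ a ]) (subst (_ ∈_) w≡ (bound b))
      ... | inj₁ j = ∈-++⁺ʳ y j
      ... | inj₂ (here q) = ⊥-elim (ne q)
      ... | inj₂ (there j) = ∈-++⁺ˡ j

    before : ∀ α {s β} → Ends a (α ++ t ∷ s ∷ β) → s ≢ a → Ends a β
    before α e ne with Ends-suffix α e
    ... | more end = ⊥-elim (ne refl)
    ... | more (more e') = e'

    -- The cut is made at the corner of `t` entered from `a` and the one left towards `c`;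
    -- cyclically, `c` follows the second and `a` precedes the first, so both are on one side.
    in-t : (a , t) ∈ darts w → (t , c) ∈ darts w → W alive c₀
    in-t at tc with darts-∃ w at
    ... | x , y , e with darts-∃ _ (AtT.turn e tc (λ q → a≢t (sym (cong proj₁ q))))
    ...   | p , β , e' = go p e'
      where
      open AtT e
      finish : ∀ α → Pl full (t ∷ α ++ t ∷ c ∷ β) → (∀ {v} → v ∈ z → v ≢ t → v ∈ α ⊎ v ∈ c ∷ β) → Ends a β → W alive c₀
      finish α pl on eβ = let β₀ , q = Ends-∃ eβ in
        together {β = β₀} (λ {v} b ne → subst (λ β → v ∈ α ⊎ v ∈ c ∷ β) q (on (on-z b ne) ne)) (subst (λ β → Split full t α (c ∷ β)) q (splitV α every pl)) only sa sc u
      go : ∀ p → t ∷ z ≡ p ++ t ∷ c ∷ β → W alive c₀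
      -- Both darts use the same corner of `t`; after doubling it, one of the two stretches is
      -- empty.
      go [] q = finish [] (Pl-dup every (subst (Pl full) q plT)) (λ i _ → inj₂ (subst (_ ∈_) (∷-injectiveʳ q) i)) (before [] (subst (Ends a) q ends-z) (a≢c ∘ sym))
      go (t' ∷ α) q with ∷-injectiveˡ q
      ... | refl = finish α (subst (Pl full) q plT) (λ i ne → off ne (∈-++⁻ α (subst (_ ∈_) (∷-injectiveʳ q) i))) (before (t ∷ α) (subst (Ends a) q ends-z) (a≢c ∘ sym))
        where
        off : ∀ {v} → v ≢ t → v ∈ α ⊎ v ∈ t ∷ c ∷ β → v ∈ α ⊎ v ∈ c ∷ β
        off ne (inj₁ i) = inj₁ i
        off ne (inj₂ (here e)) = ⊥-elim (ne e)
        off ne (inj₂ (there i)) = inj₂ i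

    -- Both edges are traversed towards `t`, so `a` and `c` each precede one of the two corners of
    -- `t` and are separated by the cut.
    in-in : (a , t) ∈ darts w → (c , t) ∈ darts w → W alive c₀
    in-in at ct with darts-∃ w at
    ... | x , y , e with darts-∃ _ (AtT.turn e ct (λ q → a≢c (sym (cong proj₁ q))))
    ...   | p , β , e' = go p e'
      where
      open AtT e
      go : ∀ p → t ∷ z ≡ p ++ c ∷ t ∷ β → W alive c₀
      go [] q = ⊥-elim (t≢c (∷-injectiveˡ q))
      go (t' ∷ α) q with ∷-injectiveˡ q
      ... | refl with Ends-∃ (last-a (Ends-suffix (t ∷ α) (subst (Ends a) q ends-z)))
        where
        last-a : Ends a (c ∷ t ∷ β) → Ends a β
        last-a (more end) = ⊥-elim (a≢t refl)
        last-a (more (more e)) = e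
      ...   | β₀ , eβ = apart {s₁ = c} {s₂ = a} {α} {[]} {β₀} {[]} (λ {v} b ne → subst (λ β → v ∈ α ++ [ c ] ⊎ v ∈ β) eβ (cov b ne))
            (subst (Split full t (α ++ [ c ])) eβ (splitV (α ++ [ c ]) every (subst (λ z → Pl full (t ∷ z)) q' plT))) onl₁ sc sa (t≢c ∘ sym) a≢t (inj₂ refl) (inj₂ refl)
        where
        q' : z ≡ (α ++ [ c ]) ++ t ∷ β
        q' = trans (∷-injectiveʳ q) (sym (++-assoc α [ c ] (t ∷ β)))
        cov : ∀ {v} → T (∂V v) → v ≢ t → v ∈ α ++ [ c ] ⊎ v ∈ β
        cov b ne with ∈-++⁻ (α ++ [ c ]) (subst (_ ∈_) q' (on-z b ne))
        ... | inj₁ i = inj₁ i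
        ... | inj₂ (here e) = ⊥-elim (ne e)
        ... | inj₂ (there i) = inj₂ i

    out-out : (t , a) ∈ darts w → (t , c) ∈ darts w → W alive c₀
    out-out ta tc with darts-∃ w ta
    ... | x , y , e with darts-∃ (t ∷ (a ∷ y) ++ x) turn
      where
      -- Rotating to the corner of `t` before `a` can only break a dart that ends in `t`.
      turn : (t , c) ∈ darts ((t ∷ a ∷ y) ++ x)
      turn with ∈-++⁻ (darts (x ++ [ t ])) (subst (_ ∈_) (trans (cong darts e) (darts-++ x)) tc)
      ... | inj₁ j = subst (λ m → (t , c) ∈ darts ((t ∷ a ∷ y) ++ m)) (++-identityʳ x) (darts-infix (t ∷ a ∷ y) (darts-init x j (t≢c ∘ sym)))
      ... | inj₂ j = darts-infix [] j
    ...   | p , β , e' = go p e'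
      where
      z : List V
      z = (a ∷ y) ++ x
      on-z : ∀ {v} → T (∂V v) → v ≢ t → v ∈ z
      on-z b ne with ∈-++⁻ x (subst (_ ∈_) e (bound b))
      ... | inj₁ j = ∈-++⁺ʳ (a ∷ y) j
      ... | inj₂ (here q) = ⊥-elim (ne q)
      ... | inj₂ (there j) = ∈-++⁺ˡ j
      go : ∀ p → t ∷ z ≡ p ++ t ∷ c ∷ β → W alive c₀
      go [] q = ⊥-elim (a≢c (∷-injectiveˡ (∷-injectiveʳ q)))
      go (t' ∷ []) q = ⊥-elim (a≢t (∷-injectiveˡ (∷-injectiveʳ q)))
      go (t' ∷ a' ∷ α) q with ∷-injectiveˡ q | ∷-injectiveˡ (∷-injectiveʳ q)
      ... | refl | refl = apart {s₁ = a} {s₂ = c} {[]} {α} {[]} {β} cov (splitV (a ∷ α) every (subst (Pl full) q (word-from {x} e))) onl sa sc a≢t (t≢c ∘ sym) (inj₁ refl) (inj₁ refl)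
        where
        onl : ∀ {x} → T (S x) → x ≡ a ⊎ x ≡ t ⊎ x ≡ c
        onl s with only s
        ... | here e = inj₁ e
        ... | there (here e) = inj₂ (inj₁ e)
        ... | there (there (here e)) = inj₂ (inj₂ e)
        cov : ∀ {v} → T (∂V v) → v ≢ t → v ∈ a ∷ α ⊎ v ∈ c ∷ β
        cov {v} b ne with ∈-++⁻ (a ∷ α) (subst (v ∈_) (∷-injectiveʳ q) (on-z b ne))
        ... | inj₁ i = inj₁ i
        ... | inj₂ (here e) = ⊥-elim (ne e)
        ... | inj₂ (there i) = inj₂ i

  Link : V → V → Set
  Link u v = T (S u ∧ S v ∧ ∂E u v)

  link-S : ∀ {u v} → Link u v → T (S v) × u ≢ v × (T (outerDart u v) ⊎ T (outerDart v u))
  link-S {u} {v} l = T-∧ˡ (T-∧ʳ {S u} l) , (λ { refl → Adj-irrefl ([ outerDart-adj u u , outerDart-adj u u ]′ o) }) , o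
    where
    o : T (outerDart u v) ⊎ T (outerDart v u)
    o = T-∨⁻ {outerDart u v} (T-∧ʳ {S v} (T-∧ʳ {S u} l))

  linked : ∀ {u v} → T (S u) → T (S v) → u ≢ v → ∃[ x ] Link u x
  linked {u} {v} su sv ne with first-step (connB⇒Reach _ u (proj₂ consecutive u v su sv))
  ... | inj₁ e = ⊥-elim (ne e)
  ... | inj₂ l = l

  case₃ : ∀ {a t c} → Unique (a ∷ t ∷ c ∷ []) → T (S a) → T (S t) → T (S c) → (∀ {x} → T (S x) → x ∈ a ∷ t ∷ c ∷ []) →
    T (outerDart a t) ⊎ T (outerDart t a) → T (outerDart t c) ⊎ T (outerDart c t) → W alive c₀
  case₃ {a} {t} {c} u sa st sc only = go
    where
    open Three u sa st sc only
    go : T (outerDart a t) ⊎ T (outerDart t a) → T (outerDart t c) ⊎ T (outerDart c t) → W alive c₀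
    go (inj₁ at) (inj₁ tc) = in-t (consec at) (consec tc)
    go (inj₁ at) (inj₂ ct) = in-in (consec at) (consec ct)
    go (inj₂ ta) (inj₁ tc) = out-out (consec ta) (consec tc)
    go (inj₂ ta) (inj₂ ct) = Three.in-t (unique₃⁺ (t≢c ∘ sym) (a≢c ∘ sym) (a≢t ∘ sym)) sc st sa
      (λ s → rev (only s)) (consec ct) (consec ta)
      where
      rev : ∀ {x} → x ∈ a ∷ t ∷ c ∷ [] → x ∈ c ∷ t ∷ a ∷ []
      rev (here e) = there (there (here e))
      rev (there (here e)) = there (here e)
      rev (there (there (here e))) = here e

  removable : W alive c₀
  removable = go S-list refl (satisfying-unique S)
    where
    inS : ∀ {x L} → S-list ≡ L → x ∈ L → T (S x)
    inS e i = satisfying⁻ {p = S} (subst (_ ∈_) (sym e) i)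
    ofS : ∀ {x L} → S-list ≡ L → T (S x) → x ∈ L
    ofS e s = subst (_ ∈_) e (satisfying⁺ {p = S} s)
    swap₂ : ∀ {s t x : V} → x ∈ s ∷ t ∷ [] → x ∈ t ∷ s ∷ []
    swap₂ (here e) = there (here e)
    swap₂ (there (here e)) = here e
    bca : ∀ {a b c x : V} → x ∈ a ∷ b ∷ c ∷ [] → x ∈ b ∷ a ∷ c ∷ []
    bca (here e) = there (here e)
    bca (there (here e)) = here e
    bca (there (there i)) = there (there i)
    acb : ∀ {a b c x : V} → x ∈ a ∷ b ∷ c ∷ [] → x ∈ a ∷ c ∷ b ∷ []
    acb (here e) = here e
    acb (there (here e)) = there (there (here e))
    acb (there (there (here e))) = there (here e)
    go : ∀ L → S-list ≡ L → Unique S-list → W alive c₀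
    go [] e _ = case₀ (λ s → nope (ofS e s))
      where
      nope : ∀ {x : V} → x ∉ []
      nope ()
    go (s ∷ []) e _ = case₁ (inS e (here refl)) (ofS e)
    go (s ∷ t ∷ []) e uq with subst Unique e uq
    ... | (s≢t ∷ []) ∷ _ with linked (inS e (here refl)) (inS e (there (here refl))) s≢t
    ...   | x , l with link-S l
    ...     | sx , ne , o with ofS e sx
    ...       | here q = ⊥-elim (ne (sym q))
    ...       | there (here refl) = [ (λ d → case₂ s≢t (inS e (here refl)) sx (ofS e) (consec d))
                                    , (λ d → case₂ (s≢t ∘ sym) sx (inS e (here refl)) (swap₂ ∘ ofS e) (consec d)) ]′ o
    go (a ∷ b ∷ c ∷ []) e uq = three (subst Unique e uq)
      where
      sa : T (S a)
      sa = inS e (here refl)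
      sb : T (S b)
      sb = inS e (there (here refl))
      sc : T (S c)
      sc = inS e (there (there (here refl)))
      In : V → Set
      In x = x ∈ a ∷ b ∷ c ∷ []
      Edge : V → V → Set
      Edge x y = T (outerDart x y) ⊎ T (outerDart y x)
      Next : V → Set
      Next x = ∃[ y ] (In y × x ≢ y × Edge x y)
      next : ∀ {x y} → T (S x) → T (S y) → x ≢ y → Next x
      next sx sy ne = let z , l = linked sx sy ne ; sz , nz , o = link-S l in z , ofS e sz , nz , o
      -- Each of the three vertices has a link to another one. Two different links share a vertex,
      -- and this is the middle of `S`.
      middle : a ≢ b → a ≢ c → b ≢ c → Next a → Next b → Next c → W alive c₀
      middle ab ac bc (_ , here q , n , _) _ _ = ⊥-elim (n (sym q))
      middle ab ac bc _ (_ , there (here q) , n , _) _ = ⊥-elim (n (sym q))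
      middle ab ac bc _ _ (_ , there (there (here q)) , n , _) = ⊥-elim (n (sym q))
      middle ab ac bc (_ , there (here refl) , _ , o) _ (_ , here refl , _ , o') = case₃ (unique₃⁺ (ab ∘ sym) bc ac) sb sa sc (bca ∘ ofS e) (Sum.swap o) (Sum.swap o')
      middle ab ac bc (_ , there (here refl) , _ , o) _ (_ , there (here refl) , _ , o') = case₃ (unique₃⁺ ab ac bc) sa sb sc (ofS e) o (Sum.swap o')
      middle ab ac bc (_ , there (there (here refl)) , _ , o) (_ , here refl , _ , o') _ = case₃ (unique₃⁺ (ab ∘ sym) bc ac) sb sa sc (bca ∘ ofS e) o' o
      middle ab ac bc (_ , there (there (here refl)) , _ , o) (_ , there (there (here refl)) , _ , o') _ = case₃ (unique₃⁺ ac ab (bc ∘ sym)) sa sc sb (acb ∘ ofS e) o (Sum.swap o')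
      three : Unique (a ∷ b ∷ c ∷ []) → W alive c₀
      three u = let ab , ac , bc = unique₃ u in middle ab ac bc (next sa sb ab) (next sb sa (ab ∘ sym)) (next sc sa (ac ∘ sym))
    go (a ∷ b ∷ c ∷ d ∷ L) e _ = ⊥-elim (tooMany (≤-trans (≤-reflexive (trans (cong length (sym e)) (satisfying-length S))) small))
      where
      tooMany : ∀ {k} → suc (suc (suc (suc k))) ≤ 3 → ⊥
      tooMany (s≤s (s≤s (s≤s ())))

  exact : ∀ x {d k} m → m ≡ d + k → x ℤ.+ + k ℤ.≤ (x ℤ.- + d) ℤ.+ + m
  exact x {d} {k} m refl = ℤP.≤-reflexive (sym (trans (ℤP.+-assoc x (ℤ.- + d) (+ (d + k))) (cong (λ z → x ℤ.+ z)
    (trans (sym (ℤP.+-assoc (ℤ.- + d) (+ d) (+ k))) (trans (cong (ℤ._+ + k) (ℤP.+-inverseˡ (+ d))) (ℤP.+-identityˡ (+ k)))))))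

  bounds : ∀ {v} → v ∈ alive → + 4 ℤ.≤ fBound G S I v ℤ.+ + c₀ v
  bounds {v} _ with ∂V v in eb | I v in ei
  ... | true | true = exact (+ 2) (deg v + 1 + 1) (s (deg v)) 
    where
    s : ∀ d → d + 1 + 1 ≡ d + 2
    s = solve-∀
  ... | true | false = exact (+ 3) (deg v + 1 + 0) (+-identityʳ (deg v + 1))
  ... | false | true = ⊥-elim (subst T eb (∂-I (subst T (sym ei) tt)))
  ... | false | false = exact (+ 4) (deg v + 0 + 0) (+-identityʳ (deg v + 0))

  weaklyDegenerate : WeaklyDeg adj (λ v → not (S v)) (fBound G S I)
  weaklyDegenerate = weaklyDeg removable (λ v → not (S v)) (fBound G S I) (satisfying⁺ {p = λ v → not (S v)}) (satisfying⁻ {p = λ v → not (S v)}) bounds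

theorem2p2 : ∀ {n : ℕ} (G : PlaneGraph n) (S I : Fin n → Bool) →
    Consecutive G S → # S ≤ 3 →
    (∀ v → T (I v) → T (PlaneGraph.∂V G v ∧ not (S v))) →
    (∀ u v → T (I u) → T (I v) → T (not (PlaneGraph.adj G u v))) →
    (∀ v → T (I v) → degIn (PlaneGraph.adj G) S v ≢ 3) →
    WeaklyDeg (PlaneGraph.adj G) (λ v → not (S v)) (fBound G S I)
theorem2p2 = Final.weaklyDegenerate
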